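{- Let $n$ be a positive integer and write $8n+17=3^{\beta}n_1$ with $n_1$ a positive integer and $3\nmid n_1$. Then $$t(1,1,3,12;n)=\sigma(n_1)-a(8n+17).$$
   Context: $\sigma(n)=\sum_{d\mid n,\,d\ge1}d$. The integers $a(n)$ ($n\ge1$) are defined by $q\prod_{k=1}^{\infty}(1-q^{2k})(1-q^{4k})(1-q^{6k})(1-q^{12k})=\sum_{n=1}^{\infty}a(n)q^n$ for $|q|<1$. For positive integers $a,b,c,d$ and a nonnegative integer $n$, $t(a,b,c,d;n)$ denotes the number of $(x,y,z,w)\in\mathbb Z^4$ with $n=a\frac{x(x-1)}2+b\frac{y(y-1)}2+c\frac{z(z-1)}2+d\frac{w(w-1)}2$. -}

module Defs where

open import Data.Nat as ℕ using (ℕ; zero; suc; _∸_)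
open import Data.Nat.Divisibility using (_∣?_)
open import Data.Integer as ℤ using (ℤ; +_; ∣_∣)
open import Data.List using (List; []; _∷_; map; filter; length; upTo; concatMap)
open import Data.Nat.ListAction using (sum)
open import Data.Bool using (true; false)
open import Relation.Nullary using (does)
open import Data.Product using (_×_; _,_)
open import Relation.Binary.PropositionalEquality using (_≡_)
import Data.Integer.Properties as ℤP
import Data.Nat.Properties as ℕP

σ : ℕ → ℕ
σ n = sum (filter (λ d → d ∣? n) (map suc (upTo n)))

Series : Set
Series = ℕ → ℤ

sumTo : (ℕ → ℤ) → ℕ → ℤ
sumTo f zero    = f zero
sumTo f (suc n) = sumTo f n ℤ.+ f (suc n)

_⊗_ : Series → Series → Series
(f ⊗ g) n = sumTo (λ i → f i ℤ.* g (n ∸ i)) n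

one : Series
one zero    = + 1
one (suc _) = + 0

oneMinusQ^ : ℕ → Series
oneMinusQ^ m zero = + 1
oneMinusQ^ m (suc j) with does (suc j ℕ.≟ m)
... | true  = ℤ.- (+ 1)
... | false = + 0

factor : ℕ → Series
factor k = oneMinusQ^ (2 ℕ.* k) ⊗ (oneMinusQ^ (4 ℕ.* k) ⊗ (oneMinusQ^ (6 ℕ.* k) ⊗ oneMinusQ^ (12 ℕ.* k)))

partialProd : ℕ → Series
partialProd zero    = one
partialProd (suc K) = partialProd K ⊗ factor (suc K)

-- a(n) = coefficient of q^n in q ∏_{k≥1} factor k.
-- For n ≥ 1 this is the coefficient of q^(n-1) in ∏_{k≥1} factor k; factors with
-- k ≥ n only affect degrees ≥ 2k > n-1, so the finite product up to k = n suffices.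
a : ℕ → ℤ
a zero    = + 0
a (suc m) = partialProd (suc m) m

-- x(x-1)/2 for x ∈ ℤ (always a natural number)
tri : ℤ → ℕ
tri x = ∣ x ℤ.* (x ℤ.- + 1) ∣ ℕ./ 2

-- integers -n, ..., n+1. Every x ∈ ℤ with x(x-1)/2 ≤ n lies in this range,
-- so all solutions of the representation problem are enumerated.
box : ℕ → List ℤ
box n = map (λ i → + i ℤ.- + n) (upTo (2 ℕ.* n ℕ.+ 2))

quads : List ℤ → List (ℤ × ℤ × ℤ × ℤ)
quads xs = concatMap (λ x → concatMap (λ y → concatMap (λ z → map (λ w → (x , y , z , w)) xs) xs) xs) xs

t : ℕ → ℕ → ℕ → ℕ → ℕ → ℕ
t a b c d n = length (filter (λ { (x , y , z , w) →
    (a ℕ.* tri x ℕ.+ b ℕ.* tri y ℕ.+ c ℕ.* tri z ℕ.+ d ℕ.* tri w) ℕ.≟ n })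
  (quads (box n)))

{-# OPTIONS --safe #-}

-- Put N = 8n + 17. Then t(1,1,3,12;n) is the number G of solutions of x² + 3z² + y² + 3w² = N
-- with z odd and w even, and if U = ∑ q^(x²+3z²) and T = ∑ (−1)^z q^(x²+3z²), the coefficient
-- of q^N in U² − T² is 4G.
--
-- Splitting T by the parity of x + z gives T = φ(−q⁴)φ(−q¹²) + 2qψ(−q²)ψ(−q⁶). Since
-- φ(−X²)ψ(−X) = ∏ (1 − X^k)(1 − X^2k), the coefficient of q^N in T² is 4a(N).
--
-- The coefficients of U are read off from the norm form x² + xy + y², which represents m ≥ 1 exactly
-- 6A(m) times, where A(m) = ∑_{d ∣ m} χ(d) and χ is the nontrivial character mod 3. Indeed both sides
-- satisfy f(pm) = (1 + χ(p)) f(m) − χ(p) f(m/p) for primes p. On the representation side this is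
-- inclusion–exclusion over the sublattices x ≡ hy (mod p) with h² + h + 1 ≡ 0 (mod p), on each of which
-- the form divided by p is again equivalent to the norm form. Hence the coefficient of q^N in U² is
-- 4A(N) + 12 ∑ A(i) A(N − i). As χ(a)χ(b) = F(a − b) − F(a + b) with F the indicator of 3ℤ, Liouville's
-- bijection (a, x, b, y) ↦ (a + b, x, b, y − x) between solutions of ax + by = N evaluates the
-- convolution, and the coefficient comes out as 4σ(n₁).
module Submission where

open import Algebra.Bundles using (CommutativeRing)
import Algebra.Properties.CommutativeSemiring.Exp
import Algebra.Properties.Ring
import Algebra.Solver.Ring.NaturalCoefficients.Default
open import Data.Nat as ℕ using (ℕ; zero; suc)
import Data.Nat.Properties as ℕP
import Data.Nat.Tactic.RingSolver as ℕSolver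
open import Data.Product using (∃; _,_)
import Relation.Binary.PropositionalEquality as ≡
import Relation.Binary.Reasoning.Setoid

-- The product formula for φ(-X²)ψ(-X) is obtained without the Jacobi triple product. The finite sum
-- `W n z` equals a product times a truncated theta series at one special argument, while modulo `z`
-- it is a product alone; the special arguments being high powers, congruences modulo powers of `X`
-- replace limits, and every series enters through finitely many coefficients. In T² = (E + 2V)²,
-- with `E` supported on even and `V` on odd exponents, an odd coefficient sees only the cross term
-- 4EV: this is the 4 in 4a(N). In U² an odd N splits into an even and an odd summand; the
-- coefficient of `U` is 6A at positive even and 2A at odd indices, whence the uniform 12, and the
-- constant term 1 of `U` produces 4A(N). For p ≡ 1 (mod 3) a root h of h² + h + 1 has to be
-- produced, and for p ≡ 2 excluded. Both follow by counting: x ↦ -1/(1 + x) has order three on p -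
-- 2 residues, and its fixed points are the roots, so their number is p - 2 modulo 3.

module ThetaProducts {c ℓ} (R : CommutativeRing c ℓ) where

  open CommutativeRing R
  open Algebra.Solver.Ring.NaturalCoefficients.Default commutativeSemiring
  open Algebra.Properties.CommutativeSemiring.Exp commutativeSemiring
  open Algebra.Properties.Ring ring using (-1*x≈-x; -‿distribʳ-*)
  open Relation.Binary.Reasoning.Setoid setoid

  -- Congruences modulo a principal ideal

  infix 4 _≈_[mod_]

  _≈_[mod_] : Carrier → Carrier → Carrier → Set _
  f ≈ g [mod m ] = ∃ λ h → f ≈ g + m * h

  ≈⇒mod : ∀ {f g m} → f ≈ g → f ≈ g [mod m ]
  ≈⇒mod {f} {g} {m} e = 0# , trans e (solve 2 (λ g m → g := g :+ m :* con 0) refl g m)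

  mod-trans : ∀ {f g h m} → f ≈ g [mod m ] → g ≈ h [mod m ] → f ≈ h [mod m ]
  mod-trans {f} {g} {h} {m} (u , p) (v , q) = v + u , (begin
    f                   ≈⟨ p ⟩
    g + m * u           ≈⟨ +-congʳ q ⟩
    h + m * v + m * u   ≈⟨ solve 4 (λ h m u v → h :+ m :* v :+ m :* u := h :+ m :* (v :+ u)) refl h m u v ⟩
    h + m * (v + u)     ∎)

  mod-sym : ∀ {f g m} → f ≈ g [mod m ] → g ≈ f [mod m ]
  mod-sym {f} {g} {m} (u , p) = - u , (begin
    g                       ≈⟨ solve 2 (λ g m → g := g :+ m :* con 0) refl g m ⟩
    g + m * 0#              ≈⟨ +-congˡ (*-congˡ (sym (-‿inverseʳ u))) ⟩
    g + m * (u - u)         ≈⟨ solve 4 (λ g m u v → g :+ m :* (u :+ v) := g :+ m :* u :+ m :* v) refl g m u (- u) ⟩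
    g + m * u + m * - u     ≈⟨ +-congʳ (sym p) ⟩
    f + m * - u             ∎)

  mod-* : ∀ {f f′ g g′ m} → f ≈ g [mod m ] → f′ ≈ g′ [mod m ] → f * f′ ≈ g * g′ [mod m ]
  mod-* {f} {f′} {g} {g′} {m} (u , p) (v , q) = g * v + u * (g′ + m * v) , (begin
    f * f′                          ≈⟨ *-cong p q ⟩
    (g + m * u) * (g′ + m * v)      ≈⟨ solve 5 (λ g g′ m u v → (g :+ m :* u) :* (g′ :+ m :* v) := g :* g′ :+ m :* (g :* v :+ u :* (g′ :+ m :* v))) refl g g′ m u v ⟩
    g * g′ + m * (g * v + u * (g′ + m * v)) ∎)

  mod-weaken : ∀ {f g m k} → f ≈ g [mod m * k ] → f ≈ g [mod m ]
  mod-weaken {f} {g} {m} {k} (u , p) = k * u , trans p (+-congˡ (*-assoc m k u))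

  mod-resp : ∀ {f g m m′} → m ≈ m′ → f ≈ g [mod m ] → f ≈ g [mod m′ ]
  mod-resp e (u , p) = u , trans p (+-congˡ (*-congʳ e))

  private
    -- Induction on `m`: once δ is a multiple of X^m, the term X v δ is a multiple of X^(m+1), and
    -- so is δ = (1 + X v) δ - X v δ.
    divide-unit : ∀ X v m δ h → (1# + X * v) * δ ≈ X ^ m * h → ∃ λ e → δ ≈ X ^ m * e
    divide-unit X v zero    δ h p = δ , sym (*-identityˡ δ)
    divide-unit X v (suc m) δ h p
      with divide-unit X v m δ (X * h) (trans p (solve 3 (λ x y h → x :* y :* h := y :* (x :* h)) refl X (X ^ m) h))
    ... | e , q = h + - (v * e) , (begin
      δ                                             ≈⟨ solve 1 (λ d → d := d :+ con 0) refl δ ⟩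
      δ + 0#                                        ≈⟨ +-congˡ (trans (sym (zeroʳ _)) (*-congˡ (sym (-‿inverseʳ (v * e))))) ⟩
      δ + X ^ suc m * (v * e + - (v * e))           ≈⟨ solve 6 (λ d x y v e n → d :+ x :* y :* (v :* e :+ n) := (d :+ x :* v :* (y :* e)) :+ x :* y :* n) refl δ X (X ^ m) v e (- (v * e)) ⟩
      δ + X * v * (X ^ m * e) + X ^ suc m * - (v * e) ≈⟨ +-congʳ (+-congˡ (*-congˡ (sym q))) ⟩
      δ + X * v * δ + X ^ suc m * - (v * e)         ≈⟨ +-congʳ (solve 3 (λ x v d → d :+ x :* v :* d := (con 1 :+ x :* v) :* d) refl X v δ) ⟩
      (1# + X * v) * δ + X ^ suc m * - (v * e)      ≈⟨ +-congʳ p ⟩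
      X ^ suc m * h + X ^ suc m * - (v * e)         ≈⟨ sym (distribˡ _ _ _) ⟩
      X ^ suc m * (h + - (v * e))                   ∎)

  -- Plays the part of division by an invertible power series: an element that is 1 modulo `X` can
  -- be cancelled modulo every power of `X`.
  mod-cancel : ∀ {X D f g} m → D ≈ 1# [mod X ] → D * f ≈ D * g [mod X ^ m ] → f ≈ g [mod X ^ m ]
  mod-cancel {X} {D} {f} {g} m (v , r) (h , p)
    with divide-unit X v m (f + - g) h (begin
      (1# + X * v) * (f + - g)        ≈⟨ *-congʳ (sym r) ⟩
      D * (f + - g)                   ≈⟨ distribˡ _ _ _ ⟩
      D * f + D * - g                 ≈⟨ +-congʳ p ⟩
      D * g + X ^ m * h + D * - g     ≈⟨ solve 4 (λ d g n y → d :* g :+ y :+ d :* n := y :+ d :* (g :+ n)) refl D g (- g) (X ^ m * h) ⟩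
      X ^ m * h + D * (g + - g)       ≈⟨ +-congˡ (trans (*-congˡ (-‿inverseʳ g)) (zeroʳ D)) ⟩
      X ^ m * h + 0#                  ≈⟨ +-identityʳ _ ⟩
      X ^ m * h                       ∎)
  ... | e , q = e , (begin
      f                     ≈⟨ sym (+-identityʳ f) ⟩
      f + 0#                ≈⟨ +-congˡ (sym (-‿inverseˡ g)) ⟩
      f + (- g + g)         ≈⟨ solve 3 (λ f n g → f :+ (n :+ g) := g :+ (f :+ n)) refl f (- g) g ⟩
      g + (f + - g)         ≈⟨ +-congˡ q ⟩
      g + X ^ m * e         ∎)

  -- Finite products and their interpolation with theta series

  ∏ : (ℕ → Carrier) → ℕ → Carrier
  ∏ f zero    = 1#
  ∏ f (suc n) = f n * ∏ f n

  ∏-* : ∀ f g n → ∏ (λ k → f k * g k) n ≈ ∏ f n * ∏ g n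
  ∏-* f g zero    = sym (*-identityˡ 1#)
  ∏-* f g (suc n) = trans (*-congˡ (∏-* f g n))
    (solve 4 (λ a b c d → a :* b :* (c :* d) := a :* c :* (b :* d)) refl (f n) (g n) (∏ f n) (∏ g n))

  ∏-cong : ∀ {f g} n → (∀ k → f k ≈ g k) → ∏ f n ≈ ∏ g n
  ∏-cong zero    e = refl
  ∏-cong (suc n) e = *-cong (e n) (∏-cong n e)

  -- The extra factors have index at least `n`, so each of them is already 1 modulo X^(n+1).
  ∏-tail : ∀ X f n m → (∀ k → f k ≈ 1# [mod X ^ suc k ]) → ∏ f (m ℕ.+ n) ≈ ∏ f n [mod X ^ suc n ]
  ∏-tail X f n zero    e = ≈⇒mod refl
  ∏-tail X f n (suc m) e =
    mod-trans (mod-* (mod-weaken (mod-resp exponent (e (m ℕ.+ n)))) (∏-tail X f n m e)) (≈⇒mod (*-identityˡ _))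
    where
    exponent : X ^ suc (m ℕ.+ n) ≈ X ^ suc n * X ^ m
    exponent = trans (^-congʳ X (≡.cong suc (ℕP.+-comm m n))) (^-homo-* X (suc n) m)

  -- W n z = ∑_{s ≤ n} (∏_{s ≤ k < n} α k) (∏_{k < s} β k) z^s interpolates between an infinite
  -- product (z → 0) and a theta series (z a suitable power of Q).
  module Interpolation (Q κ : Carrier) where

    α β : ℕ → Carrier
    α k = 1# + - Q ^ suc k
    β k = 1# + κ * Q ^ k

    W : ℕ → Carrier → Carrier
    W zero    z = 1#
    W (suc n) z = α n * W n z + ∏ β (suc n) * z ^ suc n

    α+Q≈1 : ∀ k → α k + Q ^ suc k ≈ 1#
    α+Q≈1 k = trans (+-assoc _ _ _) (trans (+-congˡ (-‿inverseˡ _)) (+-identityʳ 1#))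

    -- A q-difference equation in `z`, with an explicit boundary term because the sum is finite. In
    -- the induction step α n + Q^(n+1) = 1 merges two multiples of the old boundary term into the
    -- last summand of `W (suc n) z`, and the remaining 1 + κ Q^(n+1) is the next factor of `∏ β`.
    W-shift : ∀ n z → (1# + κ * z) * W n (Q * z) + z * W n z ≈ W n z + ∏ β (suc n) * z ^ suc n
    W-shift zero    z = solve 2 (λ k z → (con 1 :+ k :* z) :* con 1 :+ z :* con 1 :=
      con 1 :+ (con 1 :+ k :* con 1) :* con 1 :* (z :* con 1)) refl κ z
    W-shift (suc n) z = begin
      (1# + κ * z) * (A * W′ + B * (Q * z) ^ suc n) + z * (A * V + B * z′)
        ≈⟨ +-congʳ (*-congˡ (+-congˡ (*-congˡ (^-distrib-* Q z (suc n))))) ⟩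
      (1# + κ * z) * (A * W′ + B * (P * z′)) + z * (A * V + B * z′)
        ≈⟨ solve 8 (λ k z A W′ B P z′ V → (con 1 :+ k :* z) :* (A :* W′ :+ B :* (P :* z′)) :+ z :* (A :* V :+ B :* z′) :=
             A :* ((con 1 :+ k :* z) :* W′ :+ z :* V) :+ (B :* (P :* z′) :* (con 1 :+ k :* z) :+ z :* (B :* z′))) refl κ z A W′ B P z′ V ⟩
      A * ((1# + κ * z) * W′ + z * V) + (B * (P * z′) * (1# + κ * z) + z * (B * z′))
        ≈⟨ +-congʳ (*-congˡ (W-shift n z)) ⟩
      A * (V + B * z′) + (B * (P * z′) * (1# + κ * z) + z * (B * z′))
        ≈⟨ solve 7 (λ k z A B P z′ V → A :* (V :+ B :* z′) :+ (B :* (P :* z′) :* (con 1 :+ k :* z) :+ z :* (B :* z′)) :=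
             (A :* V :+ (A :+ P) :* (B :* z′)) :+ (con 1 :+ k :* P) :* B :* (z :* z′)) refl κ z A B P z′ V ⟩
      (A * V + (A + P) * (B * z′)) + (1# + κ * P) * B * (z * z′)
        ≈⟨ +-congʳ (+-congˡ (trans (*-congʳ (α+Q≈1 n)) (*-identityˡ _))) ⟩
      (A * V + B * z′) + (1# + κ * P) * B * (z * z′) ∎
      where
      A W′ B P z′ V : Carrier
      A = α n
      W′ = W n (Q * z)
      B = ∏ β (suc n)
      P = Q ^ suc n
      z′ = z ^ suc n
      V = W n z

    -- For κ z = -Q^(n+1) the coefficient `α n` in the definition of `W (suc n)` becomes 1 + κ z,
    -- which is exactly what `W-shift` needs to replace `W n (Q * z)` by `W n z`. The element `w` is
    -- -z, kept as a separate variable so that the identities live over a semiring.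
    W-step : ∀ n z w → z + w ≈ 0# → κ * z + Q ^ suc n ≈ 0# →
      W (suc n) (Q * z) ≈ (1# + w) * W n z + ∏ β (suc n) * z ^ suc n * (1# + Q ^ suc n)
    W-step n z w zw kz = begin
      A * W′ + B * (Q * z) ^ suc n             ≈⟨ +-cong (*-congʳ A≈) (*-congˡ (^-distrib-* Q z (suc n))) ⟩
      (1# + κ * z) * W′ + B * (P * z′)         ≈⟨ +-congʳ (trans (sym (+-identityʳ _)) (+-congˡ (sym (trans (*-congʳ zw) (zeroˡ V))))) ⟩
      (1# + κ * z) * W′ + (z + w) * V + B * (P * z′)
        ≈⟨ solve 8 (λ k z W′ B P z′ V w → (con 1 :+ k :* z) :* W′ :+ (z :+ w) :* V :+ B :* (P :* z′) :=
             ((con 1 :+ k :* z) :* W′ :+ z :* V) :+ (w :* V :+ B :* (P :* z′))) refl κ z W′ B P z′ V w ⟩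
      ((1# + κ * z) * W′ + z * V) + (w * V + B * (P * z′))
        ≈⟨ +-congʳ (W-shift n z) ⟩
      (V + B * z′) + (w * V + B * (P * z′))
        ≈⟨ solve 5 (λ B P z′ V w → (V :+ B :* z′) :+ (w :* V :+ B :* (P :* z′)) :=
             (con 1 :+ w) :* V :+ B :* z′ :* (con 1 :+ P)) refl B P z′ V w ⟩
      (1# + w) * V + B * z′ * (1# + P) ∎
      where
      A W′ B P z′ V : Carrier
      A = α n
      W′ = W n (Q * z)
      B = ∏ β (suc n)
      P = Q ^ suc n
      z′ = z ^ suc n
      V = W n z
      A≈ : A ≈ 1# + κ * z
      A≈ = begin
        A                     ≈⟨ sym (+-identityʳ A) ⟩
        A + 0#                ≈⟨ +-congˡ (sym kz) ⟩
        A + (κ * z + P)       ≈⟨ solve 3 (λ A k P → A :+ (k :+ P) := (A :+ P) :+ k) refl A (κ * z) P ⟩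
        (A + P) + κ * z       ≈⟨ +-congʳ (α+Q≈1 n) ⟩
        1# + κ * z            ∎

    -- Only the term s = 0 of the sum carries no factor `z`.
    W-mod : ∀ n z → W n z ≈ ∏ α n [mod z ]
    W-mod zero    z = ≈⇒mod refl
    W-mod (suc n) z with W-mod n z
    ... | h , p = α n * h + ∏ β (suc n) * z ^ n , (begin
      α n * W n z + ∏ β (suc n) * (z * z ^ n)        ≈⟨ +-congʳ (*-congˡ p) ⟩
      α n * (∏ α n + z * h) + ∏ β (suc n) * (z * z ^ n)
        ≈⟨ solve 6 (λ a p z h b y → a :* (p :+ z :* h) :+ b :* (z :* y) := a :* p :+ z :* (a :* h :+ b :* y)) refl (α n) (∏ α n) z h (∏ β (suc n)) (z ^ n) ⟩
      α n * ∏ α n + z * (α n * h + ∏ β (suc n) * z ^ n) ∎)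

  sgn : ℕ → Carrier
  sgn k = (- 1#) ^ k

  private
    neg-^ : ∀ x k → (- x) ^ k ≈ sgn k * x ^ k
    neg-^ x k = trans (^-congˡ k (sym (-1*x≈-x x))) (^-distrib-* (- 1#) x k)

    sq-^ : ∀ x k → (x * x) ^ k ≈ x ^ (k ℕ.+ k)
    sq-^ x k = trans (^-distrib-* x x k) (sym (^-homo-* x k k))

    *-neg : ∀ x y → x * - y ≈ - (x * y)
    *-neg x y = sym (-‿distribʳ-* x y)

  -- φ(−Q) = ∑ (−1)^s Q^(s²) and ψ(−X) = ∑ (−1)^s X^(2s²+s), truncated to |s| ≤ n.
  Φ Ψ : Carrier → ℕ → Carrier
  Φ Q zero    = 1#
  Φ Q (suc n) = sgn (suc n) * Q ^ (suc n ℕ.* suc n) + (sgn (suc n) * Q ^ (suc n ℕ.* suc n) + Φ Q n)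
  Ψ X zero    = 1#
  Ψ X (suc n) = sgn (suc n) * X ^ (suc n ℕ.* (2 ℕ.* n ℕ.+ 3)) + (sgn (suc n) * X ^ (suc n ℕ.* (2 ℕ.* n ℕ.+ 1)) + Ψ X n)

  module _ (Q κ : Carrier) where

    open Interpolation Q κ

    W-cong : ∀ n {z z′} → z ≈ z′ → W n z ≈ W n z′
    W-cong zero    e = refl
    W-cong (suc n) e = +-cong (*-congˡ (W-cong n e)) (*-congˡ (^-congˡ (suc n) e))

  -- `W-step` with κ = 1 at z = -Q^(n+1), whose next argument Q z is -Q^(n+2). The factor β 0 = 2
  -- doubles the boundary term, and the two copies are the theta terms s = n + 1 and s = -(n + 1).
  Φ-product : ∀ Q n → ∏ (λ k → 1# + Q ^ suc k) n * Φ Q n ≈ Interpolation.W Q 1# n (- Q ^ suc n)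
  Φ-product Q zero    = *-identityˡ 1#
  Φ-product Q (suc n) = sym (begin
    W (suc n) (- (Q * Q ^ suc n))   ≈⟨ W-cong Q 1# (suc n) (sym (*-neg Q _)) ⟩
    W (suc n) (Q * z)               ≈⟨ W-step n z (Q ^ suc n) (-‿inverseˡ _) (trans (+-congʳ (*-identityˡ z)) (-‿inverseˡ _)) ⟩
    (1# + P) * W n z + ∏ β (suc n) * z ^ suc n * (1# + P)
      ≈⟨ +-cong (*-congˡ (sym (Φ-product Q n))) (*-congʳ (*-cong (doubled n) (trans (neg-^ P (suc n)) (*-congˡ (^-assocʳ Q (suc n) (suc n)))))) ⟩
    (1# + P) * (p * Φ Q n) + (1# + 1#) * p * u * (1# + P)
      ≈⟨ solve 4 (λ P p f t → (con 1 :+ P) :* (p :* f) :+ (con 1 :+ con 1) :* p :* t :* (con 1 :+ P) :=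
           (con 1 :+ P) :* p :* (t :+ (t :+ f))) refl P p (Φ Q n) u ⟩
    (1# + P) * p * (u + (u + Φ Q n)) ∎)
    where
    open Interpolation Q 1#
    z P p u : Carrier
    z = - Q ^ suc n
    P = Q ^ suc n
    p = ∏ (λ k → 1# + Q ^ suc k) n
    u = sgn (suc n) * Q ^ (suc n ℕ.* suc n)
    doubled : ∀ m → ∏ β (suc m) ≈ (1# + 1#) * ∏ (λ k → 1# + Q ^ suc k) m
    doubled zero    = solve 0 ((con 1 :+ con 1 :* con 1) :* con 1 := (con 1 :+ con 1) :* con 1) refl
    doubled (suc m) = trans (*-congˡ (doubled m))
      (solve 2 (λ x y → (con 1 :+ con 1 :* x) :* ((con 1 :+ con 1) :* y) := (con 1 :+ con 1) :* ((con 1 :+ x) :* y)) refl (Q ^ suc m) _)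

  -- `W-step` with nome X² and κ = X at z = -X^(2n+1). Here the boundary term carries the factor 1 +
  -- Q^(n+1), whose two summands give the exponents 2s² + s at s = -(n + 1) and s = n + 1.
  Ψ-product : ∀ X n → ∏ (λ k → 1# + X * (X * X) ^ k) n * Ψ X n ≈ Interpolation.W (X * X) X n (- (X * (X * X) ^ n))
  Ψ-product X zero    = *-identityˡ 1#
  Ψ-product X (suc n) = sym (begin
    W (suc n) (- (X * (Q * Q ^ n)))
      ≈⟨ W-cong Q X (suc n) (trans (-‿cong (solve 3 (λ x q y → x :* (q :* y) := q :* (x :* y)) refl X Q (Q ^ n))) (sym (*-neg Q _))) ⟩
    W (suc n) (Q * z)
      ≈⟨ W-step n z x (-‿inverseˡ _) (trans (+-cong (*-neg X x) (*-assoc X X (Q ^ n))) (-‿inverseˡ _)) ⟩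
    (1# + x) * W n z + (1# + x) * p * z ^ suc n * (1# + Q ^ suc n)
      ≈⟨ +-congʳ (*-congˡ (sym (Ψ-product X n))) ⟩
    (1# + x) * (p * Ψ X n) + (1# + x) * p * z ^ suc n * (1# + Q ^ suc n)
      ≈⟨ solve 5 (λ x p f t P → (con 1 :+ x) :* (p :* f) :+ (con 1 :+ x) :* p :* t :* (con 1 :+ P) :=
           (con 1 :+ x) :* p :* (t :* P :+ (t :+ f))) refl x p (Ψ X n) (z ^ suc n) (Q ^ suc n) ⟩
    (1# + x) * p * (z ^ suc n * Q ^ suc n + (z ^ suc n + Ψ X n))
      ≈⟨ *-congˡ (+-cong upper (+-congʳ lower)) ⟩
    (1# + x) * p * Ψ X (suc n) ∎)
    where
    Q : Carrier
    Q = X * X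
    open Interpolation Q X
    x z p : Carrier
    x = X * Q ^ n
    z = - x
    p = ∏ (λ k → 1# + X * Q ^ k) n
    x≈ : x ≈ X ^ (2 ℕ.* n ℕ.+ 1)
    x≈ = trans (*-congˡ (sq-^ X n)) (^-congʳ X (exponent n))
      where
      exponent : ∀ n → suc (n ℕ.+ n) ≡.≡ 2 ℕ.* n ℕ.+ 1
      exponent = ℕSolver.solve-∀
    lower : z ^ suc n ≈ sgn (suc n) * X ^ (suc n ℕ.* (2 ℕ.* n ℕ.+ 1))
    lower = trans (neg-^ x (suc n)) (*-congˡ (trans (^-congˡ (suc n) x≈)
      (trans (^-assocʳ X (2 ℕ.* n ℕ.+ 1) (suc n)) (^-congʳ X (ℕP.*-comm (2 ℕ.* n ℕ.+ 1) (suc n))))))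
    upper : z ^ suc n * Q ^ suc n ≈ sgn (suc n) * X ^ (suc n ℕ.* (2 ℕ.* n ℕ.+ 3))
    upper = trans (*-cong lower (sq-^ X (suc n))) (trans (*-assoc _ _ _)
      (*-congˡ (trans (sym (^-homo-* X (suc n ℕ.* (2 ℕ.* n ℕ.+ 1)) (suc n ℕ.+ suc n))) (^-congʳ X (exponent n)))))
      where
      exponent : ∀ n → suc n ℕ.* (2 ℕ.* n ℕ.+ 1) ℕ.+ (suc n ℕ.+ suc n) ≡.≡ suc n ℕ.* (2 ℕ.* n ℕ.+ 3)
      exponent = ℕSolver.solve-∀

  -- Euler products and the theta product formula

  euler : Carrier → ℕ → Carrier
  euler X = ∏ (λ k → 1# + - X ^ suc k)

  module _ (X : Carrier) where

    private
      Q : Carrier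
      Q = X * X

      divisible : ∀ k → Q ^ suc k ≈ X ^ suc k * X ^ suc k
      divisible k = ^-distrib-* X X (suc k)

      -- The exponents 2k + 2 and 2k + 1 with k < n exhaust 1, ..., 2n.
      odd-even : ∀ n → ∏ (λ k → 1# + Q ^ suc k) n * ∏ (λ k → 1# + X * Q ^ k) n ≈ ∏ (λ k → 1# + X ^ suc k) (n ℕ.+ n)
      odd-even zero    = *-identityˡ 1#
      odd-even (suc n) rewrite ℕP.+-suc n n = begin
        (1# + Q ^ suc n) * ∏ (λ k → 1# + Q ^ suc k) n * ((1# + X * Q ^ n) * ∏ (λ k → 1# + X * Q ^ k) n)
          ≈⟨ solve 4 (λ a b c d → a :* b :* (c :* d) := a :* (c :* (b :* d))) refl _ _ _ _ ⟩
        (1# + Q ^ suc n) * ((1# + X * Q ^ n) * (∏ (λ k → 1# + Q ^ suc k) n * ∏ (λ k → 1# + X * Q ^ k) n))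
          ≈⟨ *-cong (+-congˡ (trans (*-congˡ (sq-^ X n)) (*-assoc X X _))) (*-cong (+-congˡ (*-congˡ (sq-^ X n))) (odd-even n)) ⟩
        (1# + X ^ suc (suc (n ℕ.+ n))) * ((1# + X ^ suc (n ℕ.+ n)) * ∏ (λ k → 1# + X ^ suc k) (n ℕ.+ n)) ∎

      plus : ℕ → Carrier
      plus n = ∏ (λ k → 1# + X ^ suc k) n

      plus≈1 : ∀ n → plus n ≈ 1# [mod X ]
      plus≈1 zero    = ≈⇒mod refl
      plus≈1 (suc n) = mod-trans (mod-* (X ^ n , refl) (plus≈1 n)) (≈⇒mod (*-identityˡ 1#))

      plus-euler : ∀ n → plus n * euler X n ≈ euler Q n
      plus-euler n = trans (sym (∏-* _ _ n)) (∏-cong n factor′)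
        where
        factor′ : ∀ k → (1# + X ^ suc k) * (1# + - X ^ suc k) ≈ 1# + - Q ^ suc k
        factor′ k = begin
          (1# + x) * (1# + - x)             ≈⟨ solve 2 (λ x y → (con 1 :+ x) :* (con 1 :+ y) := con 1 :+ (x :+ y) :+ x :* y) refl x (- x) ⟩
          1# + (x + - x) + x * - x          ≈⟨ +-cong (trans (+-congˡ (-‿inverseʳ x)) (+-identityʳ 1#)) (*-neg x x) ⟩
          1# + - (x * x)                    ≈⟨ +-congˡ (-‿cong (sym (divisible k))) ⟩
          1# + - Q ^ suc k                  ∎
          where
          x : Carrier
          x = X ^ suc k

      euler-tail : ∀ n → euler X (n ℕ.+ n) ≈ euler X n [mod X ^ suc n ]
      euler-tail n = ∏-tail X _ n n (λ k → - 1# , +-congˡ (trans (sym (-1*x≈-x _)) (*-comm _ _)))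

      euler²-tail : ∀ n → euler Q (n ℕ.+ n) ≈ euler Q n [mod X ^ suc n ]
      euler²-tail n = ∏-tail X _ n n (λ k → - X ^ suc k , +-congˡ (trans (-‿cong (divisible k)) (sym (*-neg _ _))))

    -- φ(−X²) ψ(−X) = ∏ (1 − X^k)(1 − X^2k): both sides become ∏ (1 − X^2k)² after multiplication by ∏ (1 + X^k).
    theta-product : ∀ n → Φ Q n * Ψ X n ≈ euler X n * euler Q n [mod X ^ suc n ]
    -- The multiplier that clears both theta series has 2n factors, by `odd-even`. The Euler
    -- products are therefore compared at length 2n and only afterwards cut back to length n.
    theta-product n = mod-trans (mod-cancel (suc n) (plus≈1 (n ℕ.+ n)) (mod-trans thetas (mod-sym eulers)))
      (mod-* (euler-tail n) (euler²-tail n))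
      where
      thetas : plus (n ℕ.+ n) * (Φ Q n * Ψ X n) ≈ euler Q n * euler Q n [mod X ^ suc n ]
      thetas = mod-trans (≈⇒mod (begin
        plus (n ℕ.+ n) * (Φ Q n * Ψ X n)   ≈⟨ *-congʳ (sym (odd-even n)) ⟩
        _ * _ * (Φ Q n * Ψ X n)            ≈⟨ solve 4 (λ a b c d → a :* b :* (c :* d) := a :* c :* (b :* d)) refl _ _ _ _ ⟩
        _ * Φ Q n * (_ * Ψ X n)            ≈⟨ *-cong (Φ-product Q n) (Ψ-product X n) ⟩
        Interpolation.W Q 1# n (- Q ^ suc n) * Interpolation.W Q X n (- (X * Q ^ n)) ∎))
        -- Both special arguments, -X^(2n+2) and -X^(2n+1), are multiples of X^(n+1); modulo that
        -- power each `W` shrinks to its product of `α`, which is `euler Q n`.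
        (mod-* (mod-weaken (mod-resp (trans (-‿cong (divisible n)) (sym (*-neg _ _))) (Interpolation.W-mod Q 1# n _)))
               (mod-weaken (mod-resp (trans (-‿cong (trans (*-congˡ (^-distrib-* X X n)) (sym (*-assoc _ _ _)))) (sym (*-neg _ _))) (Interpolation.W-mod Q X n _))))
      eulers : plus (n ℕ.+ n) * (euler X (n ℕ.+ n) * euler Q (n ℕ.+ n)) ≈ euler Q n * euler Q n [mod X ^ suc n ]
      eulers = mod-trans (≈⇒mod (trans (sym (*-assoc _ _ _)) (*-congʳ (plus-euler (n ℕ.+ n)))))
        (mod-* (euler²-tail n) (euler²-tail n))

module Representations where

  import Algebra.Construct.Pointwise
  import Algebra.Properties.AbelianGroup
  open import Data.Bool as Bool using (true; false)
  open import Data.Empty using (⊥; ⊥-elim)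
  open import Data.Integer as ℤ using (ℤ; +_; -[1+_]; ∣_∣; _+_; _*_; -_; _-_)
  open import Data.Integer.DivMod using (_/ℕ_; _%ℕ_; a≡a%ℕn+[a/ℕn]*n; n%ℕd<d)
  open import Data.Integer.Divisibility.Signed
    using (_∣_; divides; _∣?_; ∣ᵤ⇒∣; ∣⇒∣ᵤ; ∣m⇒∣-m; ∣m+n∣m⇒∣n; ∣m∣n⇒∣m+n; ∣m∣n⇒∣m-n; ∣n⇒∣m*n; ∣m⇒∣m*n;
      ∣-refl)
  open import Data.Integer.Properties as ℤP
    using (pos-*; +-injective; -1*i≡-i; abs-*; neg-involutive; ∣-i∣≡∣i∣; neg-injective; m-n≡m⊖n; ⊖-≥;
      +-inverseʳ; +-identityˡ; neg-distribˡ-*)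
  open import Data.Integer.Tactic.RingSolver using (solve-∀)
  open import Data.List using (List; []; _∷_; map; filter; length; upTo; concatMap; _++_; cartesianProduct)
  open import Data.List.Membership.Propositional using (_∈_; find; lose)
  open import Data.List.Membership.Propositional.Properties
    using (∈-cartesianProduct⁺; ∈-cartesianProduct⁻; ∈-map⁺; ∈-upTo⁺)
  open import Data.List.Relation.Unary.All as All using (All)
  open import Data.List.Relation.Unary.AllPairs using ([]; _∷_)
  open import Data.List.Relation.Unary.Any using (here; there; any?)
  open import Data.List.Relation.Unary.Unique.Propositional using (Unique)
  open import Data.List.Relation.Unary.Unique.Propositional.Properties as UniqueP using (cartesianProduct⁺)
  open import Data.Nat as ℕ using (ℕ; zero; suc; _∸_; _≤_; _<_; z≤n; s≤s; s≤s⁻¹; _≟_; _≤?_; _<?_)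
  import Data.Nat.Coprimality as Coprimality
  import Data.Nat.DivMod as ℕDM
  import Data.Nat.Divisibility as ℕD
  open import Data.Nat.GCD using (module Bézout)
  open import Data.Nat.ListAction using (sum; product)
  open import Data.Nat.Primality
    using (Prime; prime?; euclidsLemma; prime⇒nonZero; ¬prime[0]; ¬prime[1]; prime⇒irreducible)
  open import Data.Nat.Primality.Factorisation using (factorise)
  open import Data.Nat.Properties
    using (≤-trans; ≤-reflexive; m≤m+n; <⇒≤; ≤-refl; <-irrefl; m≤n*m; m≤n+m; m+[n∸m]≡n; <-asym; ≰⇒>;
      m≤m*n; m<n⇒0<n∸m; ≤-antisym; m∸n≤m; m∸n+n≡m; *-monoʳ-≤; m≤n⇒m≤1+n; <-cmp; n≢0⇒n>0; +-suc;
      +-monoˡ-≤; m+n∸m≡n; suc-injective; +-monoʳ-≤; m+n∸n≡m; m≤n⇒m<n∨m≡n; +-mono-≤; *-mono-≤; <-trans;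
      <-≤-trans; ≤-<-trans; n≤1+n; n∸n≡0; *-suc)
  open import Data.Product using (_×_; _,_; proj₁; proj₂; ∃)
  open import Data.Product.Properties using (≡-dec)
  open import Data.Sum using (_⊎_; inj₁; inj₂)
  open import Data.Unit using (tt)
  open import Defs
  open import Function using (_∘_; id)
  open import Relation.Binary.Definitions using (DecidableEquality; tri<; tri≈; tri>)
  open import Relation.Binary.PropositionalEquality
  open import Relation.Nullary using (¬_; Dec; yes; no)
  open import Relation.Nullary.Decidable using (_×-dec_; ¬?; from-yes)
  open import Relation.Unary using (Decidable)
  open import Relation.Unary.Properties using (_∩?_)

  -- Finite sums over lists

  ∑ : {A : Set} → List A → (A → ℤ) → ℤ
  ∑ []       f = + 0
  ∑ (x ∷ xs) f = f x + ∑ xs f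

  -- The Iverson bracket of P times `w`. Cardinalities and weighted counts are written as list sums
  -- of such brackets.
  on : {P : Set} → Dec P → ℤ → ℤ
  on (yes _) w = w
  on (no _)  w = + 0

  on-yes : {P : Set} (d : Dec P) {w : ℤ} → P → on d w ≡ w
  on-yes (yes _) p = refl
  on-yes (no ¬p) p = ⊥-elim (¬p p)

  on-no : {P : Set} (d : Dec P) {w : ℤ} → ¬ P → on d w ≡ + 0
  on-no (yes p) ¬p = ⊥-elim (¬p p)
  on-no (no _)  ¬p = refl

  on-cong : {P Q : Set} (d : Dec P) (e : Dec Q) {v w : ℤ} →
    (P → Q) → (Q → P) → (P → v ≡ w) → on d v ≡ on e w
  on-cong (yes p) e f g h = trans (h p) (sym (on-yes e (f p)))
  on-cong (no ¬p) e f g h = sym (on-no e (¬p ∘ g))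

  on-0 : {P : Set} (d : Dec P) → on d (+ 0) ≡ + 0
  on-0 (yes _) = refl
  on-0 (no _)  = refl

  on-*ˡ : {P : Set} (d : Dec P) (c w : ℤ) → on d (c * w) ≡ c * on d w
  on-*ˡ (yes _) c w = refl
  on-*ˡ (no _)  c w = sym (ℤP.*-zeroʳ c)

  on-+ : {P : Set} (d : Dec P) (v w : ℤ) → on d (v + w) ≡ on d v + on d w
  on-+ (yes _) v w = refl
  on-+ (no _)  v w = refl

  on-× : {P Q : Set} (d : Dec P) (e : Dec Q) (w : ℤ) → on d (on e w) ≡ on (d ×-dec e) w
  on-× (yes _) (yes _) w = refl
  on-× (yes _) (no _)  w = refl
  on-× (no _)  _       w = refl

  module _ {A : Set} where

    ∑-cong : (xs : List A) {f g : A → ℤ} → (∀ x → x ∈ xs → f x ≡ g x) → ∑ xs f ≡ ∑ xs g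
    ∑-cong []       h = refl
    ∑-cong (x ∷ xs) h = cong₂ _+_ (h x (here refl)) (∑-cong xs (λ y p → h y (there p)))

    ∑-cong′ : (xs : List A) {f g : A → ℤ} → (∀ x → f x ≡ g x) → ∑ xs f ≡ ∑ xs g
    ∑-cong′ xs h = ∑-cong xs (λ x _ → h x)

    ∑-+ : (xs : List A) (f g : A → ℤ) → ∑ xs (λ x → f x + g x) ≡ ∑ xs f + ∑ xs g
    ∑-+ []       f g = refl
    ∑-+ (x ∷ xs) f g = trans (cong (λ s → f x + g x + s) (∑-+ xs f g)) (lemma (f x) (g x) (∑ xs f) (∑ xs g))
      where
      lemma : ∀ a b c d → a + b + (c + d) ≡ a + c + (b + d)
      lemma = solve-∀

    ∑-*ˡ : (xs : List A) (c : ℤ) (f : A → ℤ) → ∑ xs (λ x → c * f x) ≡ c * ∑ xs f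
    ∑-*ˡ []       c f = sym (ℤP.*-zeroʳ c)
    ∑-*ˡ (x ∷ xs) c f = trans (cong (λ s → c * f x + s) (∑-*ˡ xs c f)) (sym (ℤP.*-distribˡ-+ c (f x) (∑ xs f)))

    ∑-0 : (xs : List A) {f : A → ℤ} → (∀ x → x ∈ xs → f x ≡ + 0) → ∑ xs f ≡ + 0
    ∑-0 []       h = refl
    ∑-0 (x ∷ xs) h = cong₂ _+_ (h x (here refl)) (∑-0 xs (λ y p → h y (there p)))

    ∑-++ : (xs ys : List A) (f : A → ℤ) → ∑ (xs ++ ys) f ≡ ∑ xs f + ∑ ys f
    ∑-++ []       ys f = sym (+-identityˡ _)
    ∑-++ (x ∷ xs) ys f = trans (cong (λ s → f x + s) (∑-++ xs ys f)) (sym (ℤP.+-assoc (f x) _ _))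

    ∑-δ : (_≟_ : DecidableEquality A) {xs : List A} → Unique xs → (y : A) → y ∈ xs → (w : A → ℤ) →
      ∑ xs (λ x → on (y ≟ x) (w x)) ≡ w y
    ∑-δ _≟_ {x ∷ xs} (x∉ ∷ u) y (here refl) w =
      trans (cong₂ _+_ (on-yes (x ≟ x) refl) (∑-0 xs (λ z z∈ → on-no (x ≟ z) (All.lookup x∉ z∈)))) (ℤP.+-identityʳ (w x))
    ∑-δ _≟_ {x ∷ xs} (x∉ ∷ u) y (there y∈) w =
      trans (cong₂ _+_ (on-no (y ≟ x) (λ e → All.lookup x∉ y∈ (sym e))) (∑-δ _≟_ u y y∈ w)) (+-identityˡ (w y))

    ∑-filter : {P : A → Set} (P? : Decidable P) (xs : List A) → + length (filter P? xs) ≡ ∑ xs (λ x → on (P? x) (+ 1))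
    ∑-filter P? [] = refl
    ∑-filter P? (x ∷ xs) with P? x
    ... | yes _ = cong (λ s → + 1 + s) (∑-filter P? xs)
    ... | no _  = trans (∑-filter P? xs) (sym (+-identityˡ _))

  module _ {A B : Set} where

    ∑-map : (h : A → B) (xs : List A) (f : B → ℤ) → ∑ (map h xs) f ≡ ∑ xs (f ∘ h)
    ∑-map h []       f = refl
    ∑-map h (x ∷ xs) f = cong (λ s → f (h x) + s) (∑-map h xs f)

  module _ {A B : Set} where

    ∑-concatMap : (h : A → List B) (xs : List A) (f : B → ℤ) → ∑ (concatMap h xs) f ≡ ∑ xs (λ x → ∑ (h x) f)
    ∑-concatMap h []       f = refl
    ∑-concatMap h (x ∷ xs) f = trans (∑-++ (h x) _ f) (cong (λ s → ∑ (h x) f + s) (∑-concatMap h xs f))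

    ∑-× : (xs : List A) (ys : List B) (f : A × B → ℤ) →
      ∑ (cartesianProduct xs ys) f ≡ ∑ xs (λ x → ∑ ys (λ y → f (x , y)))
    ∑-× []       ys f = refl
    ∑-× (x ∷ xs) ys f = trans (∑-++ (map (x ,_) ys) _ f) (cong₂ _+_ (∑-map (x ,_) ys f) (∑-× xs ys f))

    ∑-swap : (xs : List A) (ys : List B) (f : A → B → ℤ) →
      ∑ xs (λ x → ∑ ys (f x)) ≡ ∑ ys (λ y → ∑ xs (λ x → f x y))
    ∑-swap []       ys f = sym (∑-0 ys (λ _ _ → refl))
    ∑-swap (x ∷ xs) ys f = trans (cong (λ s → ∑ ys (f x) + s) (∑-swap xs ys f)) (sym (∑-+ ys (f x) _))

    ∑-*-∑ : (xs : List A) (ys : List B) (f : A → ℤ) (g : B → ℤ) →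
      ∑ xs f * ∑ ys g ≡ ∑ xs (λ x → ∑ ys (λ y → f x * g y))
    ∑-*-∑ []       ys f g = refl
    ∑-*-∑ (x ∷ xs) ys f g =
      trans (ℤP.*-distribʳ-+ (∑ ys g) (f x) (∑ xs f)) (cong₂ _+_ (sym (∑-*ˡ ys (f x) g)) (∑-*-∑ xs ys f g))

  -- Double counting of the pairs with ψ y = x: each side of the equation sums over one coordinate.
  -- The lists may be larger than the sets being compared, and ψ has to behave only where `Q` holds,
  -- so a change of variables can be given by a formula that is meaningless elsewhere.
  ∑-bijection : {A B : Set} (_≟A_ : DecidableEquality A) (_≟B_ : DecidableEquality B)
    {xs : List A} {ys : List B} → Unique xs → Unique ys →
    {P : A → Set} {Q : B → Set} (P? : Decidable P) (Q? : Decidable Q) (v : A → ℤ) (w : B → ℤ) (ψ : B → A) →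
    (∀ y → y ∈ ys → Q y → ψ y ∈ xs × P (ψ y) × v (ψ y) ≡ w y) →
    (∀ y y′ → Q y → Q y′ → ψ y ≡ ψ y′ → y ≡ y′) →
    (∀ x → x ∈ xs → P x → ∃ λ y → y ∈ ys × Q y × ψ y ≡ x) →
    ∑ xs (λ x → on (P? x) (v x)) ≡ ∑ ys (λ y → on (Q? y) (w y))
  ∑-bijection _≟A_ _≟B_ {xs} {ys} ux uy {P} {Q} P? Q? v w ψ into inj onto = begin
    ∑ xs (λ x → on (P? x) (v x))                                ≡⟨ ∑-cong xs fibre ⟩
    ∑ xs (λ x → ∑ ys (λ y → on (ψ y ≟A x) (on (Q? y) (w y))))   ≡⟨ ∑-swap xs ys _ ⟩
    ∑ ys (λ y → ∑ xs (λ x → on (ψ y ≟A x) (on (Q? y) (w y))))   ≡⟨ ∑-cong ys value ⟩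
    ∑ ys (λ y → on (Q? y) (w y))                                ∎
    where
    open ≡-Reasoning
    value : ∀ y → y ∈ ys → ∑ xs (λ x → on (ψ y ≟A x) (on (Q? y) (w y))) ≡ on (Q? y) (w y)
    value y y∈ with Q? y
    ... | yes q = ∑-δ _≟A_ ux (ψ y) (proj₁ (into y y∈ q)) (λ _ → w y)
    ... | no _  = ∑-0 xs (λ x _ → on-0 (ψ y ≟A x))
    fibre : ∀ x → x ∈ xs → on (P? x) (v x) ≡ ∑ ys (λ y → on (ψ y ≟A x) (on (Q? y) (w y)))
    fibre x x∈ with P? x
    ... | no ¬p = sym (∑-0 ys (λ y y∈ → trans (on-× (ψ y ≟A x) (Q? y) (w y))
      (on-no (ψ y ≟A x ×-dec Q? y) (λ { (refl , q) → ¬p (proj₁ (proj₂ (into y y∈ q))) }))))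
    ... | yes p with onto x x∈ p
    ... | y₀ , y₀∈ , q₀ , refl = trans (sym (∑-δ _≟B_ uy y₀ y₀∈ (λ _ → v (ψ y₀)))) (∑-cong ys (λ y y∈ →
      trans (on-cong (y₀ ≟B y) (ψ y ≟A ψ y₀ ×-dec Q? y)
        (λ { refl → refl , q₀ }) (λ (e , q) → inj y₀ y q₀ q (sym e))
        (λ { refl → proj₂ (proj₂ (into y y∈ q₀)) }))
      (sym (on-× (ψ y ≟A ψ y₀) (Q? y) (w y)))))

  -- Enumerations of integer intervals

  zs : ℕ → List ℤ
  zs zero    = + 0 ∷ []
  zs (suc n) = + suc n ∷ -[1+ n ] ∷ zs n

  ps : ℕ → List ℕ
  ps zero    = []
  ps (suc n) = suc n ∷ ps n

  ∈-zs⁻ : ∀ n {x} → x ∈ zs n → ∣ x ∣ ≤ n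
  ∈-zs⁻ zero    (here refl)         = z≤n
  ∈-zs⁻ (suc n) (here refl)         = ≤-refl
  ∈-zs⁻ (suc n) (there (here refl)) = ≤-refl
  ∈-zs⁻ (suc n) (there (there p))   = m≤n⇒m≤1+n (∈-zs⁻ n p)

  ∈-zs⁺ : ∀ n {x} → ∣ x ∣ ≤ n → x ∈ zs n
  ∈-zs⁺ zero    {+ zero}    h = here refl
  ∈-zs⁺ (suc n) {x} h with ∣ x ∣ ≤? n
  ∈-zs⁺ (suc n) {x} h | yes p = there (there (∈-zs⁺ n p))
  ∈-zs⁺ (suc n) {+ m} h | no p with refl ← ≤-antisym h (≰⇒> p) = here refl
  ∈-zs⁺ (suc n) { -[1+ m ]} h | no p with refl ← ≤-antisym h (≰⇒> p) = there (here refl)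

  zs-unique : ∀ n → Unique (zs n)
  zs-unique zero    = All.[] ∷ []
  zs-unique (suc n) =
    ((λ ()) All.∷ All.tabulate (λ { p refl → <-irrefl refl (∈-zs⁻ n p) })) ∷
    All.tabulate (λ { p refl → <-irrefl refl (∈-zs⁻ n p) }) ∷ zs-unique n

  ∈-ps⁻ : ∀ n {x} → x ∈ ps n → 1 ≤ x × x ≤ n
  ∈-ps⁻ (suc n) (here refl) = s≤s z≤n , ≤-refl
  ∈-ps⁻ (suc n) (there p) with ∈-ps⁻ n p
  ... | a , b = a , m≤n⇒m≤1+n b

  ∈-ps⁺ : ∀ n {x} → 1 ≤ x → x ≤ n → x ∈ ps n
  ∈-ps⁺ zero    {suc x} _ ()
  ∈-ps⁺ (suc n) {x} h h′ with x ≤? n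
  ... | yes p = there (∈-ps⁺ n h p)
  ... | no p with refl ← ≤-antisym h′ (≰⇒> p) = here refl

  ps-unique : ∀ n → Unique (ps n)
  ps-unique zero    = []
  ps-unique (suc n) = All.tabulate (λ { p refl → <-irrefl refl (proj₂ (∈-ps⁻ n p)) }) ∷ ps-unique n

  -- The ring of formal power series

  ns : ℕ → List ℕ
  ns zero    = 0 ∷ []
  ns (suc n) = suc n ∷ ns n

  ∈-ns⁻ : ∀ n {x} → x ∈ ns n → x ≤ n
  ∈-ns⁻ zero    (here refl) = z≤n
  ∈-ns⁻ (suc n) (here refl) = ≤-refl
  ∈-ns⁻ (suc n) (there p)   = m≤n⇒m≤1+n (∈-ns⁻ n p)

  ∈-ns⁺ : ∀ n {x} → x ≤ n → x ∈ ns n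
  ∈-ns⁺ zero    {zero} _ = here refl
  ∈-ns⁺ (suc n) {x} h with x ≤? n
  ... | yes p = there (∈-ns⁺ n p)
  ... | no p with refl ← ≤-antisym h (≰⇒> p) = here refl

  ns-unique : ∀ n → Unique (ns n)
  ns-unique zero    = All.[] ∷ []
  ns-unique (suc n) = All.tabulate (λ { p refl → <-irrefl refl (∈-ns⁻ n p) }) ∷ ns-unique n

  sumTo≡∑ : ∀ f n → sumTo f n ≡ ∑ (ns n) f
  sumTo≡∑ f zero    = sym (ℤP.+-identityʳ (f 0))
  sumTo≡∑ f (suc n) = trans (cong (λ s → s + f (suc n)) (sumTo≡∑ f n)) (ℤP.+-comm (∑ (ns n) f) (f (suc n)))

  ⊗-∑ : ∀ f g n → (f ⊗ g) n ≡ ∑ (ns n) (λ i → f i * g (n ∸ i))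
  ⊗-∑ f g n = sumTo≡∑ (λ i → f i * g (n ∸ i)) n

  ⊗-cong-≤ : ∀ {f f′ g g′ : Series} n → (∀ i → i ≤ n → f i ≡ f′ i) → (∀ i → i ≤ n → g i ≡ g′ i) →
    (f ⊗ g) n ≡ (f′ ⊗ g′) n
  ⊗-cong-≤ {f} {f′} {g} {g′} n p q = trans (⊗-∑ f g n) (trans
    (∑-cong (ns n) (λ i i∈ → cong₂ _*_ (p i (∈-ns⁻ n i∈)) (q (n ∸ i) (m∸n≤m n i)))) (sym (⊗-∑ f′ g′ n)))

  -- The series ∑ w(x) q^(e x) over a finite list. Theta series are given in this form, since a
  -- product of two such series is again one, over the cartesian product of the lists.
  gen : {A : Set} → List A → (A → ℕ) → (A → ℤ) → Series
  gen xs e w i = ∑ xs (λ x → on (e x ≟ i) (w x))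

  convolve-on : ∀ n i j v w →
    ∑ (ns n) (λ k → on (i ≟ k) v * on (j ≟ n ∸ k) w) ≡ on (i ℕ.+ j ≟ n) (v * w)
  convolve-on n i j v w with i ≤? n
  ... | no i≰n = trans
    (∑-0 (ns n) (λ k k∈ → trans (cong (_* on (j ≟ n ∸ k) w) (on-no (i ≟ k) (λ { refl → i≰n (∈-ns⁻ n k∈) }))) refl))
    (sym (on-no (i ℕ.+ j ≟ n) (λ { refl → i≰n (m≤m+n i j) })))
  ... | yes i≤n = begin
    ∑ (ns n) (λ k → on (i ≟ k) v * on (j ≟ n ∸ k) w)    ≡⟨ ∑-cong′ (ns n) (λ k → pull (i ≟ k) (on (j ≟ n ∸ k) w)) ⟩
    ∑ (ns n) (λ k → on (i ≟ k) (v * on (j ≟ n ∸ k) w))  ≡⟨ ∑-δ _≟_ (ns-unique n) i (∈-ns⁺ n i≤n) (λ k → v * on (j ≟ n ∸ k) w) ⟩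
    v * on (j ≟ n ∸ i) w                                  ≡⟨ sym (on-*ˡ (j ≟ n ∸ i) v w) ⟩
    on (j ≟ n ∸ i) (v * w)
      ≡⟨ on-cong (j ≟ n ∸ i) (i ℕ.+ j ≟ n) (λ { refl → m+[n∸m]≡n i≤n }) (λ { refl → sym (m+n∸m≡n i j) }) (λ _ → refl) ⟩
    on (i ℕ.+ j ≟ n) (v * w)                              ∎
    where
    open ≡-Reasoning
    pull : ∀ {P : Set} (d : Dec P) c → on d v * c ≡ on d (v * c)
    pull (yes _) c = refl
    pull (no _)  c = refl

  module _ {A B : Set} where

    infixr 4 _⊞_ _⊠_

    _⊞_ : (A → ℕ) → (B → ℕ) → A × B → ℕ
    (e ⊞ e′) (x , y) = e x ℕ.+ e′ y

    _⊠_ : (A → ℤ) → (B → ℤ) → A × B → ℤ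
    (w ⊠ w′) (x , y) = w x * w′ y

    gen-⊗ : (xs : List A) (ys : List B) (e : A → ℕ) (e′ : B → ℕ) (w : A → ℤ) (w′ : B → ℤ) → ∀ n →
      (gen xs e w ⊗ gen ys e′ w′) n ≡
      gen (cartesianProduct xs ys) (e ⊞ e′) (w ⊠ w′) n
    gen-⊗ xs ys e e′ w w′ n = begin
      (gen xs e w ⊗ gen ys e′ w′) n                                ≡⟨ ⊗-∑ (gen xs e w) (gen ys e′ w′) n ⟩
      ∑ (ns n) (λ k → gen xs e w k * gen ys e′ w′ (n ∸ k))         ≡⟨ ∑-cong′ (ns n) (λ k → ∑-*-∑ xs ys (λ x → on (e x ≟ k) (w x)) (λ y → on (e′ y ≟ n ∸ k) (w′ y))) ⟩
      ∑ (ns n) (λ k → ∑ xs (λ x → ∑ ys (λ y → term k x y)))           ≡⟨ ∑-swap (ns n) xs _ ⟩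
      ∑ xs (λ x → ∑ (ns n) (λ k → ∑ ys (λ y → term k x y)))           ≡⟨ ∑-cong′ xs (λ x → ∑-swap (ns n) ys _) ⟩
      ∑ xs (λ x → ∑ ys (λ y → ∑ (ns n) (λ k → term k x y)))           ≡⟨ ∑-cong′ xs (λ x → ∑-cong′ ys (λ y → convolve-on n (e x) (e′ y) (w x) (w′ y))) ⟩
      ∑ xs (λ x → ∑ ys (λ y → on (e x ℕ.+ e′ y ≟ n) (w x * w′ y))) ≡⟨ sym (∑-× xs ys (λ p → on ((e ⊞ e′) p ≟ n) ((w ⊠ w′) p))) ⟩
      gen (cartesianProduct xs ys) (e ⊞ e′) (w ⊠ w′) n                           ∎
      where
      open ≡-Reasoning
      term : ℕ → A → B → ℤ
      term k x y = on (e x ≟ k) (w x) * on (e′ y ≟ n ∸ k) (w′ y)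

  -- Up to degree `n` every series has the form `gen`, which reduces commutativity and associativity
  -- of `⊗` to rearranging finite sums over triples of exponents.
  truncate : ℕ → Series → Series
  truncate n f = gen (ns n) (λ i → i) f

  truncate-≤ : ∀ n f i → i ≤ n → truncate n f i ≡ f i
  truncate-≤ n f i i≤n = trans (∑-cong′ (ns n) (λ j → on-cong (j ≟ i) (i ≟ j) sym sym (λ _ → refl)))
    (∑-δ _≟_ (ns-unique n) i (∈-ns⁺ n i≤n) f)

  ⊗-truncate : ∀ f g n → (f ⊗ g) n ≡ ∑ (ns n) (λ i → ∑ (ns n) (λ j → on (i ℕ.+ j ≟ n) (f i * g j)))
  ⊗-truncate f g n = trans (⊗-cong-≤ {f} {truncate n f} {g} {truncate n g} n (λ i p → sym (truncate-≤ n f i p)) (λ i p → sym (truncate-≤ n g i p)))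
    (trans (gen-⊗ (ns n) (ns n) id id f g n) (∑-× (ns n) (ns n) (λ p → on ((id ⊞ id) p ≟ n) ((f ⊠ g) p))))

  ⊗-comm : ∀ f g n → (f ⊗ g) n ≡ (g ⊗ f) n
  ⊗-comm f g n = trans (⊗-truncate f g n) (trans (∑-swap (ns n) (ns n) _) (trans
    (∑-cong′ (ns n) (λ j → ∑-cong′ (ns n) (λ i → on-cong (i ℕ.+ j ≟ n) (j ℕ.+ i ≟ n)
      (trans (ℕP.+-comm j i)) (trans (ℕP.+-comm i j)) (λ _ → ℤP.*-comm (f i) (g j)))))
    (sym (⊗-truncate g f n))))

  ⊗-assoc : ∀ f g h n → ((f ⊗ g) ⊗ h) n ≡ (f ⊗ (g ⊗ h)) n
  ⊗-assoc f g h n = begin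
    ((f ⊗ g) ⊗ h) n
      ≡⟨ ⊗-cong-≤ {f ⊗ g} {gen I² (id ⊞ id) (f ⊠ g)} {h} {truncate n h} n (λ i p → inner f g i p) (λ i p → sym (truncate-≤ n h i p)) ⟩
    (gen I² (id ⊞ id) (f ⊠ g) ⊗ truncate n h) n
      ≡⟨ gen-⊗ I² I (id ⊞ id) id (f ⊠ g) h n ⟩
    gen (cartesianProduct I² I) ((id ⊞ id) ⊞ id) ((f ⊠ g) ⊠ h) n
      ≡⟨ trans (∑-× I² I (λ p → on (((id ⊞ id) ⊞ id) p ≟ n) (((f ⊠ g) ⊠ h) p)))
           (∑-× I I (λ p → ∑ I (λ k → on ((id ⊞ id) p ℕ.+ k ≟ n) ((f ⊠ g) p * h k)))) ⟩
    ∑ I (λ i → ∑ I (λ j → ∑ I (λ k → on (i ℕ.+ j ℕ.+ k ≟ n) (f i * g j * h k))))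
      ≡⟨ ∑-cong′ I (λ i → ∑-cong′ I (λ j → ∑-cong′ I (λ k → on-cong (i ℕ.+ j ℕ.+ k ≟ n) (i ℕ.+ (j ℕ.+ k) ≟ n)
           (trans (sym (ℕP.+-assoc i j k))) (trans (ℕP.+-assoc i j k)) (λ _ → ℤP.*-assoc (f i) (g j) (h k))))) ⟩
    ∑ I (λ i → ∑ I (λ j → ∑ I (λ k → on (i ℕ.+ (j ℕ.+ k) ≟ n) (f i * (g j * h k)))))
      ≡⟨ sym (trans (∑-× I I² (λ p → on ((id ⊞ (id ⊞ id)) p ≟ n) ((f ⊠ (g ⊠ h)) p)))
           (∑-cong′ I (λ i → ∑-× I I (λ p → on (i ℕ.+ (id ⊞ id) p ≟ n) (f i * (g ⊠ h) p))))) ⟩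
    gen (cartesianProduct I I²) (id ⊞ (id ⊞ id)) (f ⊠ (g ⊠ h)) n
      ≡⟨ sym (gen-⊗ I I² id (id ⊞ id) f (g ⊠ h) n) ⟩
    (truncate n f ⊗ gen I² (id ⊞ id) (g ⊠ h)) n
      ≡⟨ ⊗-cong-≤ {truncate n f} {f} {gen I² (id ⊞ id) (g ⊠ h)} {g ⊗ h} n (λ i p → truncate-≤ n f i p) (λ i p → sym (inner g h i p)) ⟩
    (f ⊗ (g ⊗ h)) n ∎
    where
    open ≡-Reasoning
    I : List ℕ
    I = ns n
    I² : List (ℕ × ℕ)
    I² = cartesianProduct I I
    inner : ∀ f g i → i ≤ n → (f ⊗ g) i ≡ gen I² (id ⊞ id) (f ⊠ g) i
    inner f g i p = trans
      (⊗-cong-≤ {f} {truncate n f} {g} {truncate n g} i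
        (λ j q → sym (truncate-≤ n f j (≤-trans q p))) (λ j q → sym (truncate-≤ n g j (≤-trans q p))))
      (gen-⊗ I I id id f g i)

  mono : ℤ → ℕ → Series
  mono c e i = on (e ≟ i) c

  ⊗-mono : ∀ c e f n → (mono c e ⊗ f) (e ℕ.+ n) ≡ c * f n
  ⊗-mono c e f n = begin
    (mono c e ⊗ f) (e ℕ.+ n)                                             ≡⟨ ⊗-∑ (mono c e) f (e ℕ.+ n) ⟩
    ∑ (ns (e ℕ.+ n)) (λ i → on (e ≟ i) c * f (e ℕ.+ n ∸ i))            ≡⟨ ∑-cong′ (ns (e ℕ.+ n)) (λ i → pull (e ≟ i) (f (e ℕ.+ n ∸ i))) ⟩
    ∑ (ns (e ℕ.+ n)) (λ i → on (e ≟ i) (c * f (e ℕ.+ n ∸ i)))          ≡⟨ ∑-δ _≟_ (ns-unique (e ℕ.+ n)) e (∈-ns⁺ (e ℕ.+ n) (m≤m+n e n)) (λ i → c * f (e ℕ.+ n ∸ i)) ⟩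
    c * f (e ℕ.+ n ∸ e)                                                  ≡⟨ cong (λ k → c * f k) (m+n∸m≡n e n) ⟩
    c * f n                                                              ∎
    where
    open ≡-Reasoning
    pull : ∀ {P : Set} (d : Dec P) v → on d c * v ≡ on d (c * v)
    pull (yes _) v = refl
    pull (no _)  v = refl

  ⊗-mono-< : ∀ c e f n → n < e → (mono c e ⊗ f) n ≡ + 0
  ⊗-mono-< c e f n n<e = trans (⊗-∑ (mono c e) f n) (∑-0 (ns n) (λ i i∈ →
    cong (_* f (n ∸ i)) (on-no (e ≟ i) (λ { refl → <-irrefl refl (<-≤-trans n<e (∈-ns⁻ n i∈)) }))))

  one≗mono : ∀ i → one i ≡ mono (+ 1) 0 i
  one≗mono zero    = refl
  one≗mono (suc i) = refl

  seriesRing : CommutativeRing _ _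
  seriesRing = record
    { Carrier = Series
    ; _≈_     = _≗_
    ; _+_     = λ f g i → f i + g i
    ; _*_     = _⊗_
    ; -_      = λ f i → - f i
    ; 0#      = λ _ → + 0
    ; 1#      = one
    ; isCommutativeRing = record
      { isRing = record
        { +-isAbelianGroup = Algebra.Construct.Pointwise.isAbelianGroup ℕ ℤP.+-0-isAbelianGroup
        ; *-cong     = λ {f} {f′} {g} {g′} p q n → ⊗-cong-≤ {f} {f′} {g} {g′} n (λ i _ → p i) (λ i _ → q i)
        ; *-assoc    = ⊗-assoc
        ; *-identity = idˡ , λ f n → trans (⊗-comm f one n) (idˡ f n)
        ; distrib    = distˡ , λ f g h n → trans (⊗-comm (λ i → g i + h i) f n)
            (trans (distˡ f g h n) (cong₂ _+_ (⊗-comm f g n) (⊗-comm f h n)))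
        }
      ; *-comm = ⊗-comm
      }
    }
    where
    idˡ : ∀ f n → (one ⊗ f) n ≡ f n
    idˡ f n = trans (⊗-cong-≤ {one} {mono (+ 1) 0} {f} {f} n (λ i _ → one≗mono i) (λ _ _ → refl))
      (trans (⊗-mono (+ 1) 0 f n) (ℤP.*-identityˡ (f n)))
    distˡ : ∀ f g h n → (f ⊗ (λ i → g i + h i)) n ≡ (f ⊗ g) n + (f ⊗ h) n
    distˡ f g h n = trans (⊗-∑ f (λ i → g i + h i) n) (trans (∑-cong′ (ns n) (λ i → ℤP.*-distribˡ-+ (f i) (g (n ∸ i)) (h (n ∸ i))))
      (trans (∑-+ (ns n) (λ i → f i * g (n ∸ i)) (λ i → f i * h (n ∸ i))) (cong₂ _+_ (sym (⊗-∑ f g n)) (sym (⊗-∑ f h n)))))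

  -- Theta series and the coefficients a(n)

  module S = CommutativeRing seriesRing
  open ThetaProducts seriesRing
  open Algebra.Properties.CommutativeSemiring.Exp S.commutativeSemiring

  -- The way back from ring congruences to coefficients: a multiple of c q^e has no terms below
  -- degree `e`.
  mod⇒≡ : ∀ {f g} c e i → f ≈ g [mod mono c e ] → i < e → f i ≡ g i
  mod⇒≡ {f} {g} c e i (h , p) i<e = trans (p i) (trans (cong (λ v → g i + v) (⊗-mono-< c e h i i<e)) (ℤP.+-identityʳ (g i)))

  mono-⊗ : ∀ c e c′ e′ → mono c e ⊗ mono c′ e′ ≗ mono (c * c′) (e ℕ.+ e′)
  mono-⊗ c e c′ e′ n with e ≤? n
  ... | no e≰n = trans (⊗-mono-< c e (mono c′ e′) n (≰⇒> e≰n))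
    (sym (on-no (e ℕ.+ e′ ≟ n) (λ { refl → e≰n (m≤m+n e e′) })))
  ... | yes e≤n with n ∸ e | m+[n∸m]≡n e≤n
  ... | m | refl = trans (⊗-mono c e (mono c′ e′) m) (trans (sym (on-*ˡ (e′ ≟ m) c c′))
    (on-cong (e′ ≟ m) (e ℕ.+ e′ ≟ e ℕ.+ m) (cong (e ℕ.+_)) (ℕP.+-cancelˡ-≡ e e′ m) (λ _ → refl)))

  mono-cong : ∀ {c c′ e e′} → c ≡ c′ → e ≡ e′ → mono c e ≗ mono c′ e′
  mono-cong refl refl i = refl

  mono-^ : ∀ e k → mono (+ 1) e ^ k ≗ mono (+ 1) (k ℕ.* e)
  mono-^ e zero    = one≗mono
  mono-^ e (suc k) = S.trans (S.*-congˡ {mono (+ 1) e} (mono-^ e k)) (mono-⊗ (+ 1) e (+ 1) (k ℕ.* e))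

  signℕ : ℕ → ℤ
  signℕ zero    = + 1
  signℕ (suc k) = - signℕ k

  sign : ℤ → ℤ
  sign s = signℕ ∣ s ∣

  sgn≗mono : ∀ k → sgn k ≗ mono (signℕ k) 0
  sgn≗mono zero    = one≗mono
  sgn≗mono (suc k) = S.trans (S.*-cong minus (sgn≗mono k))
    (S.trans (mono-⊗ (- + 1) 0 (signℕ k) 0) (mono-cong (-1*i≡-i (signℕ k)) refl))
    where
    minus : (λ i → - one i) ≗ mono (- + 1) 0
    minus zero    = refl
    minus (suc i) = refl

  sgn-mono : ∀ {f} k c j → f ≗ mono (+ 1) c → sgn k ⊗ (f ^ j) ≗ mono (signℕ k) (c ℕ.* j)
  sgn-mono k c j p = S.trans (S.*-cong (sgn≗mono k) (S.trans (^-congˡ j p) (mono-^ c j)))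
    (S.trans (mono-⊗ (signℕ k) 0 (+ 1) (j ℕ.* c)) (mono-cong (ℤP.*-identityʳ (signℕ k)) (ℕP.*-comm j c)))

  -- `tri₂ s` is 2s² + s, written for each sign as a product of naturals like the exponents of `Ψ`.
  square tri₂ : ℤ → ℕ
  square s = ∣ s ∣ ℕ.* ∣ s ∣
  tri₂ (+ n)    = n ℕ.* (2 ℕ.* n ℕ.+ 1)
  tri₂ -[1+ n ] = suc n ℕ.* (2 ℕ.* n ℕ.+ 1)

  φ⁻ ψ⁻ : ℕ → ℕ → Series
  φ⁻ n c = gen (zs n) (λ s → c ℕ.* square s) sign
  ψ⁻ n c = gen (zs n) (λ s → c ℕ.* tri₂ s) sign

  private
    constant-term : ∀ c → one ≗ (λ i → on (c ℕ.* 0 ≟ i) (+ 1) + + 0)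
    constant-term c i = trans (one≗mono i) (trans (mono-cong refl (sym (ℕP.*-zeroʳ c)) i) (sym (ℤP.+-identityʳ _)))

  Φ≗φ⁻ : ∀ {f} n c → f ≗ mono (+ 1) c → Φ f n ≗ φ⁻ n c
  Φ≗φ⁻ zero    c p = constant-term c
  Φ≗φ⁻ (suc n) c p i = cong₂ _+_ (sgn-mono (suc n) c (suc n ℕ.* suc n) p i)
    (cong₂ _+_ (sgn-mono (suc n) c (suc n ℕ.* suc n) p i) (Φ≗φ⁻ n c p i))

  Ψ≗ψ⁻ : ∀ {f} n c → f ≗ mono (+ 1) c → Ψ f n ≗ ψ⁻ n c
  Ψ≗ψ⁻ zero    c p = constant-term c
  Ψ≗ψ⁻ (suc n) c p i = cong₂ _+_
    (trans (sgn-mono (suc n) c (suc n ℕ.* (2 ℕ.* n ℕ.+ 3)) p i) (mono-cong refl (cong (λ k → c ℕ.* (suc n ℕ.* k)) (exponent n)) i))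
    (cong₂ _+_ (sgn-mono (suc n) c (suc n ℕ.* (2 ℕ.* n ℕ.+ 1)) p i) (Ψ≗ψ⁻ n c p i))
    where
    exponent : ∀ n → 2 ℕ.* n ℕ.+ 3 ≡ 2 ℕ.* suc n ℕ.+ 1
    exponent = ℕSolver.solve-∀

  oneMinus : ∀ m → oneMinusQ^ (suc m) ≗ (λ i → one i + - mono (+ 1) (suc m) i)
  oneMinus m zero = refl
  oneMinus m (suc j) with j ℕ.≡ᵇ m in eq
  ... | true  = sym (trans (+-identityˡ _) (cong -_ (on-yes (suc m ≟ suc j)
    (cong suc (sym (ℕP.≡ᵇ⇒≡ j m (subst Bool.T (sym eq) tt)))))))
  ... | false = sym (trans (+-identityˡ _) (cong -_ (on-no (suc m ≟ suc j)
    (λ e → subst Bool.T eq (ℕP.≡⇒≡ᵇ j m (sym (suc-injective e)))))))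

  private
    X Y : Series
    X = mono (+ 1) 2
    Y = mono (+ 1) 6

    X² : X ⊗ X ≗ mono (+ 1) 4
    X² = mono-⊗ (+ 1) 2 (+ 1) 2

    Y² : Y ⊗ Y ≗ mono (+ 1) 12
    Y² = mono-⊗ (+ 1) 6 (+ 1) 6

    oneMinus-^ : ∀ {f} c k → f ≗ mono (+ 1) (suc c) →
      oneMinusQ^ (suc c ℕ.* suc k) ≗ (λ i → one i + - (f ^ suc k) i)
    oneMinus-^ c k p i = trans (oneMinus _ i) (cong (λ v → one i + - v) (sym
      (trans (^-congˡ (suc k) p i) (trans (mono-^ (suc c) (suc k) i) (mono-cong refl (ℕP.*-comm (suc k) (suc c)) i)))))

    -- With X = q² and Y = q⁶ the exponents 2k, 4k, 6k, 12k belong to X, X², Y, Y²: two pairs of the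
    -- shape to which `theta-product` applies.
    partialProd≗euler : ∀ K → partialProd K ≗ (euler X K ⊗ euler (X ⊗ X) K) ⊗ (euler Y K ⊗ euler (Y ⊗ Y) K)
    partialProd≗euler zero    = S.sym (S.trans (S.*-cong (S.*-identityˡ one) (S.*-identityˡ one)) (S.*-identityˡ one))
    partialProd≗euler (suc K) = S.trans
      (S.*-cong (partialProd≗euler K) (S.*-cong (oneMinus-^ 1 K (λ _ → refl)) (S.*-cong (oneMinus-^ 3 K X²)
        (S.*-cong (oneMinus-^ 5 K (λ _ → refl)) (oneMinus-^ 11 K Y²)))))
      (Solver.solve 8 (λ e₁ e₂ e₃ e₄ f₁ f₂ f₃ f₄ →
        ((e₁ Solver.:* e₂) Solver.:* (e₃ Solver.:* e₄)) Solver.:* (f₁ Solver.:* (f₂ Solver.:* (f₃ Solver.:* f₄)))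
        Solver.:= ((f₁ Solver.:* e₁) Solver.:* (f₂ Solver.:* e₂)) Solver.:* ((f₃ Solver.:* e₃) Solver.:* (f₄ Solver.:* e₄)))
        S.refl (euler X K) (euler (X ⊗ X) K) (euler Y K) (euler (Y ⊗ Y) K) (new X) (new (X ⊗ X)) (new Y) (new (Y ⊗ Y)))
      where
      module Solver = Algebra.Solver.Ring.NaturalCoefficients.Default S.commutativeSemiring
      new : Series → Series
      new f i = one i + - (f ^ suc K) i

  -- The formula for `X` is known modulo q^(2(n+1)) and the one for `Y` modulo q^(6(n+1)), where n =
  -- m + 1. The coarser of the two moduli still lies beyond degree `m`.
  a≡theta : ∀ m → a (suc m) ≡ ((φ⁻ (suc m) 4 ⊗ φ⁻ (suc m) 12) ⊗ (ψ⁻ (suc m) 2 ⊗ ψ⁻ (suc m) 6)) m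
  a≡theta m = trans (partialProd≗euler n m) (trans (sym (mod⇒≡ {tX ⊗ tY} {eX ⊗ eY} (+ 1) (suc n ℕ.* 2) m congruence small))
    (trans (Solver.solve 4 (λ p q r s → (p Solver.:* q) Solver.:* (r Solver.:* s) Solver.:= (p Solver.:* r) Solver.:* (q Solver.:* s))
      S.refl (Φ (X ⊗ X) n) (Ψ X n) (Φ (Y ⊗ Y) n) (Ψ Y n) m)
    (S.*-cong (S.*-cong (Φ≗φ⁻ n 4 X²) (Φ≗φ⁻ n 12 Y²)) (S.*-cong (Ψ≗ψ⁻ n 2 (λ _ → refl)) (Ψ≗ψ⁻ n 6 (λ _ → refl))) m)))
    where
    module Solver = Algebra.Solver.Ring.NaturalCoefficients.Default S.commutativeSemiring
    n : ℕ
    n = suc m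
    small : m < suc n ℕ.* 2
    small = <-≤-trans (m≤n⇒m≤1+n ≤-refl) (m≤m*n (suc n) 2)
    Y-exponent : Y ^ suc n ≗ mono (+ 1) (suc n ℕ.* 2) ⊗ mono (+ 1) (suc n ℕ.* 4)
    Y-exponent = S.trans (mono-^ 6 (suc n)) (S.sym (S.trans (mono-⊗ (+ 1) (suc n ℕ.* 2) (+ 1) (suc n ℕ.* 4))
      (mono-cong refl (sym (ℕP.*-distribˡ-+ (suc n) 2 4)))))
    tX tY eX eY M : Series
    tX = Φ (X ⊗ X) n ⊗ Ψ X n
    tY = Φ (Y ⊗ Y) n ⊗ Ψ Y n
    eX = euler X n ⊗ euler (X ⊗ X) n
    eY = euler Y n ⊗ euler (Y ⊗ Y) n
    M = mono (+ 1) (suc n ℕ.* 2)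
    congruence : tX ⊗ tY ≈ eX ⊗ eY [mod M ]
    congruence = mod-* {tX} {tY} {eX} {eY} {M}
      (mod-resp {tX} {eX} {X ^ suc n} {M} (mono-^ 2 (suc n)) (theta-product X n))
      (mod-weaken {tY} {eY} {M} {mono (+ 1) (suc n ℕ.* 4)}
        (mod-resp {tY} {eY} {Y ^ suc n} {M ⊗ mono (+ 1) (suc n ℕ.* 4)} Y-exponent (theta-product Y n)))

  -- Splitting the signed theta series by parity

  on-split : {P Q R : Set} (d : Dec P) (e : Dec Q) (f : Dec R) {w : ℤ} → (P → Q ⊎ R) → (P → Q → R → ⊥) →
    on d w ≡ on (d ×-dec e) w + on (d ×-dec f) w
  on-split (no _)  e       f       _ _ = refl
  on-split (yes p) (yes q) (yes r) _ h = ⊥-elim (h p q r)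
  on-split (yes p) (yes q) (no _)  _ _ = sym (ℤP.+-identityʳ _)
  on-split (yes p) (no _)  (yes _) _ _ = sym (+-identityˡ _)
  on-split (yes p) (no ¬q) (no ¬r) h _ with h p
  ... | inj₁ q = ⊥-elim (¬q q)
  ... | inj₂ r = ⊥-elim (¬r r)

  module _ {A : Set} where

    ∑-split : (xs : List A) {P Q R : A → Set} (P? : Decidable P) (Q? : Decidable Q) (R? : Decidable R) (w : A → ℤ) →
      (∀ x → P x → Q x ⊎ R x) → (∀ x → P x → Q x → R x → ⊥) →
      ∑ xs (λ x → on (P? x) (w x)) ≡
      ∑ xs (λ x → on (P? x ×-dec Q? x) (w x)) + ∑ xs (λ x → on (P? x ×-dec R? x) (w x))
    ∑-split xs P? Q? R? w h h′ = trans (∑-cong′ xs (λ x → on-split (P? x) (Q? x) (R? x) (h x) (h′ x)))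
      (∑-+ xs (λ x → on (P? x ×-dec Q? x) (w x)) (λ x → on (P? x ×-dec R? x) (w x)))

    ∑-const : (xs : List A) {P : A → Set} (P? : Decidable P) (w : A → ℤ) (c : ℤ) → (∀ x → P x → w x ≡ c) →
      ∑ xs (λ x → on (P? x) (w x)) ≡ c * ∑ xs (λ x → on (P? x) (+ 1))
    ∑-const xs P? w c h = trans
      (∑-cong′ xs (λ x → trans (on-cong (P? x) (P? x) (λ p → p) (λ p → p) (λ p → trans (h x p) (sym (ℤP.*-identityʳ c)))) (on-*ˡ (P? x) c (+ 1))))
      (∑-*ˡ xs c (λ x → on (P? x) (+ 1)))

  -- Bijections between sets of lattice points

  _≟²_ : (p q : ℤ × ℤ) → Dec (p ≡ q)
  _≟²_ = ≡-dec ℤ._≟_ ℤ._≟_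

  Bounded : ℕ → ℤ × ℤ → Set
  Bounded B (x , y) = ∣ x ∣ ≤ B × ∣ y ∣ ≤ B

  grid : ℕ → List (ℤ × ℤ)
  grid B = cartesianProduct (zs B) (zs B)

  grid-unique : ∀ B → Unique (grid B)
  grid-unique B = cartesianProduct⁺ (zs-unique B) (zs-unique B)

  ∈-grid⁺ : ∀ B p → Bounded B p → p ∈ grid B
  ∈-grid⁺ B (x , y) (p , q) = ∈-cartesianProduct⁺ (∈-zs⁺ B p) (∈-zs⁺ B q)

  grid-bijection : ∀ B {P Q : ℤ × ℤ → Set} (P? : Decidable P) (Q? : Decidable Q) (v w : ℤ × ℤ → ℤ) (ψ : ℤ × ℤ → ℤ × ℤ) →
    (∀ q → Q q → Bounded B (ψ q) × P (ψ q) × v (ψ q) ≡ w q) →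
    (∀ q q′ → Q q → Q q′ → ψ q ≡ ψ q′ → q ≡ q′) →
    (∀ p → P p → ∃ λ q → Bounded B q × Q q × ψ q ≡ p) →
    ∑ (grid B) (λ p → on (P? p) (v p)) ≡ ∑ (grid B) (λ q → on (Q? q) (w q))
  grid-bijection B P? Q? v w ψ into inj onto = ∑-bijection _≟²_ _≟²_ (grid-unique B) (grid-unique B) P? Q? v w ψ
    (λ q _ h → let b , r = into q h in ∈-grid⁺ B (ψ q) b , r)
    inj
    (λ p _ h → let q , b , r = onto p h in q , ∈-grid⁺ B q b , r)

  -- Parity and signs of integers

  +-cancelʳ-≡ : ∀ z x y → x + z ≡ y + z → x ≡ y
  +-cancelʳ-≡ = Algebra.Properties.AbelianGroup.∙-cancelʳ ℤP.+-0-abelianGroup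

  ∣-cast : ∀ {d x y : ℤ} → x ≡ y → d ∣ x → d ∣ y
  ∣-cast refl h = h

  parity : ∀ x → (∃ λ k → x ≡ k * + 2) ⊎ (∃ λ k → x ≡ k * + 2 + + 1)
  parity x with x %ℕ 2 | n%ℕd<d x 2 | a≡a%ℕn+[a/ℕn]*n x 2
  ... | 0 | _ | e = inj₁ (x /ℕ 2 , trans e (+-identityˡ _))
  ... | 1 | _ | e = inj₂ (x /ℕ 2 , trans e (ℤP.+-comm (+ 1) (x /ℕ 2 * + 2)))
  ... | suc (suc _) | s≤s (s≤s ()) | _

  odd≢even : ∀ a b → a * + 2 + + 1 ≡ b * + 2 → ⊥
  odd≢even a b e = impossible ∣ b - a ∣ (trans (sym (abs-* (b - a) (+ 2))) (cong ∣_∣ difference))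
    where
    difference : (b - a) * + 2 ≡ + 1
    difference = trans (distribute a b) (trans (cong (_- a * + 2) (sym e)) (cancel (a * + 2)))
      where
      distribute : ∀ a b → (b - a) * + 2 ≡ b * + 2 - a * + 2
      distribute = solve-∀
      cancel : ∀ c → c + + 1 - c ≡ + 1
      cancel = solve-∀
    impossible : ∀ n → n ℕ.* 2 ≡ 1 → ⊥
    impossible zero    ()
    impossible (suc n) ()

  odd⇒2∤ : ∀ k → ¬ (+ 2 ∣ k * + 2 + + 1)
  odd⇒2∤ k (divides q e) = odd≢even k q e

  2∤⇒odd : ∀ {x} → ¬ (+ 2 ∣ x) → ∃ λ k → x ≡ k * + 2 + + 1
  2∤⇒odd {x} h with parity x
  ... | inj₁ (k , e) = ⊥-elim (h (divides k e))
  ... | inj₂ r       = r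

  sign-even : ∀ k → sign (k * + 2) ≡ + 1
  sign-even k = trans (cong signℕ (abs-* k (+ 2))) (go ∣ k ∣)
    where
    go : ∀ n → signℕ (n ℕ.* 2) ≡ + 1
    go zero    = refl
    go (suc n) = trans (neg-involutive _) (go n)

  signℕ-even-or-odd : ∀ n → (∃ λ j → n ≡ j ℕ.* 2) ⊎ signℕ n ≡ - + 1
  signℕ-even-or-odd zero = inj₁ (0 , refl)
  signℕ-even-or-odd (suc zero) = inj₂ refl
  signℕ-even-or-odd (suc (suc n)) with signℕ-even-or-odd n
  ... | inj₁ (j , e) = inj₁ (suc j , cong (λ m → suc (suc m)) e)
  ... | inj₂ e       = inj₂ (trans (neg-involutive _) e)

  sign-odd : ∀ k → sign (k * + 2 + + 1) ≡ - + 1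
  sign-odd k with signℕ-even-or-odd ∣ k * + 2 + + 1 ∣
  ... | inj₁ (j , e) = ⊥-elim (odd⇒2∤ k (∣ᵤ⇒∣ (ℕD.divides j e)))
  ... | inj₂ e       = e

  sign-+ : ∀ x y → sign (x + y) ≡ sign x * sign y
  sign-+ x y with parity x | parity y
  ... | inj₁ (k , refl) | inj₁ (l , refl) rewrite sign-even k | sign-even l = trans (cong sign (lemma k l)) (sign-even (k + l))
    where
    lemma : ∀ k l → k * + 2 + l * + 2 ≡ (k + l) * + 2
    lemma = solve-∀
  ... | inj₁ (k , refl) | inj₂ (l , refl) rewrite sign-even k | sign-odd l = trans (cong sign (lemma k l)) (sign-odd (k + l))
    where
    lemma : ∀ k l → k * + 2 + (l * + 2 + + 1) ≡ (k + l) * + 2 + + 1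
    lemma = solve-∀
  ... | inj₂ (k , refl) | inj₁ (l , refl) rewrite sign-odd k | sign-even l = trans (cong sign (lemma k l)) (sign-odd (k + l))
    where
    lemma : ∀ k l → k * + 2 + + 1 + l * + 2 ≡ (k + l) * + 2 + + 1
    lemma = solve-∀
  ... | inj₂ (k , refl) | inj₂ (l , refl) rewrite sign-odd k | sign-odd l = trans (cong sign (lemma k l)) (sign-even (k + l + + 1))
    where
    lemma : ∀ k l → k * + 2 + + 1 + (l * + 2 + + 1) ≡ (k + l + + 1) * + 2
    lemma = solve-∀

  sign-neg : ∀ x → sign (- x) ≡ sign x
  sign-neg x = cong signℕ (∣-i∣≡∣i∣ x)

  -- The exponents of the theta series and their bounds

  +square : ∀ x → + square x ≡ x * x
  +square (+ n)    = pos-* n n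
  +square -[1+ n ] = refl

  +tri₂ : ∀ s → + tri₂ s ≡ + 2 * (s * s) + s
  +tri₂ (+ n) = trans (pos-* n (2 ℕ.* n ℕ.+ 1)) (trans (cong (λ k → + n * (k + + 1)) (pos-* 2 n)) (lemma (+ n)))
    where
    lemma : ∀ x → x * (+ 2 * x + + 1) ≡ + 2 * (x * x) + x
    lemma = solve-∀
  +tri₂ -[1+ n ] = trans (pos-* (suc n) (2 ℕ.* n ℕ.+ 1)) (trans (cong (λ k → + suc n * (k + + 1)) (pos-* 2 n)) (lemma (+ n)))
    where
    lemma : ∀ x → (+ 1 + x) * (+ 2 * x + + 1) ≡ + 2 * (- (+ 1 + x) * - (+ 1 + x)) + - (+ 1 + x)
    lemma = solve-∀

  n≤n*[2m+1] : ∀ n m → n ≤ n ℕ.* (2 ℕ.* m ℕ.+ 1)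
  n≤n*[2m+1] n m rewrite ℕP.+-comm (2 ℕ.* m) 1 = m≤m*n n (suc (2 ℕ.* m))

  ∣∣≤square : ∀ x → ∣ x ∣ ≤ square x
  ∣∣≤square x with ∣ x ∣
  ... | zero  = z≤n
  ... | suc n = m≤m*n (suc n) (suc n)

  ∣∣≤tri₂ : ∀ s → ∣ s ∣ ≤ tri₂ s
  ∣∣≤tri₂ (+ n)    = n≤n*[2m+1] n n
  ∣∣≤tri₂ -[1+ n ] = n≤n*[2m+1] (suc n) n

  ≤-scale : ∀ k {m n} .{{_ : ℕ.NonZero k}} → m ≤ n → m ≤ k ℕ.* n
  ≤-scale k {m} {n} h = ≤-trans h (m≤n*m n k)

  -- `form₄` and `formₒ` are the exponents in φ(-q⁴)φ(-q¹²) and in ψ(-q²)ψ(-q⁶).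
  form form₄ formₒ : ℤ × ℤ → ℕ
  form  (x , z) = square x ℕ.+ 3 ℕ.* square z
  form₄ (u , v) = 4 ℕ.* square u ℕ.+ 12 ℕ.* square v
  formₒ (s , t) = 2 ℕ.* tri₂ s ℕ.+ 6 ℕ.* tri₂ t

  +-scaled : ∀ c d m n {x y} → + m ≡ x → + n ≡ y → + (c ℕ.* m ℕ.+ d ℕ.* n) ≡ + c * x + + d * y
  +-scaled c d m n refl refl = cong₂ _+_ (pos-* c m) (pos-* d n)

  +form : ∀ x z → + form (x , z) ≡ x * x + + 3 * (z * z)
  +form x z = cong₂ _+_ (+square x) (trans (pos-* 3 (square z)) (cong (+ 3 *_) (+square z)))

  +form₄ : ∀ u v → + form₄ (u , v) ≡ + 4 * (u * u) + + 12 * (v * v)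
  +form₄ u v = +-scaled 4 12 (square u) (square v) (+square u) (+square v)

  +formₒ : ∀ s t → + formₒ (s , t) ≡ + 2 * (+ 2 * (s * s) + s) + + 6 * (+ 2 * (t * t) + t)
  +formₒ s t = +-scaled 2 6 (tri₂ s) (tri₂ t) (+tri₂ s) (+tri₂ t)

  form-bounded : ∀ {B i} p → form p ≡ i → i ≤ B → Bounded B p
  form-bounded (x , z) refl h =
    ≤-trans (∣∣≤square x) (≤-trans (m≤m+n _ _) h) ,
    ≤-trans (≤-scale 3 (∣∣≤square z)) (≤-trans (m≤n+m _ (square x)) h)

  form₄-bounded : ∀ {B i} p → form₄ p ≡ i → i ≤ B → Bounded B p
  form₄-bounded (u , v) refl h =
    ≤-trans (≤-scale 4 (∣∣≤square u)) (≤-trans (m≤m+n _ _) h) ,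
    ≤-trans (≤-scale 12 (∣∣≤square v)) (≤-trans (m≤n+m _ (4 ℕ.* square u)) h)

  formₒ-bounded : ∀ {B i} p → suc (formₒ p) ≡ i → i ≤ B → Bounded B p
  formₒ-bounded (s , t) refl h =
    ≤-trans (≤-scale 2 (∣∣≤tri₂ s)) (≤-trans (m≤m+n _ _) (<⇒≤ h)) ,
    ≤-trans (≤-scale 6 (∣∣≤tri₂ t)) (≤-trans (m≤n+m _ (2 ℕ.* tri₂ s)) (<⇒≤ h))

  -- Truncations to the square |x|, |z| ≤ B, which contains every solution for exponents up to `B`;
  -- only these coefficients are used. `E` and `O` are the two theta products, the latter still
  -- without its factor 2q.
  U T E O : ℕ → Series
  U B = gen (grid B) form (λ _ → + 1)
  T B = gen (grid B) form (λ (x , z) → sign z)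
  E B = gen (grid B) form₄ (λ (u , v) → sign u * sign v)
  O B = gen (grid B) formₒ (λ (s , t) → sign s * sign t)

  φ⁻-product : ∀ B → φ⁻ B 4 ⊗ φ⁻ B 12 ≗ E B
  φ⁻-product B = gen-⊗ (zs B) (zs B) (λ s → 4 ℕ.* square s) (λ s → 12 ℕ.* square s) sign sign

  ψ⁻-product : ∀ B → ψ⁻ B 2 ⊗ ψ⁻ B 6 ≗ O B
  ψ⁻-product B = gen-⊗ (zs B) (zs B) (λ s → 2 ℕ.* tri₂ s) (λ s → 6 ℕ.* tri₂ s) sign sign

  EvenFst EvenSum OddFst OddSum Diff4 Sum4 : ℤ × ℤ → Set
  EvenFst (x , z) = + 2 ∣ x
  EvenSum (x , z) = + 2 ∣ x + z
  OddFst  p = ¬ EvenFst p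
  OddSum  p = ¬ EvenSum p
  Diff4   (x , z) = + 4 ∣ x - z
  Sum4    (x , z) = + 4 ∣ x + z

  evenFst? : Decidable EvenFst
  evenFst? (x , z) = (+ 2) ∣? x
  evenSum? : Decidable EvenSum
  evenSum? (x , z) = (+ 2) ∣? (x + z)
  oddFst? : Decidable OddFst
  oddFst? p = ¬? (evenFst? p)
  oddSum? : Decidable OddSum
  oddSum? p = ¬? (evenSum? p)
  diff4? : Decidable Diff4
  diff4? (x , z) = (+ 4) ∣? (x - z)
  sum4? : Decidable Sum4
  sum4? (x , z) = (+ 4) ∣? (x + z)

  yes-or-no : {P : Set} → Dec P → P ⊎ ¬ P
  yes-or-no (yes p) = inj₁ p
  yes-or-no (no ¬p) = inj₂ ¬p

  count : ∀ {P : ℤ × ℤ → Set} → ℕ → Decidable P → ℤ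
  count B P? = ∑ (grid B) (λ p → on (P? p) (+ 1))

  module Coefficient (B i : ℕ) (i≤B : i ≤ B) where

    rep rep₄ : ℤ × ℤ → Set
    rep  p = form p ≡ i
    rep₄ p = form₄ p ≡ i
    rep? : Decidable rep
    rep? p = form p ≟ i
    rep₄? : Decidable rep₄
    rep₄? p = form₄ p ≟ i

    OddRep : ℤ × ℤ → Set
    OddRep p = rep p × OddFst p
    oddRep? : Decidable OddRep
    oddRep? p = rep? p ×-dec oddFst? p

    form-neg : ∀ x z → form (x , - z) ≡ form (x , z)
    form-neg x z = cong (λ k → square x ℕ.+ 3 ℕ.* (k ℕ.* k)) (∣-i∣≡∣i∣ z)

    -- For even `i` and even `x` the term 3z² is even, hence so is `z`, and both coordinates can be
    -- halved.
    even-fst : + 2 ∣ + i → count B (rep? ∩? evenFst?) ≡ count B rep₄?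
    even-fst (divides j j-eq) = grid-bijection B (rep? ∩? evenFst?) rep₄? (λ _ → + 1) (λ _ → + 1) ψ
      (λ (u , v) r → let r′ = trans (sym (same u v)) r in form-bounded (ψ (u , v)) r′ i≤B , (r′ , divides u refl) , refl)
      (λ (u , v) (u′ , v′) _ _ e → cong₂ _,_
        (ℤP.*-cancelʳ-≡ u u′ (+ 2) (cong proj₁ e)) (ℤP.*-cancelʳ-≡ v v′ (+ 2) (cong proj₂ e)))
      onto
      where
      ψ : ℤ × ℤ → ℤ × ℤ
      ψ (u , v) = u * + 2 , v * + 2
      same : ∀ u v → form₄ (u , v) ≡ form (u * + 2 , v * + 2)
      same u v = +-injective (trans (+form₄ u v) (trans (lemma u v) (sym (+form (u * + 2) (v * + 2)))))
        where
        lemma : ∀ u v → + 4 * (u * u) + + 12 * (v * v) ≡ u * + 2 * (u * + 2) + + 3 * (v * + 2 * (v * + 2))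
        lemma = solve-∀
      onto : ∀ p → rep p × EvenFst p → ∃ λ q → Bounded B q × rep₄ q × ψ q ≡ p
      onto (x , z) (r , divides u refl) with parity z
      ... | inj₁ (v , refl) = let r₄ = trans (same u v) r in (u , v) , form₄-bounded (u , v) r₄ i≤B , r₄ , refl
      ... | inj₂ (l , refl) = ⊥-elim (odd≢even (u * u * + 2 + + 6 * (l * l) + + 6 * l + + 1) j
        (trans (trans (lemma u l) (sym (+form (u * + 2) (l * + 2 + + 1)))) (trans (cong +_ r) j-eq)))
        where
        lemma : ∀ u l → (u * u * + 2 + + 6 * (l * l) + + 6 * l + + 1) * + 2 + + 1 ≡
          u * + 2 * (u * + 2) + + 3 * ((l * + 2 + + 1) * (l * + 2 + + 1))
        lemma = solve-∀

    -- The substitution multiplies u + v√-3 by 1 - √-3, an element of norm 4, and changes the sign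
    -- of the second coordinate. Its first coordinate u + 3v has the parity of u + v, which matches
    -- the two side conditions.
    odd-diff : count B (oddRep? ∩? diff4?) ≡ count B (rep₄? ∩? oddSum?)
    odd-diff = grid-bijection B (oddRep? ∩? diff4?) (rep₄? ∩? oddSum?) (λ _ → + 1) (λ _ → + 1) ψ
      (λ (u , v) (r , o) → let r′ = trans (sym (same u v)) r in
        form-bounded (ψ (u , v)) r′ i≤B , ((r′ , odd′ u v o) , divides v (lemma u v)) , refl)
      inj onto
      where
      ψ : ℤ × ℤ → ℤ × ℤ
      ψ (u , v) = u + + 3 * v , u - v
      lemma : ∀ u v → (u + + 3 * v) - (u - v) ≡ v * + 4
      lemma = solve-∀
      same : ∀ u v → form₄ (u , v) ≡ form (u + + 3 * v , u - v)
      same u v = +-injective (trans (+form₄ u v) (trans (lemma′ u v) (sym (+form (u + + 3 * v) (u - v)))))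
        where
        lemma′ : ∀ u v → + 4 * (u * u) + + 12 * (v * v) ≡ (u + + 3 * v) * (u + + 3 * v) + + 3 * ((u - v) * (u - v))
        lemma′ = solve-∀
      unique : ∀ x z m → x - z ≡ m * + 4 → ψ (x - + 3 * m , m) ≡ (x , z)
      unique x z m e = cong₂ _,_ (lemma₁ x m) (trans (lemma₂ x m) (trans (cong (λ y → x - y) (sym e)) (lemma₃ x z)))
        where
        lemma₁ : ∀ x m → x - + 3 * m + + 3 * m ≡ x
        lemma₁ = solve-∀
        lemma₂ : ∀ x m → x - + 3 * m - m ≡ x - m * + 4
        lemma₂ = solve-∀
        lemma₃ : ∀ x z → x - (x - z) ≡ z
        lemma₃ = solve-∀
      inj : ∀ q q′ → rep₄ q × OddSum q → rep₄ q′ × OddSum q′ → ψ q ≡ ψ q′ → q ≡ q′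
      inj (u , v) (u′ , v′) _ _ e =
        cong₂ _,_ (+-cancelʳ-≡ (- v) u u′ (trans (cong proj₂ e) (cong (λ y → u′ - y) (sym v≡v′)))) v≡v′
        where
        v≡v′ : v ≡ v′
        v≡v′ = ℤP.*-cancelʳ-≡ v v′ (+ 4) (trans (sym (lemma u v)) (trans (cong₂ _-_ (cong proj₁ e) (cong proj₂ e)) (lemma u′ v′)))
      odd : ∀ u v → OddFst (ψ (u , v)) → OddSum (u , v)
      odd u v h (divides k e) = h (divides (k + v) (trans (lemma₁ u v) (trans (cong (λ y → y + + 2 * v) e) (lemma₂ k v))))
        where
        lemma₁ : ∀ u v → u + + 3 * v ≡ u + v + + 2 * v
        lemma₁ = solve-∀
        lemma₂ : ∀ k v → k * + 2 + + 2 * v ≡ (k + v) * + 2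
        lemma₂ = solve-∀
      odd′ : ∀ u v → OddSum (u , v) → OddFst (ψ (u , v))
      odd′ u v h (divides k e) = h (divides (k - v) (trans (lemma₁ u v) (trans (cong (λ y → y - + 2 * v) e) (lemma₂ k v))))
        where
        lemma₁ : ∀ u v → u + v ≡ u + + 3 * v - + 2 * v
        lemma₁ = solve-∀
        lemma₂ : ∀ k v → k * + 2 - + 2 * v ≡ (k - v) * + 2
        lemma₂ = solve-∀
      onto : ∀ p → OddRep p × Diff4 p → ∃ λ q → Bounded B q × (rep₄ q × OddSum q) × ψ q ≡ p
      onto (x , z) ((r , o) , divides m e) with x - + 3 * m | unique x z m e
      ... | u | refl = let r₄ = trans (same u m) r in (u , m) , form₄-bounded (u , m) r₄ i≤B , (r₄ , odd u m o) , refl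

    odd-sum : count B (oddRep? ∩? sum4?) ≡ count B (oddRep? ∩? diff4?)
    odd-sum = grid-bijection B (oddRep? ∩? sum4?) (oddRep? ∩? diff4?) (λ _ → + 1) (λ _ → + 1) neg
      (λ (x , z) ((r , o) , s) → let r′ = trans (form-neg x z) r in form-bounded (neg (x , z)) r′ i≤B , ((r′ , o) , s) , refl)
      (λ (x , z) (x′ , z′) _ _ e → cong₂ _,_ (cong proj₁ e) (neg-injective (cong proj₂ e)))
      (λ (x , z) ((r , o) , s) → let r′ = trans (form-neg x z) r in
        neg (x , z) , form-bounded (neg (x , z)) r′ i≤B ,
        ((r′ , o) , subst (λ y → + 4 ∣ x + y) (sym (neg-involutive z)) s) , cong (x ,_) (neg-involutive z))
      where
      neg : ℤ × ℤ → ℤ × ℤ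
      neg (x , z) = x , - z

  square-parity : ∀ x → ∃ λ k → x * x ≡ x + k * + 2
  square-parity x with parity x
  ... | inj₁ (k , refl) = + 2 * (k * k) - k , lemma k
    where
    lemma : ∀ k → k * + 2 * (k * + 2) ≡ k * + 2 + (+ 2 * (k * k) - k) * + 2
    lemma = solve-∀
  ... | inj₂ (k , refl) = + 2 * (k * k) + k , lemma k
    where
    lemma : ∀ k → (k * + 2 + + 1) * (k * + 2 + + 1) ≡ k * + 2 + + 1 + (+ 2 * (k * k) + k) * + 2
    lemma = solve-∀

  form-parity : ∀ x z → ∃ λ k → + form (x , z) ≡ x + z + k * + 2
  form-parity x z with square-parity x | square-parity z
  ... | k , e | l , e′ = k + z + + 3 * l , trans (+form x z) (trans (cong₂ (λ p q → p + + 3 * q) e e′) (lemma x z k l))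
    where
    lemma : ∀ x z k l → x + k * + 2 + + 3 * (z + l * + 2) ≡ x + z + (k + z + + 3 * l) * + 2
    lemma = solve-∀

  even-form⇒ : ∀ {i} x z → form (x , z) ≡ i → + 2 ∣ + i → + 2 ∣ x + z
  even-form⇒ x z refl (divides j e) with form-parity x z
  ... | k , e′ = divides (j - k) (trans (lemma (x + z) k) (trans (cong (λ y → y - k * + 2) (trans (sym e′) e)) (lemma′ j k)))
    where
    lemma : ∀ s k → s ≡ s + k * + 2 - k * + 2
    lemma = solve-∀
    lemma′ : ∀ j k → j * + 2 - k * + 2 ≡ (j - k) * + 2
    lemma′ = solve-∀

  even-form⇐ : ∀ {i} x z → form (x , z) ≡ i → + 2 ∣ x + z → + 2 ∣ + i
  even-form⇐ x z refl (divides j e) with form-parity x z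
  ... | k , e′ = divides (j + k) (trans e′ (trans (cong (λ y → y + k * + 2) e) (sym (ℤP.*-distribʳ-+ (+ 2) j k))))

  ∣-cancel-+ : ∀ {d x} z → d ∣ x + z → d ∣ x → d ∣ z
  ∣-cancel-+ {d} {x} z s h = ∣m+n∣m⇒∣n {d} {x} {z} s h

  half-difference : ∀ x z → ¬ + 2 ∣ x → ¬ + 2 ∣ z → (+ 4 ∣ x - z) ⊎ (+ 4 ∣ x + z)
  half-difference x z hx hz with 2∤⇒odd hx | 2∤⇒odd hz
  ... | k , refl | l , refl with parity (k - l)
  ... | inj₁ (m , e) = inj₁ (divides m (trans (lemma k l) (trans (cong (λ y → y * + 2) e) (lemma′ m))))
    where
    lemma : ∀ k l → k * + 2 + + 1 - (l * + 2 + + 1) ≡ (k - l) * + 2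
    lemma = solve-∀
    lemma′ : ∀ m → m * + 2 * + 2 ≡ m * + 4
    lemma′ = solve-∀
  ... | inj₂ (m , e) = inj₂ (divides (m + l + + 1) (trans (lemma k l) (trans (cong (λ y → (y + + 2 * l + + 1) * + 2) e) (lemma′ m l))))
    where
    lemma : ∀ k l → k * + 2 + + 1 + (l * + 2 + + 1) ≡ (k - l + + 2 * l + + 1) * + 2
    lemma = solve-∀
    lemma′ : ∀ m l → (m * + 2 + + 1 + + 2 * l + + 1) * + 2 ≡ (m + l + + 1) * + 4
    lemma′ = solve-∀

  not-both : ∀ x z → ¬ + 2 ∣ x → + 4 ∣ x - z → + 4 ∣ x + z → ⊥
  not-both x z hx (divides m e) (divides l e′) = hx (divides (m + l)
    (ℤP.*-cancelʳ-≡ x ((m + l) * + 2) (+ 2) (trans (lemma x z) (trans (cong₂ _+_ e e′) (lemma′ m l)))))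
    where
    lemma : ∀ x z → x * + 2 ≡ x - z + (x + z)
    lemma = solve-∀
    lemma′ : ∀ m l → m * + 4 + l * + 4 ≡ (m + l) * + 2 * + 2
    lemma′ = solve-∀

  sign-even′ : ∀ {x} → + 2 ∣ x → sign x ≡ + 1
  sign-even′ (divides k refl) = sign-even k

  sign-odd′ : ∀ {x} → ¬ + 2 ∣ x → sign x ≡ - + 1
  sign-odd′ h with 2∤⇒odd h
  ... | k , refl = sign-odd k

  form₄-even : ∀ p → + 2 ∣ + form₄ p
  form₄-even (u , v) = divides (+ 2 * (u * u) + + 6 * (v * v)) (trans (+form₄ u v) (lemma u v))
    where
    lemma : ∀ u v → + 4 * (u * u) + + 12 * (v * v) ≡ (+ 2 * (u * u) + + 6 * (v * v)) * + 2
    lemma = solve-∀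

  formₒ-even : ∀ p → + 2 ∣ + formₒ p
  formₒ-even (s , t) = divides (+ tri₂ s + + 3 * + tri₂ t) (trans (+-scaled 2 6 (tri₂ s) (tri₂ t) refl refl) (lemma (+ tri₂ s) (+ tri₂ t)))
    where
    lemma : ∀ u v → + 2 * u + + 6 * v ≡ (u + + 3 * v) * + 2
    lemma = solve-∀

  E-odd : ∀ B i → ¬ + 2 ∣ + i → E B i ≡ + 0
  E-odd B i h = ∑-0 (grid B) (λ p _ → on-no (form₄ p ≟ i) (λ { refl → h (form₄-even p) }))

  O-odd : ∀ B i → ¬ + 2 ∣ + i → O B i ≡ + 0
  O-odd B i h = ∑-0 (grid B) (λ p _ → on-no (formₒ p ≟ i) (λ { refl → h (formₒ-even p) }))

  Class₁ Class₃ : ℤ × ℤ → Set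
  Class₁ (u , v) = + 4 ∣ u - v - + 1
  Class₃ (u , v) = + 4 ∣ u - v + + 1
  class₁? : Decidable Class₁
  class₁? (u , v) = (+ 4) ∣? (u - v - + 1)
  class₃? : Decidable Class₃
  class₃? (u , v) = (+ 4) ∣? (u - v + + 1)

  module _ (B i : ℕ) (i≤B : i ≤ B) where

    open Coefficient B i i≤B

    -- Let C and D count the solutions of form₄ = i with u + v even and odd. Solutions with x even
    -- have sign +1 and number C + D. Those with x odd have sign -1; they satisfy x ≡ z or x ≡ -z
    -- (mod 4), D of them each. The total C + D - 2D is C - D, the coefficient of `E`.
    T-even : + 2 ∣ + i → T B i ≡ E B i
    T-even h = begin
      T B i
        ≡⟨ ∑-split (grid B) rep? evenFst? oddFst? (λ (x , z) → sign z) (λ p _ → yes-or-no (evenFst? p)) (λ p _ q r → r q) ⟩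
      ∑ (grid B) (λ p → on (rep? p ×-dec evenFst? p) (sign (proj₂ p))) + ∑ (grid B) (λ p → on (oddRep? p) (sign (proj₂ p)))
        ≡⟨ cong₂ _+_ (∑-const (grid B) (rep? ∩? evenFst?) (λ p → sign (proj₂ p)) (+ 1)
             (λ (x , z) (r , q) → sign-even′ (∣-cancel-+ z (even-form⇒ x z r h) q)))
           (∑-const (grid B) oddRep? (λ p → sign (proj₂ p)) (- + 1) (λ (x , z) (r , o) → sign-odd′ (odd-snd x z r o))) ⟩
      + 1 * count B (rep? ∩? evenFst?) + - + 1 * count B oddRep?
        ≡⟨ cong₂ (λ s t → + 1 * s + - + 1 * t) (even-fst h) (trans
             (∑-split (grid B) oddRep? diff4? sum4? (λ _ → + 1)
               (λ (x , z) (r , o) → half-difference x z o (odd-snd x z r o)) (λ (x , z) (_ , o) → not-both x z o))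
             (cong₂ _+_ odd-diff (trans odd-sum odd-diff))) ⟩
      + 1 * count B rep₄? + - + 1 * (D + D)
        ≡⟨ cong (λ s → + 1 * s + - + 1 * (D + D)) (split₄ (λ _ → + 1)) ⟩
      + 1 * (C + D) + - + 1 * (D + D)
        ≡⟨ lemma C D ⟩
      + 1 * C + - + 1 * D
        ≡⟨ sym (trans (split₄ (λ (u , v) → sign u * sign v)) (cong₂ _+_
             (∑-const (grid B) (rep₄? ∩? evenSum?) (λ (u , v) → sign u * sign v) (+ 1)
               (λ (u , v) (_ , q) → trans (sym (sign-+ u v)) (sign-even′ q)))
             (∑-const (grid B) (rep₄? ∩? oddSum?) (λ (u , v) → sign u * sign v) (- + 1)
               (λ (u , v) (_ , q) → trans (sym (sign-+ u v)) (sign-odd′ q))))) ⟩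
      E B i ∎
      where
      open ≡-Reasoning
      C D : ℤ
      C = count B (rep₄? ∩? evenSum?)
      D = count B (rep₄? ∩? oddSum?)
      lemma : ∀ C D → + 1 * (C + D) + - + 1 * (D + D) ≡ + 1 * C + - + 1 * D
      lemma = solve-∀
      odd-snd : ∀ x z → rep (x , z) → ¬ + 2 ∣ x → ¬ + 2 ∣ z
      odd-snd x z r o q = o (∣-cancel-+ x (∣-cast (ℤP.+-comm x z) (even-form⇒ x z r h)) q)
      split₄ : ∀ w → ∑ (grid B) (λ p → on (rep₄? p) (w p)) ≡
        ∑ (grid B) (λ p → on (rep₄? p ×-dec evenSum? p) (w p)) + ∑ (grid B) (λ p → on (rep₄? p ×-dec oddSum? p) (w p))
      split₄ w = ∑-split (grid B) rep₄? evenSum? oddSum? w (λ p _ → yes-or-no (evenSum? p)) (λ p _ q r → r q)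

    repₒ? : Decidable (λ p → suc (formₒ p) ≡ i)
    repₒ? p = suc (formₒ p) ≟ i

    -- For odd `i` the difference x - z is 1 or 3 modulo 4, and negating both coordinates exchanges
    -- the two classes: this is the factor 2. The class of 1 is parametrised by x = s + 3t + 1, z =
    -- s - t, where the sign (-1)^z becomes (-1)^s (-1)^t.
    T-odd : ¬ + 2 ∣ + i → T B i ≡ + 2 * ∑ (grid B) (λ (s , t) → on (repₒ? (s , t)) (sign s * sign t))
    T-odd h = begin
      T B i
        ≡⟨ ∑-split (grid B) rep? class₁? class₃? (λ (x , z) → sign z) classes exclusive ⟩
      ∑ (grid B) (λ p → on (rep? p ×-dec class₁? p) (sign (proj₂ p))) + ∑ (grid B) (λ p → on (rep? p ×-dec class₃? p) (sign (proj₂ p)))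
        ≡⟨ cong₂ _+_ first (trans second first) ⟩
      W + W
        ≡⟨ lemma W ⟩
      + 2 * W ∎
      where
      open ≡-Reasoning
      W : ℤ
      W = ∑ (grid B) (λ (s , t) → on (repₒ? (s , t)) (sign s * sign t))
      lemma : ∀ w → w + w ≡ + 2 * w
      lemma = solve-∀
      classes : ∀ p → rep p → Class₁ p ⊎ Class₃ p
      classes (u , v) r with parity (u + v)
      ... | inj₁ (k , e) = ⊥-elim (h (even-form⇐ u v r (divides k e)))
      ... | inj₂ (k , e) with parity (k - v)
      ... | inj₁ (m , e′) = inj₁ (divides m (trans (l₁ u v) (trans (cong (λ y → y - + 2 * v - + 1) e) (trans (l₂ k v) (trans (cong (λ y → y * + 2) e′) (l₃ m))))))
        where
        l₁ : ∀ u v → u - v - + 1 ≡ u + v - + 2 * v - + 1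
        l₁ = solve-∀
        l₂ : ∀ k v → k * + 2 + + 1 - + 2 * v - + 1 ≡ (k - v) * + 2
        l₂ = solve-∀
        l₃ : ∀ m → m * + 2 * + 2 ≡ m * + 4
        l₃ = solve-∀
      ... | inj₂ (m , e′) = inj₂ (divides (m + + 1) (trans (l₁ u v) (trans (cong (λ y → y - + 2 * v + + 1) e) (trans (l₂ k v) (trans (cong (λ y → (y + + 1) * + 2) e′) (l₃ m))))))
        where
        l₁ : ∀ u v → u - v + + 1 ≡ u + v - + 2 * v + + 1
        l₁ = solve-∀
        l₂ : ∀ k v → k * + 2 + + 1 - + 2 * v + + 1 ≡ (k - v + + 1) * + 2
        l₂ = solve-∀
        l₃ : ∀ m → (m * + 2 + + 1 + + 1) * + 2 ≡ (m + + 1) * + 4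
        l₃ = solve-∀
      exclusive : ∀ p → rep p → Class₁ p → Class₃ p → ⊥
      exclusive (u , v) _ (divides k e) (divides l e′) = odd≢even k l
        (ℤP.*-cancelʳ-≡ (k * + 2 + + 1) (l * + 2) (+ 2) (trans (l₁ k) (trans (cong (λ y → y + + 2) (sym e)) (trans (l₂ u v) (trans e′ (l₃ l))))))
        where
        l₁ : ∀ k → (k * + 2 + + 1) * + 2 ≡ k * + 4 + + 2
        l₁ = solve-∀
        l₂ : ∀ u v → u - v - + 1 + + 2 ≡ u - v + + 1
        l₂ = solve-∀
        l₃ : ∀ l → l * + 4 ≡ l * + 2 * + 2
        l₃ = solve-∀
      second : ∑ (grid B) (λ p → on (rep? p ×-dec class₃? p) (sign (proj₂ p))) ≡ ∑ (grid B) (λ p → on (rep? p ×-dec class₁? p) (sign (proj₂ p)))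
      second = grid-bijection B (rep? ∩? class₃?) (rep? ∩? class₁?) (λ p → sign (proj₂ p)) (λ p → sign (proj₂ p)) neg
        (λ (u , v) (r , c) → let r′ = trans (form-neg² u v) r in form-bounded (neg (u , v)) r′ i≤B ,
          (r′ , ∣-resp (l₁ u v) (∣m⇒∣-m c)) , sign-neg v)
        (λ (u , v) (u′ , v′) _ _ e → cong₂ _,_ (neg-injective (cong proj₁ e)) (neg-injective (cong proj₂ e)))
        (λ (u , v) (r , c) → let r′ = trans (form-neg² u v) r in neg (u , v) , form-bounded (neg (u , v)) r′ i≤B ,
          (r′ , ∣-resp (l₂ u v) (∣m⇒∣-m c)) , cong₂ _,_ (neg-involutive u) (neg-involutive v))
        where
        neg : ℤ × ℤ → ℤ × ℤ
        neg (u , v) = - u , - v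
        form-neg² : ∀ u v → form (- u , - v) ≡ form (u , v)
        form-neg² u v = cong₂ (λ k l → k ℕ.* k ℕ.+ 3 ℕ.* (l ℕ.* l)) (∣-i∣≡∣i∣ u) (∣-i∣≡∣i∣ v)
        ∣-resp : ∀ {x y} → x ≡ y → + 4 ∣ x → + 4 ∣ y
        ∣-resp refl d = d
        l₁ : ∀ u v → - (u - v - + 1) ≡ - u - - v + + 1
        l₁ = solve-∀
        l₂ : ∀ u v → - (u - v + + 1) ≡ - u - - v - + 1
        l₂ = solve-∀
      first : ∑ (grid B) (λ p → on (rep? p ×-dec class₁? p) (sign (proj₂ p))) ≡ W
      first = grid-bijection B (rep? ∩? class₁?) repₒ? (λ p → sign (proj₂ p)) (λ (s , t) → sign s * sign t) ψ
        (λ (s , t) r → let r′ = trans (sym (same s t)) r in form-bounded (ψ (s , t)) r′ i≤B , (r′ , divides t (l₁ s t)) ,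
          trans (sign-+ s (- t)) (cong (λ y → sign s * y) (sign-neg t)))
        inj onto
        where
        ψ : ℤ × ℤ → ℤ × ℤ
        ψ (s , t) = s + + 3 * t + + 1 , s - t
        l₁ : ∀ s t → s + + 3 * t + + 1 - (s - t) - + 1 ≡ t * + 4
        l₁ = solve-∀
        same : ∀ s t → suc (formₒ (s , t)) ≡ form (ψ (s , t))
        same s t = +-injective (trans (cong (λ y → + 1 + y) (+formₒ s t)) (trans (l₂ s t) (sym (+form (s + + 3 * t + + 1) (s - t)))))
          where
          l₂ : ∀ s t → + 1 + (+ 2 * (+ 2 * (s * s) + s) + + 6 * (+ 2 * (t * t) + t)) ≡
            (s + + 3 * t + + 1) * (s + + 3 * t + + 1) + + 3 * ((s - t) * (s - t))
          l₂ = solve-∀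
        inj : ∀ q q′ → _ → _ → ψ q ≡ ψ q′ → q ≡ q′
        inj (s , t) (s′ , t′) _ _ e = cong₂ _,_ (+-cancelʳ-≡ (- t) s s′ (trans (cong proj₂ e) (cong (λ y → s′ - y) (sym t≡t′)))) t≡t′
          where
          t≡t′ : t ≡ t′
          t≡t′ = ℤP.*-cancelʳ-≡ t t′ (+ 4) (trans (sym (l₁ s t)) (trans (cong₂ (λ x y → x - y - + 1) (cong proj₁ e) (cong proj₂ e)) (l₁ s′ t′)))
        onto : ∀ p → rep p × Class₁ p → ∃ λ q → Bounded B q × suc (formₒ q) ≡ i × ψ q ≡ p
        onto (u , v) (r , divides m e) = (v + m , m) , formₒ-bounded (v + m , m) rₒ i≤B , rₒ , unique
          where
          l₂ : ∀ v m → v + m + + 3 * m + + 1 ≡ v + m * + 4 + + 1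
          l₂ = solve-∀
          l₃ : ∀ u v → v + (u - v - + 1) + + 1 ≡ u
          l₃ = solve-∀
          l₄ : ∀ v m → v + m - m ≡ v
          l₄ = solve-∀
          unique : ψ (v + m , m) ≡ (u , v)
          unique = cong₂ _,_ (trans (l₂ v m) (trans (cong (λ y → v + y + + 1) (sym e)) (l₃ u v))) (l₄ v m)
          rₒ : suc (formₒ (v + m , m)) ≡ i
          rₒ = trans (same (v + m) m) (trans (cong form unique) r)

  -- Odd coefficients of T²

  parityℕ : ∀ n → (+ 2 ∣ + n) ⊎ (¬ + 2 ∣ + n)
  parityℕ n = yes-or-no ((+ 2) ∣? (+ n))

  even-+ : ∀ {x y} → + 2 ∣ x → + 2 ∣ y → + 2 ∣ x + y
  even-+ = ∣m∣n⇒∣m+n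

  odd-+ : ∀ {x y} → ¬ + 2 ∣ x → ¬ + 2 ∣ y → + 2 ∣ x + y
  odd-+ hx hy with 2∤⇒odd hx | 2∤⇒odd hy
  ... | k , refl | l , refl = divides (k + l + + 1) (lemma k l)
    where
    lemma : ∀ k l → k * + 2 + + 1 + (l * + 2 + + 1) ≡ (k + l + + 1) * + 2
    lemma = solve-∀

  +-∸ : ∀ {i n} → i ≤ n → + n ≡ + i + + (n ∸ i)
  +-∸ i≤n = cong +_ (sym (m+[n∸m]≡n i≤n))

  ⊗-vanishes : ∀ f g n → (∀ i → i ≤ n → f i * g (n ∸ i) ≡ + 0) → (f ⊗ g) n ≡ + 0
  ⊗-vanishes f g n h = trans (⊗-∑ f g n) (∑-0 (ns n) (λ i i∈ → h i (∈-ns⁻ n i∈)))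

  EvenSupport OddSupport : Series → Set
  EvenSupport f = ∀ i → ¬ + 2 ∣ + i → f i ≡ + 0
  OddSupport  f = ∀ i → + 2 ∣ + i → f i ≡ + 0

  ⊗-even : ∀ f g n → EvenSupport f → EvenSupport g → ¬ + 2 ∣ + n → (f ⊗ g) n ≡ + 0
  ⊗-even f g n hf hg odd = ⊗-vanishes f g n go
    where
    go : ∀ i → i ≤ n → f i * g (n ∸ i) ≡ + 0
    go i i≤n with parityℕ i
    ... | inj₂ o = cong (λ y → y * g (n ∸ i)) (hf i o)
    ... | inj₁ e = trans (cong (λ y → f i * y) (hg (n ∸ i) (λ e′ → odd (∣-cast (sym (+-∸ i≤n)) (even-+ e e′))))) (ℤP.*-zeroʳ (f i))

  ⊗-odd : ∀ f g n → OddSupport f → OddSupport g → ¬ + 2 ∣ + n → (f ⊗ g) n ≡ + 0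
  ⊗-odd f g n hf hg odd = ⊗-vanishes f g n go
    where
    go : ∀ i → i ≤ n → f i * g (n ∸ i) ≡ + 0
    go i i≤n with parityℕ i
    ... | inj₁ e = cong (λ y → y * g (n ∸ i)) (hf i e)
    ... | inj₂ o with parityℕ (n ∸ i)
    ... | inj₁ e  = trans (cong (λ y → f i * y) (hg (n ∸ i) e)) (ℤP.*-zeroʳ (f i))
    ... | inj₂ o′ = ⊥-elim (odd (∣-cast (sym (+-∸ i≤n)) (odd-+ o o′)))

  V : ℕ → Series
  V B zero    = + 0
  V B (suc j) = O B j

  V≗shift : ∀ B → V B ≗ mono (+ 1) 1 ⊗ O B
  V≗shift B zero    = sym (⊗-mono-< (+ 1) 1 (O B) 0 (s≤s z≤n))
  V≗shift B (suc j) = sym (trans (⊗-mono (+ 1) 1 (O B) j) (ℤP.*-identityˡ (O B j)))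

  suc-odd : ∀ j → + 2 ∣ + suc j → ¬ + 2 ∣ + j
  suc-odd j (divides k e) (divides l e′) = odd≢even l k (trans (cong (λ y → y + + 1) (sym e′)) (trans (ℤP.+-comm (+ j) (+ 1)) e))

  V-odd : ∀ B → OddSupport (V B)
  V-odd B zero    h = refl
  V-odd B (suc j) h = O-odd B j (suc-odd j h)

  T-decomposition : ∀ B i → i ≤ B → T B i ≡ E B i + (V B i + V B i)
  T-decomposition B i i≤B with parityℕ i
  ... | inj₁ e = trans (T-even B i i≤B e) (trans (sym (ℤP.+-identityʳ (E B i)))
    (cong (λ y → E B i + y) (sym (cong₂ _+_ (V-odd B i e) (V-odd B i e)))))
  T-decomposition B zero    i≤B | inj₂ o = ⊥-elim (o (divides (+ 0) refl))
  T-decomposition B (suc j) i≤B | inj₂ o = trans (T-odd B (suc j) i≤B o) (trans (cong (λ y → + 2 * y) shift) (trans (lemma (O B j))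
    (cong (λ y → y + (O B j + O B j)) (sym (E-odd B (suc j) o)))))
    where
    shift : ∑ (grid B) (λ (s , t) → on (suc (formₒ (s , t)) ≟ suc j) (sign s * sign t)) ≡ O B j
    shift = ∑-cong′ (grid B) (λ (s , t) → on-cong (suc (formₒ (s , t)) ≟ suc j) (formₒ (s , t) ≟ j) suc-injective (cong suc) (λ _ → refl))
    lemma : ∀ x → + 2 * x ≡ + 0 + (x + x)
    lemma = solve-∀

  T²≡4a : ∀ m → ¬ + 2 ∣ + suc m → (T (suc m) ⊗ T (suc m)) (suc m) ≡ + 4 * a (suc m)
  T²≡4a m odd = begin
    (T B ⊗ T B) B
      ≡⟨ ⊗-cong-≤ {T B} {E+2V} {T B} {E+2V} B (T-decomposition B) (T-decomposition B) ⟩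
    (E+2V ⊗ E+2V) B
      ≡⟨ Solver.solve 2 (λ e v → (e Solver.:+ (v Solver.:+ v)) Solver.:* (e Solver.:+ (v Solver.:+ v)) Solver.:=
           e Solver.:* e Solver.:+ (((v Solver.:* e) Solver.:+ (v Solver.:* e) Solver.:+ (v Solver.:* e) Solver.:+ (v Solver.:* e)) Solver.:+
           ((v Solver.:* v) Solver.:+ (v Solver.:* v) Solver.:+ (v Solver.:* v) Solver.:+ (v Solver.:* v)))) S.refl (E B) (V B) B ⟩
    (E B ⊗ E B) B + ((VE + VE + VE + VE) + (VV + VV + VV + VV))
      -- Squares of series supported on one parity class live in even degrees, so both vanish at the
      -- odd degree `B`.
      ≡⟨ cong₂ (λ p q → p + ((VE + VE + VE + VE) + (q + q + q + q)))
           (⊗-even (E B) (E B) B (E-odd B) (E-odd B) odd) (⊗-odd (V B) (V B) B (V-odd B) (V-odd B) odd) ⟩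
    + 0 + ((VE + VE + VE + VE) + + 0)
      ≡⟨ lemma VE ⟩
    + 4 * VE
      ≡⟨ cong (λ y → + 4 * y) shifted ⟩
    + 4 * (E B ⊗ O B) m
      ≡⟨ cong (λ y → + 4 * y) (sym (trans (a≡theta m) (S.*-cong (φ⁻-product B) (ψ⁻-product B) m))) ⟩
    + 4 * a (suc m) ∎
    where
    open ≡-Reasoning
    module Solver = Algebra.Solver.Ring.NaturalCoefficients.Default S.commutativeSemiring
    B : ℕ
    B = suc m
    E+2V : Series
    E+2V i = E B i + (V B i + V B i)
    VE VV : ℤ
    VE = (V B ⊗ E B) B
    VV = (V B ⊗ V B) B
    lemma : ∀ x → + 0 + ((x + x + x + x) + + 0) ≡ + 4 * x
    lemma = solve-∀
    -- The factor q of `V` is the factor q in front of the product that defines `a`.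
    shifted : VE ≡ (E B ⊗ O B) m
    shifted = begin
      (V B ⊗ E B) (suc m)                     ≡⟨ S.*-congʳ {E B} {V B} {mono (+ 1) 1 ⊗ O B} (V≗shift B) (suc m) ⟩
      ((mono (+ 1) 1 ⊗ O B) ⊗ E B) (suc m)    ≡⟨ ⊗-assoc (mono (+ 1) 1) (O B) (E B) (suc m) ⟩
      (mono (+ 1) 1 ⊗ (O B ⊗ E B)) (suc m)    ≡⟨ ⊗-mono (+ 1) 1 (O B ⊗ E B) m ⟩
      + 1 * (O B ⊗ E B) m                     ≡⟨ ℤP.*-identityˡ _ ⟩
      (O B ⊗ E B) m                           ≡⟨ ⊗-comm (O B) (E B) m ⟩
      (E B ⊗ O B) m                           ∎

  -- Liouville's convolution identity

  χ F : ℕ → ℤ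
  χ 0 = + 0
  χ 1 = + 1
  χ 2 = - + 1
  χ (suc (suc (suc n))) = χ n
  F 0 = + 1
  F 1 = + 0
  F 2 = + 0
  F (suc (suc (suc n))) = F n

  -- χ a * χ b = F (a − b) − F (a + b), stated for a = b + d to avoid truncated subtraction.
  χ-product : ∀ b d → χ (b ℕ.+ d) * χ b ≡ F d - F (b ℕ.+ d ℕ.+ b)
  χ-product 0 d = trans (ℤP.*-zeroʳ (χ d)) (sym (trans (cong (λ k → F d - F k) (ℕP.+-identityʳ d)) (+-inverseʳ (F d))))
  χ-product 1 0 = refl
  χ-product 1 1 = refl
  χ-product 1 2 = refl
  χ-product 1 (suc (suc (suc d))) = χ-product 1 d
  χ-product 2 0 = refl
  χ-product 2 1 = refl
  χ-product 2 2 = refl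
  χ-product 2 (suc (suc (suc d))) = χ-product 2 d
  χ-product (suc (suc (suc b))) d = trans (χ-product b d) (cong (λ k → F d - k) (sym (period (b ℕ.+ d) b)))
    where
    period : ∀ m n → F (m ℕ.+ suc (suc (suc n))) ≡ F (m ℕ.+ n)
    period m n = cong F (trans (+-suc m _) (cong suc (trans (+-suc m _) (cong suc (+-suc m n)))))

  pairs : ℕ → List (ℕ × ℕ)
  pairs B = cartesianProduct (ps B) (ps B)

  A : ℕ → Series
  A B = gen (pairs B) (λ (d , e) → d ℕ.* e) (λ (d , e) → χ d)

  Quad : Set
  Quad = (ℕ × ℕ) × (ℕ × ℕ)

  _≟ℕ²_ : (p q : ℕ × ℕ) → Dec (p ≡ q)
  _≟ℕ²_ = ≡-dec _≟_ _≟_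

  Positive : Quad → Set
  Positive ((a , x) , (b , y)) = (1 ≤ a × 1 ≤ x) × (1 ≤ b × 1 ≤ y)

  pairs-unique : ∀ B → Unique (pairs B)
  pairs-unique B = cartesianProduct⁺ (ps-unique B) (ps-unique B)

  ∈-pairs⁻ : ∀ B {a x} → (a , x) ∈ pairs B → (1 ≤ a × a ≤ B) × (1 ≤ x × x ≤ B)
  ∈-pairs⁻ B h = let p , q = ∈-cartesianProduct⁻ (ps B) (ps B) h in ∈-ps⁻ B p , ∈-ps⁻ B q

  ≤-product : ∀ {m n} → 1 ≤ n → m ≤ m ℕ.* n
  ≤-product {m} {suc n} _ = m≤m*n m (suc n)

  ∈-pairs⁺ : ∀ B {a x} → 1 ≤ a → 1 ≤ x → a ℕ.* x ≤ B → (a , x) ∈ pairs B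
  ∈-pairs⁺ B {a} {x} p q h = ∈-cartesianProduct⁺ (∈-ps⁺ B p (≤-trans (≤-product q) h))
    (∈-ps⁺ B q (≤-trans (≤-product p) (subst (_≤ B) (ℕP.*-comm a x) h)))

  module Liouville (N : ℕ) where

    quads′ : List Quad
    quads′ = cartesianProduct (pairs N) (pairs N)

    quads′-unique : Unique quads′
    quads′-unique = cartesianProduct⁺ (pairs-unique N) (pairs-unique N)

    Sol : Quad → Set
    Sol ((a , x) , (b , y)) = a ℕ.* x ℕ.+ b ℕ.* y ≡ N
    sol? : Decidable Sol
    sol? ((a , x) , (b , y)) = a ℕ.* x ℕ.+ b ℕ.* y ≟ N

    ∈⇒positive : ∀ q → q ∈ quads′ → Positive q
    ∈⇒positive (p , q) h = let h₁ , h₂ = ∈-cartesianProduct⁻ (pairs N) (pairs N) h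
                               (a , _) , (x , _) = ∈-pairs⁻ N h₁
                               (b , _) , (y , _) = ∈-pairs⁻ N h₂ in (a , x) , (b , y)

    positive⇒∈ : ∀ q → Positive q → Sol q → q ∈ quads′
    positive⇒∈ ((a , x) , (b , y)) ((pa , px) , (pb , py)) refl = ∈-cartesianProduct⁺
      (∈-pairs⁺ N pa px (m≤m+n _ _)) (∈-pairs⁺ N pb py (m≤n+m _ (a ℕ.* x)))

    total : {P : Quad → Set} → Decidable P → (Quad → ℤ) → ℤ
    total P? w = ∑ quads′ (λ q → on (sol? q ×-dec P? q) (w q))

    total-bijection : ∀ {P Q : Quad → Set} (P? : Decidable P) (Q? : Decidable Q) (v w : Quad → ℤ) (ψ : Quad → Quad) →
      (∀ q → Positive q → Sol q → Q q → Positive (ψ q) × Sol (ψ q) × P (ψ q) × v (ψ q) ≡ w q) →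
      (∀ q q′ → Q q → Q q′ → ψ q ≡ ψ q′ → q ≡ q′) →
      (∀ p → Positive p → Sol p → P p → ∃ λ q → Positive q × Sol q × Q q × ψ q ≡ p) →
      total P? v ≡ total Q? w
    total-bijection P? Q? v w ψ into inj onto = ∑-bijection (≡-dec _≟ℕ²_ _≟ℕ²_) (≡-dec _≟ℕ²_ _≟ℕ²_) quads′-unique quads′-unique
      (sol? ∩? P?) (sol? ∩? Q?) v w ψ
      (λ q q∈ (s , h) → let pos , s′ , p , e = into q (∈⇒positive q q∈) s h in positive⇒∈ (ψ q) pos s′ , (s′ , p) , e)
      (λ q q′ (_ , h) (_ , h′) → inj q q′ h h′)
      (λ p p∈ (s , h) → let q , pos , s′ , h′ , e = onto p (∈⇒positive p p∈) s h in q , positive⇒∈ q pos s′ , (s′ , h′) , e)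

    a>b a<b a=b x<y x>y x=y : Quad → Set
    a>b ((a , x) , (b , y)) = b < a
    a<b ((a , x) , (b , y)) = a < b
    a=b ((a , x) , (b , y)) = a ≡ b
    x<y ((a , x) , (b , y)) = x < y
    x>y ((a , x) , (b , y)) = y < x
    x=y ((a , x) , (b , y)) = x ≡ y
    a>b? : Decidable a>b
    a>b? ((a , x) , (b , y)) = b <? a
    a<b? : Decidable a<b
    a<b? ((a , x) , (b , y)) = a <? b
    a=b? : Decidable a=b
    a=b? ((a , x) , (b , y)) = a ≟ b
    x<y? : Decidable x<y
    x<y? ((a , x) , (b , y)) = x <? y
    x>y? : Decidable x>y
    x>y? ((a , x) , (b , y)) = y <? x
    x=y? : Decidable x=y
    x=y? ((a , x) , (b , y)) = x ≟ y

    swap : ∀ {P Q : Quad → Set} (P? : Decidable P) (Q? : Decidable Q) (v w : Quad → ℤ) →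
      (∀ p q → Q (p , q) → P (q , p)) → (∀ p q → P (p , q) → Q (q , p)) → (∀ p q → v (q , p) ≡ w (p , q)) →
      total P? v ≡ total Q? w
    swap P? Q? v w f g e = total-bijection P? Q? v w (λ (p , q) → q , p)
      (λ ((a , x) , (b , y)) (pa , pb) s h → (pb , pa) , trans (ℕP.+-comm (b ℕ.* y) (a ℕ.* x)) s , f _ _ h , e _ _)
      (λ { (p , q) (p′ , q′) _ _ refl → refl })
      (λ ((a , x) , (b , y)) (pa , pb) s h → _ , (pb , pa) , trans (ℕP.+-comm (b ℕ.* y) (a ℕ.* x)) s , g _ _ h , refl)

    -- The inequality x < y is what keeps y - x positive, and on the other side it turns into the
    -- new first entry a + b exceeding b. The entry `b` itself is unchanged, so weights in `b` alone
    -- pass through.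
    slide : (v : ℕ → ℕ → ℤ) →
      total a>b? (λ ((a , x) , (b , y)) → v a b) ≡ total x<y? (λ ((a , x) , (b , y)) → v (a ℕ.+ b) b)
    slide v = total-bijection a>b? x<y? (λ ((a , x) , (b , y)) → v a b) (λ ((a , x) , (b , y)) → v (a ℕ.+ b) b) ψ
      (λ { ((a , x) , (b , y)) ((pa , px) , (pb , py)) s h →
        ((≤-trans pa (m≤m+n a b) , px) , (pb , m<n⇒0<n∸m h)) , trans (solution a b h) s ,
        +-monoˡ-≤ b pa , refl })
      (λ { ((a , x) , (b , y)) ((a′ , x′) , (b′ , y′)) h h′ e → inj a x b y a′ x′ b′ y′ h h′ e })
      (λ { ((a , x) , (b , y)) ((pa , px) , (pb , py)) s h →
        ((a ∸ b , x) , (b , y ℕ.+ x)) , ((m<n⇒0<n∸m h , px) , (pb , ≤-trans py (m≤m+n y x))) ,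
        trans (solution′ x y h) s , +-monoˡ-≤ x py ,
        cong₂ _,_ (cong (_, x) (m∸n+n≡m (<⇒≤ h))) (cong (b ,_) (m+n∸n≡m y x)) })
      where
      ψ : Quad → Quad
      ψ ((a , x) , (b , y)) = (a ℕ.+ b , x) , (b , y ∸ x)
      solution : ∀ a b {x y} → x < y → (a ℕ.+ b) ℕ.* x ℕ.+ b ℕ.* (y ∸ x) ≡ a ℕ.* x ℕ.+ b ℕ.* y
      solution a b {x} {y} h = trans (lemma a b x (y ∸ x)) (cong (λ k → a ℕ.* x ℕ.+ b ℕ.* k) (m+[n∸m]≡n (<⇒≤ h)))
        where
        lemma : ∀ a b x z → (a ℕ.+ b) ℕ.* x ℕ.+ b ℕ.* z ≡ a ℕ.* x ℕ.+ b ℕ.* (x ℕ.+ z)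
        lemma = ℕSolver.solve-∀
      solution′ : ∀ {a b} x y → b < a → (a ∸ b) ℕ.* x ℕ.+ b ℕ.* (y ℕ.+ x) ≡ a ℕ.* x ℕ.+ b ℕ.* y
      solution′ {a} {b} x y h = trans (lemma (a ∸ b) b x y) (cong (λ k → k ℕ.* x ℕ.+ b ℕ.* y) (m∸n+n≡m (<⇒≤ h)))
        where
        lemma : ∀ c b x y → c ℕ.* x ℕ.+ b ℕ.* (y ℕ.+ x) ≡ (c ℕ.+ b) ℕ.* x ℕ.+ b ℕ.* y
        lemma = ℕSolver.solve-∀
      inj : ∀ a x b y a′ x′ b′ y′ → x < y → x′ < y′ → ψ ((a , x) , (b , y)) ≡ ψ ((a′ , x′) , (b′ , y′)) →
        ((a , x) , (b , y)) ≡ ((a′ , x′) , (b′ , y′))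
      inj a x b y a′ x′ b′ y′ h h′ e with cong (λ q → proj₂ (proj₁ q)) e | cong (λ q → proj₁ (proj₂ q)) e
      ... | refl | refl = cong₂ (λ k l → (k , x) , (b , l))
        (ℕP.+-cancelʳ-≡ b a a′ (cong (λ q → proj₁ (proj₁ q)) e))
        (trans (sym (m∸n+n≡m (<⇒≤ h))) (trans (cong (ℕ._+ x) (cong (λ q → proj₂ (proj₂ q)) e)) (m∸n+n≡m (<⇒≤ h′))))

  on-trichotomy : {P : Set} (d : Dec P) (m n : ℕ) {w : ℤ} →
    on d w ≡ on (d ×-dec (n <? m)) w + on (d ×-dec (m <? n)) w + on (d ×-dec (m ≟ n)) w
  on-trichotomy (no _)  m n = refl
  on-trichotomy (yes p) m n {w} with <-cmp m n
  ... | tri< lt ¬eq ¬gt = sym (trans (cong₂ _+_ (cong₂ _+_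
    (on-no (yes p ×-dec (n <? m)) (λ h → ¬gt (proj₂ h))) (on-yes (yes p ×-dec (m <? n)) (p , lt)))
    (on-no (yes p ×-dec (m ≟ n)) (λ h → ¬eq (proj₂ h)))) (trans (ℤP.+-identityʳ _) (+-identityˡ w)))
  ... | tri≈ ¬lt eq ¬gt = sym (trans (cong₂ _+_ (cong₂ _+_
    (on-no (yes p ×-dec (n <? m)) (λ h → ¬gt (proj₂ h))) (on-no (yes p ×-dec (m <? n)) (λ h → ¬lt (proj₂ h))))
    (on-yes (yes p ×-dec (m ≟ n)) (p , eq))) (+-identityˡ w))
  ... | tri> ¬lt ¬eq gt = sym (trans (cong₂ _+_ (cong₂ _+_
    (on-yes (yes p ×-dec (n <? m)) (p , gt)) (on-no (yes p ×-dec (m <? n)) (λ h → ¬lt (proj₂ h))))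
    (on-no (yes p ×-dec (m ≟ n)) (λ h → ¬eq (proj₂ h)))) (trans (ℤP.+-identityʳ _) (ℤP.+-identityʳ w)))

  ∑-below : ∀ n m (f : ℕ → ℤ) → m ≤ n → ∑ (ps n) (λ x → on (x <? suc m) (f x)) ≡ ∑ (ps m) f
  ∑-below n m f m≤n with m≤n⇒m<n∨m≡n m≤n
  ... | inj₂ refl = ∑-cong (ps n) (λ x x∈ → on-yes (x <? suc n) (s≤s (proj₂ (∈-ps⁻ n x∈))))
  ∑-below (suc n) m f m≤n | inj₁ (s≤s m≤n′) = trans
    (cong₂ _+_ (on-no (suc n <? suc m) (λ { (s≤s h) → <-irrefl refl (≤-trans h m≤n′) })) (∑-below n m f m≤n′))
    (+-identityˡ _)

  ∑-ones : ∀ m (c : ℤ) → ∑ (ps m) (λ _ → c) ≡ + m * c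
  ∑-ones zero    c = refl
  ∑-ones (suc m) c = trans (cong (λ s → c + s) (∑-ones m c)) (lemma c (+ m))
    where
    lemma : ∀ c m → c + m * c ≡ (+ 1 + m) * c
    lemma = solve-∀

  -- The left side is 6⌊m/3⌋. Expressing it through `F` and `χ` at m + 1 makes the later sum over
  -- factorisations N = d e, with e = m + 1, a combination of divisor sums.
  ∑-F : ∀ m → + 6 * ∑ (ps m) F ≡ + 2 * + suc m - + 3 - + 3 * F (suc m) + χ (suc m)
  ∑-F zero    = refl
  ∑-F (suc m) = trans (ℤP.*-distribˡ-+ (+ 6) (F (suc m)) (∑ (ps m) F)) (trans (cong (λ s → + 6 * F (suc m) + s) (∑-F m))
    (trans (lemma (F (suc m)) (χ (suc m)) (+ suc m)) (trans (cong (λ s → + 2 * + suc m - + 3 + s) (step (suc m)))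
      (lemma′ (+ suc m) (F (suc (suc m))) (χ (suc (suc m)))))))
    where
    lemma : ∀ f c m → + 6 * f + (+ 2 * m - + 3 - + 3 * f + c) ≡ + 2 * m - + 3 + (+ 3 * f + c)
    lemma = solve-∀
    lemma′ : ∀ m f c → + 2 * m - + 3 + (+ 2 - + 3 * f + c) ≡ + 2 * (+ 1 + m) - + 3 - + 3 * f + c
    lemma′ = solve-∀
    step : ∀ k → + 3 * F k + χ k ≡ + 2 - + 3 * F (suc k) + χ (suc k)
    step 0 = refl
    step 1 = refl
    step 2 = refl
    step (suc (suc (suc k))) = step k

  -- Sums over factorisations of N

  module Convolution (N : ℕ) where

    open Liouville N

    weighted : (ℕ → ℕ → ℤ) → ℤ
    weighted f = ∑ (pairs N) (λ (d , e) → on (d ℕ.* e ≟ N) (f d e))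

    weighted-cong : ∀ {f g} → (∀ d e → 1 ≤ e → f d e ≡ g d e) → weighted f ≡ weighted g
    weighted-cong h = ∑-cong (pairs N) (λ (d , e) m → cong (on (d ℕ.* e ≟ N)) (h d e (proj₁ (proj₂ (∈-pairs⁻ N m)))))

    weighted-+ : ∀ f g → weighted (λ d e → f d e + g d e) ≡ weighted f + weighted g
    weighted-+ f g = trans (∑-cong′ (pairs N) (λ (d , e) → on-+ (d ℕ.* e ≟ N) (f d e) (g d e))) (∑-+ (pairs N) _ _)

    weighted-* : ∀ c f → weighted (λ d e → c * f d e) ≡ c * weighted f
    weighted-* c f = trans (∑-cong′ (pairs N) (λ (d , e) → on-*ˡ (d ℕ.* e ≟ N) c (f d e))) (∑-*ˡ (pairs N) c (λ (d , e) → on (d ℕ.* e ≟ N) (f d e)))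

    weighted-swap : ∀ f → weighted f ≡ weighted (λ d e → f e d)
    weighted-swap f = ∑-bijection _≟ℕ²_ _≟ℕ²_ (pairs-unique N) (pairs-unique N)
      (λ (d , e) → d ℕ.* e ≟ N) (λ (d , e) → d ℕ.* e ≟ N) (λ (d , e) → f d e) (λ (d , e) → f e d) (λ (d , e) → e , d)
      (λ (d , e) m h → flip m , trans (ℕP.*-comm e d) h , refl)
      (λ { (d , e) (d′ , e′) _ _ refl → refl })
      (λ (d , e) m h → (e , d) , flip m , trans (ℕP.*-comm e d) h , refl)
      where
      flip : ∀ {d e} → (d , e) ∈ pairs N → (e , d) ∈ pairs N
      flip m = let (p , q) , (p′ , q′) = ∈-pairs⁻ N m in ∈-cartesianProduct⁺ (∈-ps⁺ N p′ q′) (∈-ps⁺ N p q)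

    -- Solutions with a = b = d are factorisations N = d (x + y): put e = x + y and choose x between
    -- 1 and e - 1.
    diagonal : (w : Quad → ℤ) →
      total a=b? w ≡ weighted (λ d e → ∑ (ps N) (λ x → on (x <? e) (w ((d , x) , (d , e ∸ x)))))
    diagonal w = trans bijection (trans (∑-× (pairs N) (ps N) _) (∑-cong′ (pairs N) (λ (d , e) → inner d e)))
      where
      P? : Decidable (λ ((d , e) , x) → d ℕ.* e ≡ N × x < e)
      P? ((d , e) , x) = (d ℕ.* e ≟ N) ×-dec (x <? e)
      ψ : (ℕ × ℕ) × ℕ → Quad
      ψ ((d , e) , x) = (d , x) , (d , e ∸ x)
      inner : ∀ d e → ∑ (ps N) (λ x → on (P? ((d , e) , x)) (w (ψ ((d , e) , x)))) ≡
        on (d ℕ.* e ≟ N) (∑ (ps N) (λ x → on (x <? e) (w ((d , x) , (d , e ∸ x)))))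
      inner d e = trans (∑-cong′ (ps N) (λ x → sym (on-× (d ℕ.* e ≟ N) (x <? e) _))) (pull (d ℕ.* e ≟ N))
        where
        pull : ∀ {P : Set} (c : Dec P) {f : ℕ → ℤ} → ∑ (ps N) (λ x → on c (f x)) ≡ on c (∑ (ps N) f)
        pull (yes _) = refl
        pull (no _)  = ∑-0 (ps N) (λ _ _ → refl)
      bijection : total a=b? w ≡ ∑ (cartesianProduct (pairs N) (ps N)) (λ p → on (P? p) (w (ψ p)))
      bijection = ∑-bijection (≡-dec _≟ℕ²_ _≟ℕ²_) (≡-dec _≟ℕ²_ _≟_) quads′-unique
        (cartesianProduct⁺ (pairs-unique N) (ps-unique N)) (sol? ∩? a=b?) P? w (λ p → w (ψ p)) ψ
        (λ ((d , e) , x) m (h , x<e) →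
          let m₁ , m₂ = ∈-cartesianProduct⁻ (pairs N) (ps N) m
              (pd , _) , _ = ∈-pairs⁻ N m₁
              s = trans (sym (ℕP.*-distribˡ-+ d x (e ∸ x))) (trans (cong (d ℕ.*_) (m+[n∸m]≡n (<⇒≤ x<e))) h)
          in positive⇒∈ _ ((pd , proj₁ (∈-ps⁻ N m₂)) , (pd , m<n⇒0<n∸m x<e)) s , (s , refl) , refl)
        (λ ((d , e) , x) ((d′ , e′) , x′) (_ , h) (_ , h′) eq → inj d e x d′ e′ x′ h h′ eq)
        (λ { ((d , x) , (.d , y)) m (s , refl) →
          let (pd , px) , (_ , py) = ∈⇒positive _ m
              s′ = trans (ℕP.*-distribˡ-+ d x y) s
              x+y≤N = ≤-trans (≤-product pd) (≤-reflexive (trans (ℕP.*-comm (x ℕ.+ y) d) s′))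
          in ((d , x ℕ.+ y) , x) ,
             ∈-cartesianProduct⁺ (∈-pairs⁺ N pd (≤-trans px (m≤m+n x y)) (≤-reflexive s′))
               (∈-ps⁺ N px (≤-trans (m≤m+n x y) x+y≤N)) ,
             (s′ , subst (_≤ x ℕ.+ y) (ℕP.+-comm x 1) (+-monoʳ-≤ x py)) ,
             cong (λ k → (d , x) , (d , k)) (m+n∸m≡n x y) })
        where
        inj : ∀ d e x d′ e′ x′ → x < e → x′ < e′ → ψ ((d , e) , x) ≡ ψ ((d′ , e′) , x′) → ((d , e) , x) ≡ ((d′ , e′) , x′)
        inj d e x d′ e′ x′ h h′ eq with cong proj₁ eq
        ... | refl = cong (λ k → (d , k) , x) (trans (sym (m∸n+n≡m (<⇒≤ h)))
          (trans (cong (ℕ._+ x) (cong (λ q → proj₂ (proj₂ q)) eq)) (m∸n+n≡m (<⇒≤ h′))))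

    transpose : (w : Quad → ℤ) → total x=y? w ≡ total a=b? (λ ((a , x) , (b , y)) → w ((x , a) , (y , b)))
    transpose w = total-bijection x=y? a=b? w (λ q → w (τ q)) τ
      (λ ((a , x) , (b , y)) ((pa , px) , (pb , py)) s h → ((px , pa) , (py , pb)) , trans (solution a x b y) s , h , refl)
      (λ { ((a , x) , (b , y)) ((a′ , x′) , (b′ , y′)) _ _ refl → refl })
      (λ ((a , x) , (b , y)) ((pa , px) , (pb , py)) s h → _ , ((px , pa) , (py , pb)) , trans (solution a x b y) s , h , refl)
      where
      τ : Quad → Quad
      τ ((a , x) , (b , y)) = (x , a) , (y , b)
      solution : ∀ a x b y → x ℕ.* a ℕ.+ y ℕ.* b ≡ a ℕ.* x ℕ.+ b ℕ.* y
      solution = ℕSolver.solve-∀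

    all : (Quad → ℤ) → ℤ
    all w = ∑ quads′ (λ q → on (sol? q) (w q))

    by-a : ∀ w → all w ≡ total a>b? w + total a<b? w + total a=b? w
    by-a w = trans (∑-cong′ quads′ (λ q@((a , x) , (b , y)) → on-trichotomy (sol? q) a b)) (trans (∑-+ quads′ _ _)
      (cong (λ y → y + total a=b? w) (∑-+ quads′ _ _)))

    by-x : ∀ w → all w ≡ total x>y? w + total x<y? w + total x=y? w
    by-x w = trans (∑-cong′ quads′ (λ q@((a , x) , (b , y)) → on-trichotomy (sol? q) x y)) (trans (∑-+ quads′ _ _)
      (cong (λ y → y + total x=y? w) (∑-+ quads′ _ _)))

    total-cong : ∀ {P : Quad → Set} (P? : Decidable P) {v w : Quad → ℤ} → (∀ q → P q → v q ≡ w q) → total P? v ≡ total P? w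
    total-cong P? h = ∑-cong′ quads′ (λ q → on-cong (sol? q ×-dec P? q) (sol? q ×-dec P? q) id id (λ (_ , p) → h q p))

  3∣⇒F : ∀ k → F (3 ℕ.* k) ≡ + 1
  3∣⇒F zero    = refl
  3∣⇒F (suc k) = trans (cong F (*-suc 3 k)) (3∣⇒F k)

  3∤⇒F : ∀ n → ¬ (3 ℕD.∣ n) → F n ≡ + 0
  3∤⇒F 0 h = ⊥-elim (h (ℕD.divides 0 refl))
  3∤⇒F 1 h = refl
  3∤⇒F 2 h = refl
  3∤⇒F (suc (suc (suc n))) h = 3∤⇒F n (λ { (ℕD.divides q e) → h (ℕD.divides (suc q) (cong (λ m → suc (suc (suc m))) e)) })

  F-indicator : ∀ n v → F n * v ≡ on (3 ℕD.∣? n) v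
  F-indicator n v with 3 ℕD.∣? n
  ... | yes (ℕD.divides q refl) = trans (cong (λ y → y * v) (trans (cong F (ℕP.*-comm q 3)) (3∣⇒F q))) (ℤP.*-identityˡ v)
  ... | no ¬d                   = cong (λ y → y * v) (3∤⇒F n ¬d)

  -- Evaluation of the convolution of A with itself

  module _ (N : ℕ) where

    open Liouville N
    open Convolution N

    -- Both sides are sums over triples (3k) l = N, respectively k (3l) = N.
    move-three : + 3 * weighted (λ d e → F d * + e) ≡ weighted (λ d e → F e * + e)
    move-three = begin
      + 3 * weighted (λ d e → F d * + e)
        ≡⟨ sym (weighted-* (+ 3) (λ d e → F d * + e)) ⟩
      weighted (λ d e → + 3 * (F d * + e))
        ≡⟨ weighted-cong (λ d e _ → trans (lemma (F d) (+ e)) (F-indicator d (+ 3 * + e))) ⟩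
      weighted (λ d e → on (3 ℕD.∣? d) (+ 3 * + e))
        ≡⟨ ∑-cong′ (pairs N) (λ (d , e) → on-× (d ℕ.* e ≟ N) (3 ℕD.∣? d) _) ⟩
      ∑ (pairs N) (λ (d , e) → on ((d ℕ.* e ≟ N) ×-dec (3 ℕD.∣? d)) (+ 3 * + e))
        ≡⟨ left ⟩
      ∑ (pairs N) (λ (k , l) → on (3 ℕ.* (k ℕ.* l) ≟ N) (+ 3 * + l))
        ≡⟨ sym right ⟩
      ∑ (pairs N) (λ (d , e) → on ((d ℕ.* e ≟ N) ×-dec (3 ℕD.∣? e)) (+ e))
        ≡⟨ sym (∑-cong′ (pairs N) (λ (d , e) → on-× (d ℕ.* e ≟ N) (3 ℕD.∣? e) _)) ⟩
      weighted (λ d e → on (3 ℕD.∣? e) (+ e))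
        ≡⟨ weighted-cong (λ d e _ → sym (F-indicator e (+ e))) ⟩
      weighted (λ d e → F e * + e) ∎
      where
      open ≡-Reasoning
      lemma : ∀ f e → + 3 * (f * e) ≡ f * (+ 3 * e)
      lemma = solve-∀
      positive : ∀ {k l} → (k , l) ∈ pairs N → 1 ≤ k × 1 ≤ l
      positive m = let (p , _) , (q , _) = ∈-pairs⁻ N m in p , q
      3*k>0⇒k>0 : ∀ k → 1 ≤ k ℕ.* 3 → 1 ≤ k
      3*k>0⇒k>0 (suc k) _ = s≤s z≤n
      small : ∀ k l → 3 ℕ.* (k ℕ.* l) ≡ N → k ℕ.* l ≤ N
      small k l h = ≤-trans (m≤n*m (k ℕ.* l) 3) (≤-reflexive h)
      eqˡ : ∀ k l → k ℕ.* 3 ℕ.* l ≡ 3 ℕ.* (k ℕ.* l)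
      eqˡ = ℕSolver.solve-∀
      eqʳ : ∀ k l → k ℕ.* (l ℕ.* 3) ≡ 3 ℕ.* (k ℕ.* l)
      eqʳ = ℕSolver.solve-∀
      triple : ∀ {k} → 1 ≤ k → 1 ≤ k ℕ.* 3
      triple h = ≤-trans h (≤-product (s≤s z≤n))
      left : ∑ (pairs N) (λ (d , e) → on ((d ℕ.* e ≟ N) ×-dec (3 ℕD.∣? d)) (+ 3 * + e)) ≡
        ∑ (pairs N) (λ (k , l) → on (3 ℕ.* (k ℕ.* l) ≟ N) (+ 3 * + l))
      left = ∑-bijection _≟ℕ²_ _≟ℕ²_ (pairs-unique N) (pairs-unique N)
        (λ (d , e) → (d ℕ.* e ≟ N) ×-dec (3 ℕD.∣? d)) (λ (k , l) → 3 ℕ.* (k ℕ.* l) ≟ N)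
        (λ (d , e) → + 3 * + e) (λ (k , l) → + 3 * + l) (λ (k , l) → k ℕ.* 3 , l)
        (λ (k , l) m h → let pk , pl = positive m
                             s = trans (eqˡ k l) h in
          ∈-pairs⁺ N (triple pk) pl (≤-reflexive s) , (s , ℕD.divides k refl) , refl)
        (λ (k , l) (k′ , l′) _ _ e → cong₂ _,_ (ℕP.*-cancelʳ-≡ k k′ 3 (cong proj₁ e)) (cong proj₂ e))
        (λ { (d , e) m (h , ℕD.divides k refl) → let pd , pe = positive m
                                                     s = trans (sym (eqˡ k e)) h in
          (k , e) , ∈-pairs⁺ N (3*k>0⇒k>0 k pd) pe (small k e s) , s , refl })
      right : ∑ (pairs N) (λ (d , e) → on ((d ℕ.* e ≟ N) ×-dec (3 ℕD.∣? e)) (+ e)) ≡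
        ∑ (pairs N) (λ (k , l) → on (3 ℕ.* (k ℕ.* l) ≟ N) (+ 3 * + l))
      right = ∑-bijection _≟ℕ²_ _≟ℕ²_ (pairs-unique N) (pairs-unique N)
        (λ (d , e) → (d ℕ.* e ≟ N) ×-dec (3 ℕD.∣? e)) (λ (k , l) → 3 ℕ.* (k ℕ.* l) ≟ N)
        (λ (d , e) → + e) (λ (k , l) → + 3 * + l) (λ (k , l) → k , l ℕ.* 3)
        (λ (k , l) m h → let pk , pl = positive m
                             s = trans (eqʳ k l) h in
          ∈-pairs⁺ N pk (triple pl) (≤-reflexive s) , (s , ℕD.divides l refl) , trans (pos-* l 3) (ℤP.*-comm (+ l) (+ 3)))
        (λ (k , l) (k′ , l′) _ _ e → cong₂ _,_ (cong proj₁ e) (ℕP.*-cancelʳ-≡ l l′ 3 (cong proj₂ e)))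
        (λ { (d , e) m (h , ℕD.divides l refl) → let pd , pe = positive m
                                                     s = trans (sym (eqʳ d l)) h in
          (d , l) , ∈-pairs⁺ N pd (3*k>0⇒k>0 l pe) (small d l s) , s , refl })

    private
      e≤N : ∀ {d e} → (d , e) ∈ pairs N → e ≤ N
      e≤N m = proj₂ (proj₂ (∈-pairs⁻ N m))

      pred-< : ∀ {e} → 1 ≤ e → ∃ λ m → e ≡ suc m
      pred-< {suc e} _ = e , refl

      below : ∀ {d e} (f : ℕ → ℤ) (c v : ℤ) → (d , e) ∈ pairs N → (∀ m → e ≡ suc m → c * ∑ (ps m) f ≡ v) →
        c * ∑ (ps N) (λ x → on (x <? e) (f x)) ≡ v
      below {d} f c v mem h with pred-< (proj₁ (proj₂ (∈-pairs⁻ N mem)))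
      ... | m , refl = trans (cong (λ s → c * s) (∑-below N m f (<⇒≤ (e≤N mem)))) (h m refl)

      constant : ∀ {d e} (c : ℤ) → (d , e) ∈ pairs N → ∑ (ps N) (λ x → on (x <? e) c) ≡ (+ e - + 1) * c
      constant {d} {e} c mem = trans (sym (ℤP.*-identityˡ _)) (below {d} {e} (λ _ → c) (+ 1) _ mem
        (λ { m refl → trans (ℤP.*-identityˡ _) (trans (∑-ones m c) (lemma (+ m) c)) }))
        where
        lemma : ∀ m c → m * c ≡ (+ 1 + m - + 1) * c
        lemma = solve-∀

      weighted-cong∈ : ∀ {f g} → (∀ d e → (d , e) ∈ pairs N → f d e ≡ g d e) → weighted f ≡ weighted g
      weighted-cong∈ h = ∑-cong (pairs N) (λ (d , e) m → cong (on (d ℕ.* e ≟ N)) (h d e m))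

      sE s1 sF sχ sFe sFde : ℤ
      sE   = weighted (λ d e → + e)
      s1   = weighted (λ d e → + 1)
      sF   = weighted (λ d e → F e)
      sχ   = weighted (λ d e → χ e)
      sFe  = weighted (λ d e → F e * + e)
      sFde = weighted (λ d e → F d * + e)

      -- `u` and `Z` are sums over the diagonal a = b, `r` and `D` over the diagonal x = y; all four
      -- reduce to divisor sums. `L` and `M` are off-diagonal halves without such an evaluation, but
      -- the convolution involves only L - M.
      u r Z D L M : ℤ
      u = total a=b? (λ ((a , x) , (b , y)) → F a)
      r = total x=y? (λ ((a , x) , (b , y)) → F a)
      Z = total a=b? (λ ((a , x) , (b , y)) → F ℕ.∣ a - b ∣)
      D = total x=y? (λ ((a , x) , (b , y)) → F (a ℕ.+ b))
      L = total x<y? (λ ((a , x) , (b , y)) → F a)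
      M = total a>b? (λ ((a , x) , (b , y)) → F a)

      weighted-− : ∀ f g → weighted (λ d e → f d e - g d e) ≡ weighted f - weighted g
      weighted-− f g = trans (weighted-+ f (λ d e → - g d e)) (cong (λ y → weighted f + y)
        (trans (weighted-cong (λ d e _ → sym (-1*i≡-i (g d e)))) (trans (weighted-* (- + 1) g) (-1*i≡-i (weighted g)))))

      u≡ : u ≡ sFde - sF
      u≡ = trans (diagonal (λ ((a , x) , (b , y)) → F a)) (trans
        (weighted-cong∈ (λ d e m → trans (constant (F d) m) (lemma (+ e) (F d))))
        (trans (weighted-− (λ d e → F d * + e) (λ d e → F d)) (cong (λ y → sFde - y) (weighted-swap (λ d e → F d)))))
        where
        lemma : ∀ e f → (e - + 1) * f ≡ f * e - f
        lemma = solve-∀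

      -- After transposition the weight F a becomes F x, summed over 1 ≤ x < e, which is where the
      -- closed form `∑-F` enters.
      r≡ : + 6 * r ≡ + 2 * sE - + 3 * s1 - + 3 * sF + sχ
      r≡ = trans (cong (λ y → + 6 * y) (trans (transpose (λ ((a , x) , (b , y)) → F a)) (diagonal (λ ((a , x) , (b , y)) → F x))))
        (trans (sym (weighted-* (+ 6) (λ d e → ∑ (ps N) (λ x → on (x <? e) (F x)))))
        (trans (weighted-cong∈ {g = λ d e → + 2 * + e - + 3 * + 1 - + 3 * F e + χ e}
          (λ d e mem → below {d} {e} F (+ 6) _ mem (λ { m refl → ∑-F m })))
        (trans (weighted-+ (λ d e → + 2 * + e - + 3 * + 1 - + 3 * F e) (λ d e → χ e)) (cong (λ y → y + sχ)
        (trans (weighted-− (λ d e → + 2 * + e - + 3 * + 1) (λ d e → + 3 * F e)) (cong₂ _-_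
          (trans (weighted-− (λ d e → + 2 * + e) (λ d e → + 3 * + 1))
            (cong₂ _-_ (weighted-* (+ 2) (λ d e → + e)) (weighted-* (+ 3) (λ d e → + 1))))
          (weighted-* (+ 3) (λ d e → F e))))))))

      Z≡ : Z ≡ sE - s1
      Z≡ = trans (total-cong a=b? {w = λ _ → + 1} (λ { ((a , x) , (.a , y)) refl → cong F (ℕP.∣n-n∣≡0 a) }))
        (trans (diagonal (λ _ → + 1)) (trans (weighted-cong∈ (λ d e m → trans (constant (+ 1) m) (ℤP.*-identityʳ _)))
        (weighted-− (λ d e → + e) (λ d e → + 1))))

      -- On the transposed diagonal the two summands add up to e, so the weight F e is constant in
      -- x.
      D≡ : D ≡ sFe - sF
      D≡ = trans (transpose (λ ((a , x) , (b , y)) → F (a ℕ.+ b))) (trans (diagonal (λ ((a , x) , (b , y)) → F (x ℕ.+ y)))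
        (trans (weighted-cong∈ (λ d e m → trans
          (∑-cong′ (ps N) (λ x → on-cong (x <? e) (x <? e) id id (λ x<e → cong F (m+[n∸m]≡n (<⇒≤ x<e)))))
          (trans (constant (F e) m) (lemma (+ e) (F e)))))
        (weighted-− (λ d e → F e * + e) (λ d e → F e))))
        where
        lemma : ∀ e f → (e - + 1) * f ≡ f * e - f
        lemma = solve-∀

      gap sumF : Quad → ℤ
      gap  ((a , x) , (b , y)) = F ℕ.∣ a - b ∣
      sumF ((a , x) , (b , y)) = F (a ℕ.+ b)

      ∣m+n-n∣≡m : ∀ m n → ℕ.∣ m ℕ.+ n - n ∣ ≡ m
      ∣m+n-n∣≡m m n = trans (ℕP.∣-∣-comm (m ℕ.+ n) n) (trans (ℕP.m≤n⇒∣m-n∣≡n∸m (m≤n+m n m)) (m+n∸n≡m m n))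

      -- The weight is symmetric, so the halves a > b and a < b agree; sliding turns the difference
      -- into (a + b) - b = a.
      all-gap : all gap ≡ L + L + Z
      all-gap = trans (by-a gap) (cong (λ y → y + Z) (cong₂ _+_ bigger
        (trans (swap a<b? a>b? gap gap (λ _ _ h → h) (λ _ _ h → h) (λ (a , _) (b , _) → cong F (ℕP.∣-∣-comm b a))) bigger)))
        where
        bigger : total a>b? gap ≡ L
        bigger = trans (slide (λ a b → F ℕ.∣ a - b ∣)) (total-cong x<y? (λ ((a , x) , (b , y)) _ → cong F (∣m+n-n∣≡m a b)))

      -- The same with the cut between x and y and `slide` read backwards: on x < y the sum a + b is
      -- the first entry of the slid solution.
      all-sum : all sumF ≡ M + M + D
      all-sum = trans (by-x sumF) (cong (λ y → y + D) (cong₂ _+_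
        (trans (swap x>y? x<y? sumF sumF (λ _ _ h → h) (λ _ _ h → h) (λ (a , _) (b , _) → cong F (ℕP.+-comm b a))) smaller) smaller))
        where
        smaller : total x<y? sumF ≡ M
        smaller = sym (slide (λ a b → F a))

      -- The sum of F a over all solutions, cut once by comparing x with y and once by comparing a
      -- with b. The pieces x > y and a < b both equal `K`: exchange the two pairs and use that
      -- `slide` preserves b. What remains determines L - M as u - r.
      balance : L + r ≡ M + u
      balance = ℤ-cancel K (L + r) (M + u) (trans (lemma K L r) (trans (trans (sym (trans (by-x Fa) (cong (λ y → y + L + r) K≡))) (by-a Fa)) (trans (cong (λ y → M + y + u) K′≡) (lemma′ K M u))))
        where
        Fa : Quad → ℤ
        Fa ((a , x) , (b , y)) = F a
        K : ℤ
        K = total a>b? (λ ((a , x) , (b , y)) → F b)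
        K≡ : total x>y? Fa ≡ K
        K≡ = trans (swap x>y? x<y? Fa (λ ((a , x) , (b , y)) → F b) (λ _ _ h → h) (λ _ _ h → h) (λ _ _ → refl)) (sym (slide (λ a b → F b)))
        K′≡ : total a<b? Fa ≡ K
        K′≡ = swap a<b? a>b? Fa (λ ((a , x) , (b , y)) → F b) (λ _ _ h → h) (λ _ _ h → h) (λ _ _ → refl)
        ℤ-cancel : ∀ k x y → x + k ≡ y + k → x ≡ y
        ℤ-cancel = +-cancelʳ-≡
        lemma : ∀ K L r → L + r + K ≡ K + L + r
        lemma = solve-∀
        lemma′ : ∀ K M u → M + K + u ≡ M + u + K
        lemma′ = solve-∀

      χχ : ∀ m n → χ m * χ n ≡ F ℕ.∣ m - n ∣ - F (m ℕ.+ n)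
      χχ m n with ℕP.≤-total n m
      ... | inj₁ n≤m = trans (subst (λ k → χ k * χ n ≡ F (m ∸ n) - F (k ℕ.+ n)) (m+[n∸m]≡n n≤m) (χ-product n (m ∸ n)))
        (cong (λ k → F k - F (m ℕ.+ n)) (sym (trans (ℕP.∣-∣-comm m n) (ℕP.m≤n⇒∣m-n∣≡n∸m n≤m))))
      ... | inj₂ m≤n = trans (ℤP.*-comm (χ m) (χ n)) (trans (subst (λ k → χ k * χ m ≡ F (n ∸ m) - F (k ℕ.+ m)) (m+[n∸m]≡n m≤n) (χ-product m (n ∸ m)))
        (cong₂ (λ k l → F k - F l) (sym (ℕP.m≤n⇒∣m-n∣≡n∸m m≤n)) (ℕP.+-comm n m)))

      A⊗A : (A N ⊗ A N) N ≡ all gap - all sumF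
      A⊗A = trans (gen-⊗ (pairs N) (pairs N) (λ (d , e) → d ℕ.* e) (λ (d , e) → d ℕ.* e) (λ (d , e) → χ d) (λ (d , e) → χ d) N)
        (trans (∑-cong′ quads′ (λ q@((a , x) , (b , y)) → trans (cong (on (sol? q)) (trans (χχ a b) (cong (λ s → gap q + s) (sym (-1*i≡-i (sumF q))))))
          (trans (on-+ (sol? q) (gap q) (- + 1 * sumF q)) (cong (λ s → on (sol? q) (gap q) + s) (on-*ˡ (sol? q) (- + 1) (sumF q))))))
        (trans (∑-+ quads′ (λ q → on (sol? q) (gap q)) (λ q → - + 1 * on (sol? q) (sumF q)))
        (cong (λ s → all gap + s) (trans (∑-*ˡ quads′ (- + 1) (λ q → on (sol? q) (sumF q))) (-1*i≡-i (all sumF))))))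

    -- The convolution is 2(L - M) + Z - D = 2(u - r) + Z - D; the multiplier 3 clears the 6 in the
    -- evaluation of r. The sums `s1` and `sF` cancel, and `move-three` trades F d · e for F e · e.
    convolution : + 3 * (A N ⊗ A N) N ≡ weighted (λ d e → + e - F e * + e) - A N N
    convolution = begin
      + 3 * (A N ⊗ A N) N                                        ≡⟨ cong (λ y → + 3 * y) (trans A⊗A (cong₂ _-_ all-gap all-sum)) ⟩
      + 3 * (L + L + Z - (M + M + D))                            ≡⟨ l₁ L M u r Z D ⟩
      + 6 * (L + r) - + 6 * r + + 3 * Z - + 6 * M - + 3 * D      ≡⟨ cong (λ y → + 6 * y - + 6 * r + + 3 * Z - + 6 * M - + 3 * D) balance ⟩
      + 6 * (M + u) - + 6 * r + + 3 * Z - + 6 * M - + 3 * D      ≡⟨ l₂ M u (+ 6 * r) Z D ⟩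
      + 6 * u - + 6 * r + + 3 * Z - + 3 * D
        ≡⟨ cong₂ (λ x y → + 6 * x - y + + 3 * Z - + 3 * D) u≡ r≡ ⟩
      + 6 * (sFde - sF) - (+ 2 * sE - + 3 * s1 - + 3 * sF + sχ) + + 3 * Z - + 3 * D
        ≡⟨ cong₂ (λ x y → + 6 * (sFde - sF) - (+ 2 * sE - + 3 * s1 - + 3 * sF + sχ) + + 3 * x - + 3 * y) Z≡ D≡ ⟩
      + 6 * (sFde - sF) - (+ 2 * sE - + 3 * s1 - + 3 * sF + sχ) + + 3 * (sE - s1) - + 3 * (sFe - sF)
        ≡⟨ l₃ sFde sF sE s1 sχ sFe ⟩
      + 2 * (+ 3 * sFde) + sE - + 3 * sFe - sχ                   ≡⟨ cong (λ y → + 2 * y + sE - + 3 * sFe - sχ) move-three ⟩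
      + 2 * sFe + sE - + 3 * sFe - sχ                            ≡⟨ l₄ sFe sE sχ ⟩
      (sE - sFe) - sχ                                            ≡⟨ cong₂ _-_ (sym (weighted-− (λ d e → + e) (λ d e → F e * + e))) (weighted-swap (λ d e → χ e)) ⟩
      weighted (λ d e → + e - F e * + e) - A N N                 ∎
      where
      open ≡-Reasoning
      l₁ : ∀ L M u r Z D → + 3 * (L + L + Z - (M + M + D)) ≡ + 6 * (L + r) - + 6 * r + + 3 * Z - + 6 * M - + 3 * D
      l₁ = solve-∀
      l₂ : ∀ M u r Z D → + 6 * (M + u) - r + + 3 * Z - + 6 * M - + 3 * D ≡ + 6 * u - r + + 3 * Z - + 3 * D
      l₂ = solve-∀
      l₃ : ∀ sFde sF sE s1 sχ sFe → + 6 * (sFde - sF) - (+ 2 * sE - + 3 * s1 - + 3 * sF + sχ) + + 3 * (sE - s1) - + 3 * (sFe - sF) ≡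
        + 2 * (+ 3 * sFde) + sE - + 3 * sFe - sχ
      l₃ = solve-∀
      l₄ : ∀ sFe sE sχ → + 2 * sFe + sE - + 3 * sFe - sχ ≡ (sE - sFe) - sχ
      l₄ = solve-∀

  -- From divisor sums to σ(n₁)

  ∑-filter-sum : {P : ℕ → Set} (P? : Decidable P) (xs : List ℕ) → + sum (filter P? xs) ≡ ∑ xs (λ x → on (P? x) (+ x))
  ∑-filter-sum P? [] = refl
  ∑-filter-sum P? (x ∷ xs) with P? x
  ... | yes _ = cong (λ y → + x + y) (∑-filter-sum P? xs)
  ... | no _  = trans (∑-filter-sum P? xs) (sym (+-identityˡ _))

  prime-3 : Prime 3
  prime-3 = from-yes (prime? 3)

  ∣-3^-cancel : ∀ β {e m} → ¬ (3 ℕD.∣ e) → e ℕD.∣ 3 ℕ.^ β ℕ.* m → e ℕD.∣ m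
  ∣-3^-cancel zero    {e} {m} h d = subst (λ k → e ℕD.∣ k) (ℕP.*-identityˡ m) d
  ∣-3^-cancel (suc β) {e} {m} h (ℕD.divides q eq)
    with euclidsLemma q e prime-3 (ℕD.divides (3 ℕ.^ β ℕ.* m) (trans (sym eq) (trans (ℕP.*-assoc 3 (3 ℕ.^ β) m) (ℕP.*-comm 3 (3 ℕ.^ β ℕ.* m)))))
  ... | inj₂ 3∣e = ⊥-elim (h 3∣e)
  ... | inj₁ (ℕD.divides k refl) = ∣-3^-cancel β h (ℕD.divides k (ℕP.*-cancelˡ-≡ _ _ 3
    (trans (sym (ℕP.*-assoc 3 (3 ℕ.^ β) m)) (trans eq (trans (cong (ℕ._* e) (ℕP.*-comm k 3)) (ℕP.*-assoc 3 k e))))))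

  -- The weight retains the divisors e of N that are prime to 3. These are exactly the divisors of
  -- n₁, because 3^β is absorbed by the cofactor d.
  σ-weighted : ∀ N β n₁ → 1 ≤ N → N ≡ 3 ℕ.^ β ℕ.* n₁ → ¬ (3 ℕD.∣ n₁) →
    Convolution.weighted N (λ d e → + e - F e * + e) ≡ + σ n₁
  σ-weighted N β n₁ 1≤N N≡ 3∤n₁ = begin
    weighted (λ d e → + e - F e * + e)
      ≡⟨ weighted-cong (λ d e _ → trans (cong (λ y → + e - y) (F-indicator e (+ e))) (complement (3 ℕD.∣? e) (+ e))) ⟩
    weighted (λ d e → on (¬? (3 ℕD.∣? e)) (+ e))
      ≡⟨ ∑-cong′ (pairs N) (λ (d , e) → on-× (d ℕ.* e ≟ N) (¬? (3 ℕD.∣? e)) (+ e)) ⟩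
    ∑ (pairs N) (λ (d , e) → on ((d ℕ.* e ≟ N) ×-dec ¬? (3 ℕD.∣? e)) (+ e))
      ≡⟨ sym (∑-bijection _≟_ _≟ℕ²_ candidates-unique (pairs-unique N) (λ e → e ℕD.∣? n₁)
           (λ (d , e) → (d ℕ.* e ≟ N) ×-dec ¬? (3 ℕD.∣? e)) (λ e → + e) (λ (d , e) → + e) proj₂ into inj onto) ⟩
    ∑ candidates (λ e → on (e ℕD.∣? n₁) (+ e))
      ≡⟨ sym (∑-filter-sum (λ d → d ℕD.∣? n₁) candidates) ⟩
    + σ n₁ ∎
    where
    open ≡-Reasoning
    open Convolution N
    candidates : List ℕ
    candidates = map suc (upTo n₁)
    candidates-unique : Unique candidates
    candidates-unique = UniqueP.map⁺ suc-injective (UniqueP.upTo⁺ n₁)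
    complement : ∀ {P : Set} (d : Dec P) v → v - on d v ≡ on (¬? d) v
    complement (yes _) v = +-inverseʳ v
    complement (no _)  v = ℤP.+-identityʳ v
    1≤n₁ : 1 ≤ n₁
    1≤n₁ = n≢0⇒n>0 (λ { refl → <-irrefl refl (subst (1 ≤_) (trans N≡ (ℕP.*-zeroʳ (3 ℕ.^ β))) 1≤N) })
    instance
      n₁-nonZero : ℕ.NonZero n₁
      n₁-nonZero = ℕ.>-nonZero 1≤n₁
    candidate : ∀ {e} → 1 ≤ e → e ℕD.∣ n₁ → e ∈ candidates
    candidate {suc e} _ d = ∈-map⁺ suc (∈-upTo⁺ (ℕD.∣⇒≤ d))
    into : ∀ y → y ∈ pairs N → (proj₁ y ℕ.* proj₂ y ≡ N) × ¬ (3 ℕD.∣ proj₂ y) → proj₂ y ∈ candidates × proj₂ y ℕD.∣ n₁ × + proj₂ y ≡ + proj₂ y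
    into (d , e) m (h , 3∤e) = let _ , (pe , _) = ∈-pairs⁻ N m
                                   e∣n₁ = ∣-3^-cancel β 3∤e (ℕD.divides d (trans (sym N≡) (sym h))) in
      candidate pe e∣n₁ , e∣n₁ , refl
    inj : ∀ y y′ → (proj₁ y ℕ.* proj₂ y ≡ N) × ¬ (3 ℕD.∣ proj₂ y) → (proj₁ y′ ℕ.* proj₂ y′ ≡ N) × ¬ (3 ℕD.∣ proj₂ y′) → proj₂ y ≡ proj₂ y′ → y ≡ y′
    inj (d , zero)  (d′ , .zero)  (_ , h) _ refl = ⊥-elim (h (ℕD.divides 0 refl))
    inj (d , suc e) (d′ , .(suc e)) (h , _) (h′ , _) refl = cong (_, suc e) (ℕP.*-cancelʳ-≡ d d′ (suc e) (trans h (sym h′)))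
    onto : ∀ e → e ∈ candidates → e ℕD.∣ n₁ → ∃ λ y → y ∈ pairs N × ((proj₁ y ℕ.* proj₂ y ≡ N) × ¬ (3 ℕD.∣ proj₂ y)) × proj₂ y ≡ e
    onto e m (ℕD.divides q eq) = (3 ℕ.^ β ℕ.* q , e) , ∈-pairs⁺ N (factorˡ {3 ℕ.^ β ℕ.* q} {e} eq′) (factorʳ {3 ℕ.^ β ℕ.* q} {e} eq′) (≤-reflexive eq′) ,
      (eq′ , (λ d → 3∤n₁ (ℕD.∣-trans d (ℕD.divides q eq)))) , refl
      where
      eq′ : 3 ℕ.^ β ℕ.* q ℕ.* e ≡ N
      eq′ = trans (ℕP.*-assoc (3 ℕ.^ β) q e) (trans (cong (3 ℕ.^ β ℕ.*_) (sym eq)) (sym N≡))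
      factorˡ : ∀ {m k} → m ℕ.* k ≡ N → 1 ≤ m
      factorˡ {zero}  h = subst (1 ≤_) (sym h) 1≤N
      factorˡ {suc m} h = s≤s z≤n
      factorʳ : ∀ {m k} → m ℕ.* k ≡ N → 1 ≤ k
      factorʳ {m} {k} h = factorˡ {k} {m} (trans (ℕP.*-comm k m) h)

  -- Representations by x² + xy + y²

  norm : ℤ → ℤ → ℤ
  norm x y = x * x + x * y + y * y

  -- A unimodular substitution carrying norm to the form a u² + (2h+1) u v + c v².
  record Equivalence (a h c : ℤ) : Set where
    field
      x y z w  : ℤ
      norm-xy  : norm x y ≡ a
      norm-zw  : norm z w ≡ c
      cross    : + 2 * (x * z) + x * w + y * z + + 2 * (y * w) ≡ + 2 * h + + 1
      det      : x * w - y * z ≡ + 1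

    norm-substitute : ∀ u v → norm (x * u + z * v) (y * u + w * v) ≡ a * (u * u) + (+ 2 * h + + 1) * (u * v) + c * (v * v)
    norm-substitute u v = trans (lemma x y z w u v) (cong₂ _+_ (cong₂ _+_ (cong (λ t → t * (u * u)) norm-xy) (cong (λ t → t * (u * v)) cross)) (cong (λ t → t * (v * v)) norm-zw))
      where
      lemma : ∀ x y z w u v →
        (x * u + z * v) * (x * u + z * v) + (x * u + z * v) * (y * u + w * v) + (y * u + w * v) * (y * u + w * v) ≡
        (x * x + x * y + y * y) * (u * u) + (+ 2 * (x * z) + x * w + y * z + + 2 * (y * w)) * (u * v) + (z * z + z * w + w * w) * (v * v)
      lemma = solve-∀

  equivalence-refl : Equivalence (+ 1) (+ 0) (+ 1)
  equivalence-refl = record { x = + 1 ; y = + 0 ; z = + 0 ; w = + 1 ; norm-xy = refl ; norm-zw = refl ; cross = refl ; det = refl }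

  equivalence-swap : ∀ {a h c} → Equivalence a h c → Equivalence c (- h - + 1) a
  equivalence-swap {a} {h} {c} r = record
    { x = z ; y = w ; z = - x ; w = - y
    ; norm-xy = norm-zw
    ; norm-zw = trans (l₁ x y) norm-xy
    ; cross   = trans (l₂ x y z w) (trans (cong -_ cross) (l₃ h))
    ; det     = trans (l₄ x y z w) det
    }
    where
    open Equivalence r
    l₁ : ∀ x y → - x * - x + - x * - y + - y * - y ≡ x * x + x * y + y * y
    l₁ = solve-∀
    l₂ : ∀ x y z w → + 2 * (z * - x) + z * - y + w * - x + + 2 * (w * - y) ≡ - (+ 2 * (x * z) + x * w + y * z + + 2 * (y * w))
    l₂ = solve-∀
    l₃ : ∀ h → - (+ 2 * h + + 1) ≡ + 2 * (- h - + 1) + + 1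
    l₃ = solve-∀
    l₄ : ∀ x y z w → z * - y - w * - x ≡ x * w - y * z
    l₄ = solve-∀

  equivalence-shift : ∀ {a h c} k → Equivalence a h c → Equivalence a (h + k * a) (c + k * (+ 2 * h + + 1) + k * k * a)
  equivalence-shift {a} {h} {c} k r = record
    { x = x ; y = y ; z = z + k * x ; w = w + k * y
    ; norm-xy = norm-xy
    ; norm-zw = trans (l₁ x y z w k) (cong₂ _+_ (cong₂ _+_ norm-zw (cong (λ t → k * t) cross)) (cong (λ t → k * k * t) norm-xy))
    ; cross   = trans (l₂ x y z w k) (trans (cong₂ (λ s t → s + + 2 * k * t) cross norm-xy) (l₃ h k a))
    ; det     = trans (l₄ x y z w k) det
    }
    where
    open Equivalence r
    l₁ : ∀ x y z w k → (z + k * x) * (z + k * x) + (z + k * x) * (w + k * y) + (w + k * y) * (w + k * y) ≡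
      (z * z + z * w + w * w) + k * (+ 2 * (x * z) + x * w + y * z + + 2 * (y * w)) + k * k * (x * x + x * y + y * y)
    l₁ = solve-∀
    l₂ : ∀ x y z w k → + 2 * (x * (z + k * x)) + x * (w + k * y) + y * (z + k * x) + + 2 * (y * (w + k * y)) ≡
      (+ 2 * (x * z) + x * w + y * z + + 2 * (y * w)) + + 2 * k * (x * x + x * y + y * y)
    l₂ = solve-∀
    l₃ : ∀ h k a → + 2 * h + + 1 + + 2 * k * a ≡ + 2 * (h + k * a) + + 1
    l₃ = solve-∀
    l₄ : ∀ x y z w k → x * (w + k * y) - y * (z + k * x) ≡ x * w - y * z
    l₄ = solve-∀

  equivalence-cast : ∀ {a h c h′ c′} → h ≡ h′ → c ≡ c′ → Equivalence a h c → Equivalence a h′ c′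
  equivalence-cast refl refl r = r

  -- Reduction of positive forms of discriminant −3: with 0 ≤ r < a and a c = r² + r + 1 one has c < a unless a = 1.
  discriminant-3 : ∀ n a → a ≤ n → 1 ≤ a → ∀ h c → + a * c ≡ h * h + h + + 1 → Equivalence (+ a) h c
  discriminant-3 (suc n) (suc zero) _ _ h c e =
    equivalence-cast (l₁ h) (trans (l₂ h) (trans (sym e) (ℤP.*-identityˡ c))) (equivalence-shift h equivalence-refl)
    where
    l₁ : ∀ h → + 0 + h * + 1 ≡ h
    l₁ = solve-∀
    l₂ : ∀ h → + 1 + h * (+ 2 * + 0 + + 1) + h * h * + 1 ≡ h * h + h + + 1
    l₂ = solve-∀
  discriminant-3 (suc n) a@(suc (suc a₀)) (s≤s a≤n) _ h c e =
    -- The recursion treats the form with outer coefficients c₁ and a exchanged; swapping back and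
    -- shifting by the quotient k restores the triple a, h, c.
    equivalence-cast (sym h≡) (l₃ c k (+ r) (+ a))
      (equivalence-shift k (equivalence-cast (l₄ (+ r)) refl (equivalence-swap reduced)))
    where
    r : ℕ
    r = h %ℕ a
    k : ℤ
    k = h /ℕ a
    h≡ : h ≡ + r + k * + a
    h≡ = a≡a%ℕn+[a/ℕn]*n h a
    r<a : r < a
    r<a = n%ℕd<d h a
    c₁ : ℤ
    c₁ = c - k * (+ 2 * + r + + 1) - k * k * + a
    l₃ : ∀ c k r a → c - k * (+ 2 * r + + 1) - k * k * a + k * (+ 2 * r + + 1) + k * k * a ≡ c
    l₃ = solve-∀
    l₄ : ∀ r → - (- r - + 1) - + 1 ≡ r
    l₄ = solve-∀
    a*c₁ : + a * c₁ ≡ + (r ℕ.* r ℕ.+ r ℕ.+ 1)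
    a*c₁ = trans (l₅ (+ a) c k (+ r)) (trans (cong (λ y → y - + a * (k * (+ 2 * + r + + 1) + k * k * + a)) (trans e (cong (λ h → h * h + h + + 1) h≡)))
      (trans (l₆ (+ r) k (+ a)) (cong (λ y → y + + r + + 1) (sym (pos-* r r)))))
      where
      l₅ : ∀ a c k r → a * (c - k * (+ 2 * r + + 1) - k * k * a) ≡ a * c - a * (k * (+ 2 * r + + 1) + k * k * a)
      l₅ = solve-∀
      l₆ : ∀ r k a → (r + k * a) * (r + k * a) + (r + k * a) + + 1 - a * (k * (+ 2 * r + + 1) + k * k * a) ≡ r * r + r + + 1
      l₆ = solve-∀
    positive-part : ∀ c′ → + a * c′ ≡ + (r ℕ.* r ℕ.+ r ℕ.+ 1) → ∃ λ m → c′ ≡ + m × a ℕ.* m ≡ r ℕ.* r ℕ.+ r ℕ.+ 1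
    positive-part (+ m) eq = m , refl , +-injective (trans (pos-* a m) eq)
    -- Since a ≥ 2 and r ≤ a - 1, r² + r + 1 ≤ a² - a + 1 < a². As the left side is a c₁, this gives
    -- c₁ < a and the descent terminates.
    quadratic-bound : r ℕ.* r ℕ.+ r ℕ.+ 1 < a ℕ.* a
    quadratic-bound with r | s≤s⁻¹ r<a
    ... | r | r≤ = ≤-trans (s≤s (+-monoˡ-≤ 1 (+-mono-≤ (*-mono-≤ r≤ r≤) r≤))) (≤-trans (≤-reflexive (l₇ a₀)) (≤-trans (m≤m+n _ a₀) (≤-reflexive (l₈ a₀))))
      where
      l₇ : ∀ a → suc (suc a ℕ.* suc a ℕ.+ suc a ℕ.+ 1) ≡ a ℕ.* a ℕ.+ 3 ℕ.* a ℕ.+ 4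
      l₇ = ℕSolver.solve-∀
      l₈ : ∀ a → a ℕ.* a ℕ.+ 3 ℕ.* a ℕ.+ 4 ℕ.+ a ≡ suc (suc a) ℕ.* suc (suc a)
      l₈ = ℕSolver.solve-∀
    reduced : Equivalence c₁ (- + r - + 1) (+ a)
    reduced with positive-part c₁ a*c₁
    ... | zero  , c₁≡ , eq = ⊥-elim (0≢ (trans (sym eq) (ℕP.*-zeroʳ a)))
      where
      0≢ : r ℕ.* r ℕ.+ r ℕ.+ 1 ≡ 0 → ⊥
      0≢ eq₀ with trans (ℕP.+-comm 1 (r ℕ.* r ℕ.+ r)) eq₀
      ... | ()
    ... | suc m , c₁≡ , eq = subst (λ k → Equivalence k (- + r - + 1) (+ a)) (sym c₁≡)
      (discriminant-3 n (suc m) (≤-trans (s≤s⁻¹ m<a) a≤n) (s≤s z≤n) (- + r - + 1) (+ a)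
        (trans (ℤP.*-comm (+ suc m) (+ a)) (trans (sym (pos-* a (suc m))) (trans (cong +_ eq) (trans (cong (λ y → y + + r + + 1) (pos-* r r)) (l₉ (+ r)))))))
      where
      m<a : suc m < a
      m<a = ℕP.*-cancelˡ-< a (suc m) a (subst (_< a ℕ.* a) (sym eq) quadratic-bound)
      l₉ : ∀ r → r * r + r + + 1 ≡ (- r - + 1) * (- r - + 1) + (- r - + 1) + + 1
      l₉ = solve-∀

  -- Counting elements of given norm on sublattices

  norm-bounded : ∀ {B m} x y → norm x y ≡ + m → 2 ℕ.* m ≤ B → Bounded B (x , y)
  norm-bounded {B} {m} x y e h = bound x y e , bound y x (trans (symmetric y x) e)
    where
    symmetric : ∀ x y → x * x + x * y + y * y ≡ y * y + y * x + x * x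
    symmetric = solve-∀
    bound : ∀ x y → norm x y ≡ + m → ∣ x ∣ ≤ B
    bound x y e = ≤-trans (∣∣≤square x) (≤-trans (ℕP.*-cancelˡ-≤ 3 (≤-trans below-4m (≤-trans (m≤m+n (4 ℕ.* m) (2 ℕ.* m)) (≤-reflexive (l₂ m))))) h)
      where
      -- Completing the square gives 3x² ≤ 4m, so |x| ≤ x² ≤ 2m. This is the origin of the bounds of
      -- size 2m for the norm form.
      l₁ : ∀ x y → + 3 * (x * x) + (x + + 2 * y) * (x + + 2 * y) ≡ + 4 * (x * x + x * y + y * y)
      l₁ = solve-∀
      l₂ : ∀ m → 4 ℕ.* m ℕ.+ 2 ℕ.* m ≡ 3 ℕ.* (2 ℕ.* m)
      l₂ = ℕSolver.solve-∀
      completed : 3 ℕ.* square x ℕ.+ square (x + + 2 * y) ≡ 4 ℕ.* m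
      completed = +-injective (trans (cong₂ _+_ (trans (pos-* 3 (square x)) (cong (λ t → + 3 * t) (+square x))) (+square (x + + 2 * y)))
        (trans (l₁ x y) (trans (cong (λ t → + 4 * t) e) (sym (pos-* 4 m)))))
      below-4m : 3 ℕ.* square x ≤ 4 ℕ.* m
      below-4m = ≤-trans (m≤m+n _ _) (≤-reflexive completed)

  norm² : ℤ × ℤ → ℤ
  norm² (x , y) = norm x y

  Norm : ℤ → ℤ × ℤ → Set
  Norm k p = norm² p ≡ k

  norm? : ∀ k → Decidable (Norm k)
  norm? k p = norm² p ℤ.≟ k

  R : ℕ → ℕ → ℤ
  R B m = count B (norm? (+ m))

  -- The number of elements of norm m / p (none when p does not divide m).
  R/ : ℕ → ℕ → ℕ → ℤ
  R/ B p m = count B (λ q → + p * norm² q ℤ.≟ + m)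

  OnLine : ℤ → ℤ → ℤ × ℤ → Set
  OnLine p h (x , y) = p ∣ x - h * y

  onLine? : ∀ p h → Decidable (OnLine p h)
  onLine? p h (x , y) = p ∣? (x - h * y)

  BothDivisible : ℤ → ℤ × ℤ → Set
  BothDivisible p (x , y) = (p ∣ x) × (p ∣ y)

  bothDivisible? : ∀ p → Decidable (BothDivisible p)
  bothDivisible? p (x , y) = (p ∣? x) ×-dec (p ∣? y)

  module _ (B p m : ℕ) .{{_ : ℕ.NonZero p}} (large : 2 ℕ.* (p ℕ.* m) ≤ B) where

    private
      m-large : 2 ℕ.* m ≤ B
      m-large = ≤-trans (*-monoʳ-≤ 2 (m≤n*m m p)) large

    -- Points of the sublattice are (p u + h v, v), with norm p (p u² + (2h + 1) u v + c v²). The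
    -- second factor has discriminant (2h + 1)² - 4pc = -3, so it is a norm in new coordinates s, t;
    -- `ψ` recovers u, v from these by the inverse substitution.
    line-count : ∀ h c → + p * c ≡ h * h + h + + 1 →
      count B (λ q → norm? (+ (p ℕ.* m)) q ×-dec onLine? (+ p) h q) ≡ R B m
    line-count h c pc = grid-bijection B (λ q → norm? (+ (p ℕ.* m)) q ×-dec onLine? (+ p) h q) (norm? (+ m)) (λ _ → + 1) (λ _ → + 1) ψ
      (λ (s , t) e → norm-bounded (proj₁ (ψ (s , t))) (proj₂ (ψ (s , t))) (scaled s t e) large ,
        (scaled s t e , divides (w * s - z * t) (l₁ (+ p) h (w * s - z * t) (x * t - y * s))) , refl)
      (λ (s , t) (s′ , t′) _ _ e → inj s t s′ t′ e)
      onto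
      where
      open Equivalence (discriminant-3 p p ≤-refl (n≢0⇒n>0 (ℕ.≢-nonZero⁻¹ p)) h c pc)
      ψ : ℤ × ℤ → ℤ × ℤ
      ψ (s , t) = + p * (w * s - z * t) + h * (x * t - y * s) , x * t - y * s
      l₁ : ∀ p h u v → p * u + h * v - h * v ≡ u * p
      l₁ = solve-∀
      inverseˡ : ∀ s t → x * (w * s - z * t) + z * (x * t - y * s) ≡ s
      inverseˡ s t = trans (lemma x y z w s t) (trans (cong (λ k → k * s) det) (ℤP.*-identityˡ s))
        where
        lemma : ∀ x y z w s t → x * (w * s - z * t) + z * (x * t - y * s) ≡ (x * w - y * z) * s
        lemma = solve-∀
      inverseʳ : ∀ s t → y * (w * s - z * t) + w * (x * t - y * s) ≡ t
      inverseʳ s t = trans (lemma x y z w s t) (trans (cong (λ k → k * t) det) (ℤP.*-identityˡ t))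
        where
        lemma : ∀ x y z w s t → y * (w * s - z * t) + w * (x * t - y * s) ≡ (x * w - y * z) * t
        lemma = solve-∀
      line-norm : ∀ u v → norm (+ p * u + h * v) v ≡ + p * norm (x * u + z * v) (y * u + w * v)
      line-norm u v = trans (l₂ (+ p) h u v) (trans (cong (λ k → + p * (+ p * (u * u) + (+ 2 * h + + 1) * (u * v)) + k * (v * v)) (sym pc))
        (trans (l₃ (+ p) h c u v) (cong (λ k → + p * k) (sym (norm-substitute u v)))))
        where
        l₂ : ∀ p h u v → (p * u + h * v) * (p * u + h * v) + (p * u + h * v) * v + v * v ≡
          p * (p * (u * u) + (+ 2 * h + + 1) * (u * v)) + (h * h + h + + 1) * (v * v)
        l₂ = solve-∀
        l₃ : ∀ p h c u v → p * (p * (u * u) + (+ 2 * h + + 1) * (u * v)) + p * c * (v * v) ≡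
          p * (p * (u * u) + (+ 2 * h + + 1) * (u * v) + c * (v * v))
        l₃ = solve-∀
      scaled : ∀ s t → norm s t ≡ + m → norm (proj₁ (ψ (s , t))) (proj₂ (ψ (s , t))) ≡ + (p ℕ.* m)
      scaled s t e = trans (line-norm (w * s - z * t) (x * t - y * s)) (trans (cong (λ k → + p * k)
        (trans (cong₂ norm (inverseˡ s t) (inverseʳ s t)) e)) (sym (pos-* p m)))
      instance
        +p-nonZero : ℤ.NonZero (+ p)
        +p-nonZero = ℤ.≢-nonZero (λ e → ℕ.≢-nonZero⁻¹ p (+-injective e))
      inj : ∀ s t s′ t′ → ψ (s , t) ≡ ψ (s′ , t′) → (s , t) ≡ (s′ , t′)
      inj s t s′ t′ e = cong₂ _,_
        (trans (sym (inverseˡ s t)) (trans (cong₂ (λ u v → x * u + z * v) u≡ v≡) (inverseˡ s′ t′)))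
        (trans (sym (inverseʳ s t)) (trans (cong₂ (λ u v → y * u + w * v) u≡ v≡) (inverseʳ s′ t′)))
        where
        v≡ : x * t - y * s ≡ x * t′ - y * s′
        v≡ = cong proj₂ e
        u≡ : w * s - z * t ≡ w * s′ - z * t′
        u≡ = ℤP.*-cancelʳ-≡ (w * s - z * t) (w * s′ - z * t′) (+ p)
          (trans (sym (l₁ (+ p) h (w * s - z * t) (x * t - y * s))) (trans (cong₂ (λ k v → k - h * v) (cong proj₁ e) v≡) (l₁ (+ p) h (w * s′ - z * t′) (x * t′ - y * s′))))
      onto : ∀ q → Norm (+ (p ℕ.* m)) q × OnLine (+ p) h q → ∃ λ r → Bounded B r × Norm (+ m) r × ψ r ≡ q
      onto (X , v) (e , divides u eq) = (s , r) , norm-bounded s r n m-large , n , cong₂ _,_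
        (trans (cong₂ (λ a b → + p * a + h * b) back₁ back₂) (trans (cong (λ k → k + h * v) (trans (ℤP.*-comm (+ p) u) (sym eq))) (l₄ X (h * v)))) back₂
        where
        s r : ℤ
        s = x * u + z * v
        r = y * u + w * v
        l₄ : ∀ X k → X - k + k ≡ X
        l₄ = solve-∀
        back₁ : w * s - z * r ≡ u
        back₁ = trans (lemma x y z w u v) (trans (cong (λ k → k * u) det) (ℤP.*-identityˡ u))
          where
          lemma : ∀ x y z w u v → w * (x * u + z * v) - z * (y * u + w * v) ≡ (x * w - y * z) * u
          lemma = solve-∀
        back₂ : x * r - y * s ≡ v
        back₂ = trans (lemma x y z w u v) (trans (cong (λ k → k * v) det) (ℤP.*-identityˡ v))
          where
          lemma : ∀ x y z w u v → x * (y * u + w * v) - y * (x * u + z * v) ≡ (x * w - y * z) * v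
          lemma = solve-∀
        n : norm s r ≡ + m
        n = ℤP.*-cancelˡ-≡ (+ p) (norm s r) (+ m) (trans (sym (line-norm u v)) (trans
          (cong (λ k → norm k v) (trans (cong (λ k → k + h * v) (trans (ℤP.*-comm (+ p) u) (sym eq))) (l₄ X (h * v))))
          (trans e (pos-* p m))))

    divisible-count : count B (λ q → norm? (+ (p ℕ.* m)) q ×-dec bothDivisible? (+ p) q) ≡ R/ B p m
    divisible-count = grid-bijection B (λ q → norm? (+ (p ℕ.* m)) q ×-dec bothDivisible? (+ p) q) (λ q → + p * norm² q ℤ.≟ + m) (λ _ → + 1) (λ _ → + 1) ψ
      (λ (s , t) e → norm-bounded (s * + p) (t * + p) (scaled s t e) large , (scaled s t e , divides s refl , divides t refl) , refl)
      (λ (s , t) (s′ , t′) _ _ e → cong₂ _,_ (ℤP.*-cancelʳ-≡ s s′ (+ p) (cong proj₁ e)) (ℤP.*-cancelʳ-≡ t t′ (+ p) (cong proj₂ e)))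
      (λ { (X , Y) (e , divides s refl , divides t refl) → (s , t) , bounded s t e , unscaled s t e , refl })
      where
      ψ : ℤ × ℤ → ℤ × ℤ
      ψ (s , t) = s * + p , t * + p
      instance
        +p-nonZero : ℤ.NonZero (+ p)
        +p-nonZero = ℤ.≢-nonZero (λ e → ℕ.≢-nonZero⁻¹ p (+-injective e))
      norm-scale : ∀ p s t → s * p * (s * p) + s * p * (t * p) + t * p * (t * p) ≡ p * (p * (s * s + s * t + t * t))
      norm-scale = solve-∀
      scaled : ∀ s t → + p * norm s t ≡ + m → norm (s * + p) (t * + p) ≡ + (p ℕ.* m)
      scaled s t e = trans (norm-scale (+ p) s t) (trans (cong (λ k → + p * k) e) (sym (pos-* p m)))
      unscaled : ∀ s t → norm (s * + p) (t * + p) ≡ + (p ℕ.* m) → + p * norm s t ≡ + m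
      unscaled s t e = ℤP.*-cancelˡ-≡ (+ p) (+ p * norm s t) (+ m) (trans (sym (norm-scale (+ p) s t)) (trans e (pos-* p m)))
      ∣∣≤∣*p∣ : ∀ s → ∣ s ∣ ≤ ∣ s * + p ∣
      ∣∣≤∣*p∣ s = ≤-trans (m≤m*n ∣ s ∣ p) (≤-reflexive (sym (abs-* s (+ p))))
      bounded : ∀ s t → norm (s * + p) (t * + p) ≡ + (p ℕ.* m) → Bounded B (s , t)
      bounded s t e = let b₁ , b₂ = norm-bounded (s * + p) (t * + p) e large in
        ≤-trans (∣∣≤∣*p∣ s) b₁ , ≤-trans (∣∣≤∣*p∣ t) b₂

  -- Roots of x² + x + 1 modulo a prime

  least : ℕ → ℕ → ℕ → ℤ
  least x y z = on ((x <? y) ×-dec (x <? z)) (+ 1)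

  -- The three hypotheses say that two coinciding members force all three to coincide, as in an
  -- orbit under a map of order three. Otherwise the members are distinct and one is strictly least.
  exactly-one-least : ∀ x y z → (x ≡ y → y ≡ z) → (y ≡ z → x ≡ y) → (z ≡ x → x ≡ y) →
    + 1 ≡ on (y ≟ x) (+ 1) + (least x y z + least y z x + least z x y)
  exactly-one-least x y z xy yz zx with y ≟ x
  ... | yes refl with xy refl
  ... | refl = sym (cong (λ k → + 1 + (k + k + k)) (on-no ((x <? x) ×-dec (x <? x)) (λ (h , _) → <-irrefl refl h)))
  exactly-one-least x y z xy yz zx | no y≢x with <-cmp x y
  ... | tri≈ _ e _ = ⊥-elim (y≢x (sym e))
  ... | tri< x<y _ _ with <-cmp z x
  ... | tri≈ _ e _ = ⊥-elim (y≢x (sym (zx e)))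
  ... | tri< z<x _ _ = sym (trans (+-identityˡ _) (cong₂ _+_ (cong₂ _+_
    (on-no ((x <? y) ×-dec (x <? z)) (λ (_ , h) → <-asym h z<x))
    (on-no ((y <? z) ×-dec (y <? x)) (λ (_ , h) → <-asym h x<y)))
    (on-yes ((z <? x) ×-dec (z <? y)) (z<x , <-trans z<x x<y))))
  ... | tri> _ _ x<z = sym (trans (+-identityˡ _) (cong₂ _+_ (cong₂ _+_
    (on-yes ((x <? y) ×-dec (x <? z)) (x<y , x<z))
    (on-no ((y <? z) ×-dec (y <? x)) (λ (_ , h) → <-asym h x<y)))
    (on-no ((z <? x) ×-dec (z <? y)) (λ (h , _) → <-asym h x<z))))
  exactly-one-least x y z xy yz zx | no y≢x | tri> _ _ y<x with <-cmp y z
  ... | tri≈ _ e _ = ⊥-elim (y≢x (sym (yz e)))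
  ... | tri< y<z _ _ = sym (trans (+-identityˡ _) (cong₂ _+_ (cong₂ _+_
    (on-no ((x <? y) ×-dec (x <? z)) (λ (h , _) → <-asym h y<x))
    (on-yes ((y <? z) ×-dec (y <? x)) (y<z , y<x)))
    (on-no ((z <? x) ×-dec (z <? y)) (λ (_ , h) → <-asym h y<z))))
  ... | tri> _ _ z<y = sym (trans (+-identityˡ _) (cong₂ _+_ (cong₂ _+_
    (on-no ((x <? y) ×-dec (x <? z)) (λ (h , _) → <-asym h y<x))
    (on-no ((y <? z) ×-dec (y <? x)) (λ (h , _) → <-asym h z<y)))
    (on-yes ((z <? x) ×-dec (z <? y)) (<-trans z<y y<x , z<y))))

  -- Every orbit of three elements contains exactly one x with x < τ x and x < τ (τ x).
  order-three : {xs : List ℕ} → Unique xs → (τ : ℕ → ℕ) → (∀ x → x ∈ xs → τ x ∈ xs) → (∀ x → τ (τ (τ x)) ≡ x) →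
    ∃ λ s → ∑ xs (λ _ → + 1) ≡ ∑ xs (λ x → on (τ x ≟ x) (+ 1)) + + 3 * s
  order-three {xs} u τ closed cube = s , (begin
    ∑ xs (λ _ → + 1)
      ≡⟨ ∑-cong′ xs (λ x → exactly-one-least x (τ x) (τ (τ x)) (cong τ) τ-injective (λ e → trans (sym (cube x)) (cong τ e))) ⟩
    ∑ xs (λ x → on (τ x ≟ x) (+ 1) + (μ x + μ₁ x + μ₂ x))
      ≡⟨ trans (∑-+ xs (λ x → on (τ x ≟ x) (+ 1)) (λ x → μ x + μ₁ x + μ₂ x)) (cong (λ k → ∑ xs (λ x → on (τ x ≟ x) (+ 1)) + k)
           (trans (∑-+ xs (λ x → μ x + μ₁ x) μ₂) (cong (λ k → k + ∑ xs μ₂) (∑-+ xs μ μ₁)))) ⟩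
    ∑ xs (λ x → on (τ x ≟ x) (+ 1)) + (s + ∑ xs μ₁ + ∑ xs μ₂)
      ≡⟨ cong (λ k → ∑ xs (λ x → on (τ x ≟ x) (+ 1)) + k) (trans (cong₂ (λ a b → s + a + b) μ₁≡ (trans μ₂≡ μ₁≡)) (lemma s)) ⟩
    ∑ xs (λ x → on (τ x ≟ x) (+ 1)) + + 3 * s ∎)
    where
    open ≡-Reasoning
    μ μ₁ μ₂ : ℕ → ℤ
    μ x  = least x (τ x) (τ (τ x))
    μ₁ x = least (τ x) (τ (τ x)) x
    μ₂ x = least (τ (τ x)) x (τ x)
    s : ℤ
    s = ∑ xs μ
    lemma : ∀ s → s + s + s ≡ + 3 * s
    lemma = solve-∀
    τ-injective : ∀ {x y} → τ x ≡ τ y → x ≡ y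
    τ-injective {x} {y} e = trans (sym (cube x)) (trans (cong (λ k → τ (τ k)) e) (cube y))
    M : ℕ → Set
    M x = x < τ x × x < τ (τ x)
    M? : Decidable M
    M? x = (x <? τ x) ×-dec (x <? τ (τ x))
    rotate : {P : ℕ → Set} (P? : Decidable P) → ∑ xs (λ x → on (P? (τ x)) (+ 1)) ≡ ∑ xs (λ x → on (P? x) (+ 1))
    rotate {P} P? = sym (∑-bijection _≟_ _≟_ u u P? (λ x → P? (τ x)) (λ _ → + 1) (λ _ → + 1) τ
      (λ x x∈ p → closed x x∈ , p , refl)
      (λ _ _ _ _ → τ-injective)
      (λ x x∈ p → τ (τ x) , closed _ (closed x x∈) , subst P (sym (cube x)) p , cube x))
    μ₁≡ : ∑ xs μ₁ ≡ s
    μ₁≡ = trans (∑-cong′ xs (λ x → cong (least (τ x) (τ (τ x))) (sym (cube x)))) (rotate M?)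
    μ₂≡ : ∑ xs μ₂ ≡ ∑ xs μ₁
    μ₂≡ = trans (∑-cong′ xs (λ x → cong₂ (least (τ (τ x))) (sym (cube x)) (sym (cong τ (cube x)))))
      (trans (rotate (λ x → M? (τ x))) (∑-cong′ xs (λ x → cong (least (τ x) (τ (τ x))) (cube x))))

  -- The fixed points of x ↦ −1/(1+x) are the roots of x² + x + 1. On the residues
  -- other than 0 and −1 the map has order three.
  module Roots (k : ℕ) (p-prime : Prime (suc (suc k))) where

    p : ℕ
    p = suc (suc k)

    -- The relation y = -1/(1 + x) modulo p, with the denominator cleared.
    Image : ℕ → ℕ → Set
    Image x y = + p ∣ + y * (+ 1 + + x) + + 1

    p∤ : ∀ {n} → 1 ≤ n → n < p → ¬ (+ p ∣ + n)
    p∤ {suc n} _ n<p d = ℕP.<⇒≱ n<p (ℕD.∣⇒≤ (∣⇒∣ᵤ d))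

    p∤1 : ¬ (+ p ∣ + 1)
    p∤1 = p∤ (s≤s z≤n) (s≤s (s≤s z≤n))

    inverse : ∀ n → 1 ≤ n → n < p → ∃ λ b → + p ∣ b * + n - + 1
    inverse (suc n) _ n<p with Coprimality.coprime-Bézout (Coprimality.prime⇒coprime p-prime n<p)
    ... | Bézout.+- x y eq = - + y , divides (- + x) (trans (l₁ (+ y) (+ suc n)) (trans (cong -_ (trans (cong (λ k → + 1 + k) (sym (pos-* y (suc n)))) (trans (cong +_ eq) (pos-* x p)))) (neg-distribˡ-* (+ x) (+ p))))
      where
      l₁ : ∀ y n → - y * n - + 1 ≡ - (+ 1 + y * n)
      l₁ = solve-∀
    ... | Bézout.-+ x y eq = + y , divides (+ x) (trans (cong (λ k → k - + 1) (trans (sym (pos-* y (suc n))) (trans (cong +_ (sym eq)) (cong (λ k → + 1 + k) (pos-* x p))))) (l₁ (+ x * + p)))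
      where
      l₁ : ∀ k → + 1 + k - + 1 ≡ k
      l₁ = solve-∀

    unique-residue : ∀ y y′ → y < p → y′ < p → + p ∣ + y - + y′ → y ≡ y′
    unique-residue y y′ h h′ d with <-cmp y y′
    ... | tri≈ _ e _ = e
    ... | tri< y<y′ _ _ = ⊥-elim (p∤ (m<n⇒0<n∸m y<y′) (≤-<-trans (m∸n≤m y′ y) h′)
      (∣-cast (trans (lemma (+ y) (+ y′)) (trans (m-n≡m⊖n y′ y) (⊖-≥ (<⇒≤ y<y′)))) (∣m⇒∣-m d)))
      where
      lemma : ∀ y y′ → - (y - y′) ≡ y′ - y
      lemma = solve-∀
    ... | tri> _ _ y′<y = ⊥-elim (p∤ (m<n⇒0<n∸m y′<y) (≤-<-trans (m∸n≤m y y′) h)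
      (∣-cast (trans (m-n≡m⊖n y y′) (⊖-≥ (<⇒≤ y′<y))) d))

    InRange : ℕ → Set
    InRange x = 1 ≤ x × x ≤ k

    inRange? : Decidable InRange
    inRange? x = (1 ≤? x) ×-dec (x ≤? k)

    image : ∀ x → InRange x → ∃ λ y → InRange y × Image x y
    image x (1≤x , x≤k) with inverse (suc x) (s≤s z≤n) (s≤s (s≤s x≤k))
    ... | b , divides q eq = y , in-range y y<p spec , spec
      where
      y : ℕ
      y = (- b) %ℕ p
      y<p : y < p
      y<p = n%ℕd<d (- b) p
      j : ℤ
      j = (- b) /ℕ p
      y≡ : + y ≡ - b - j * + p
      y≡ = trans (l₁ (+ y) (j * + p)) (cong (λ k → k - j * + p) (sym (a≡a%ℕn+[a/ℕn]*n (- b) p)))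
        where
        l₁ : ∀ y k → y ≡ y + k - k
        l₁ = solve-∀
      spec : Image x y
      spec = divides (- q - j * + suc x) (trans (cong (λ k → k * + suc x + + 1) y≡) (trans (l₁ b (+ suc x) j (+ p))
        (trans (cong (λ k → - k - j * + suc x * + p) eq) (l₂ q j (+ suc x) (+ p)))))
        where
        l₁ : ∀ b x j p → (- b - j * p) * x + + 1 ≡ - (b * x - + 1) - j * x * p
        l₁ = solve-∀
        l₂ : ∀ q j x p → - (q * p) - j * x * p ≡ (- q - j * x) * p
        l₂ = solve-∀
      -- The excluded values cannot occur: y = 0 would give p ∣ 1, and y = p - 1 would give p ∣ x.
      in-range : ∀ y → y < p → Image x y → InRange y
      in-range zero    _ d = ⊥-elim (p∤1 d)
      in-range (suc y) y<p d with suc y ≤? k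
      ... | yes h = s≤s z≤n , h
      ... | no ¬h with refl ← ≤-antisym (s≤s⁻¹ (s≤s⁻¹ y<p)) (s≤s⁻¹ (≰⇒> ¬h)) =
        ⊥-elim (p∤ 1≤x (≤-trans (s≤s x≤k) (n≤1+n (suc k)))
          (∣-cast (l₁ (+ k) (+ x)) (∣m∣n⇒∣m-n (divides (+ 1 + + x) (ℤP.*-comm (+ p) (+ 1 + + x))) d)))
        where
        l₁ : ∀ k x → (+ 2 + k) * (+ 1 + x) - ((+ 1 + k) * (+ 1 + x) + + 1) ≡ x
        l₁ = solve-∀

    <p : ∀ {x} → InRange x → x < p
    <p (_ , h) = ≤-trans (s≤s h) (n≤1+n (suc k))

    p∣*⇒ : ∀ m n → + p ∣ m * n → (+ p ∣ m) ⊎ (+ p ∣ n)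
    p∣*⇒ m n d with euclidsLemma ∣ m ∣ ∣ n ∣ p-prime (subst (λ v → p ℕD.∣ v) (abs-* m n) (∣⇒∣ᵤ d))
    ... | inj₁ h = inj₁ (∣ᵤ⇒∣ h)
    ... | inj₂ h = inj₂ (∣ᵤ⇒∣ h)

    image-unique : ∀ {x y y′} → InRange x → y < p → y′ < p → Image x y → Image x y′ → y ≡ y′
    image-unique {x} {y} {y′} (1≤x , x≤k) h h′ i i′ with p∣*⇒ (+ y - + y′) (+ suc x) (∣-cast (l₁ (+ y) (+ y′) (+ x)) (∣m∣n⇒∣m-n i i′))
      where
      l₁ : ∀ y y′ x → y * (+ 1 + x) + + 1 - (y′ * (+ 1 + x) + + 1) ≡ (y - y′) * (+ 1 + x)
      l₁ = solve-∀
    ... | inj₁ d = unique-residue y y′ h h′ d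
    ... | inj₂ d = ⊥-elim (p∤ (s≤s z≤n) (s≤s (s≤s x≤k)) d)

    -- Iterating x ↦ -1/(1 + x) three times returns x; in divisibility form this is the single
    -- polynomial identity `l₁`.
    image-cycle : ∀ x y z → Image x y → Image y z → Image z x
    image-cycle x y z i j = ∣-cast (l₁ (+ x) (+ y) (+ z)) (∣m∣n⇒∣m-n (∣n⇒∣m*n (+ 1 + + x) j) (∣n⇒∣m*n (+ z) i))
      where
      l₁ : ∀ x y z → (+ 1 + x) * (z * (+ 1 + y) + + 1) - z * (y * (+ 1 + x) + + 1) ≡ x * (+ 1 + z) + + 1
      l₁ = solve-∀

    abstract
      τ′ : ∀ x → Dec (InRange x) → ℕ
      τ′ x (yes r) = proj₁ (image x r)
      τ′ x (no _)  = x

      τ : ℕ → ℕ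
      τ x = τ′ x (inRange? x)

      τ-image : ∀ {x} → InRange x → InRange (τ x) × Image x (τ x)
      τ-image {x} r = go (inRange? x)
        where
        go : ∀ d → InRange (τ′ x d) × Image x (τ′ x d)
        go (yes r) = proj₂ (image x r)
        go (no ¬r) = ⊥-elim (¬r r)

      τ-outside : ∀ {x} → ¬ InRange x → τ x ≡ x
      τ-outside {x} ¬r = go (inRange? x)
        where
        go : ∀ d → τ′ x d ≡ x
        go (yes r) = ⊥-elim (¬r r)
        go (no _)  = refl

      τ-cube : ∀ x → τ (τ (τ x)) ≡ x
      τ-cube x = go (inRange? x)
        where
        go : Dec (InRange x) → τ (τ (τ x)) ≡ x
        go (no ¬r) = let e = τ-outside ¬r in trans (cong (λ k → τ (τ k)) e) (trans (cong τ e) e)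
        go (yes r) = let r₁ , i₁ = τ-image r
                         r₂ , i₂ = τ-image r₁
                         r₃ , i₃ = τ-image r₂ in
          image-unique r₂ (<p r₃) (<p r) i₃ (image-cycle x (τ x) (τ (τ x)) i₁ i₂)

    ∈⇒InRange : ∀ {x} → x ∈ ps k → InRange x
    ∈⇒InRange h = ∈-ps⁻ k h

    -- The number of fixed points is k = p - 2 modulo 3. For p ≡ 1 this is 2, so a root exists; for
    -- p ≡ 2 it is 0, which is incompatible with exactly two roots.
    orbits : ∃ λ s → + k ≡ ∑ (ps k) (λ x → on (τ x ≟ x) (+ 1)) + + 3 * s
    orbits with order-three (ps-unique k) τ (λ x x∈ → let (a , b) , _ = τ-image (∈⇒InRange x∈) in ∈-ps⁺ k a b) τ-cube
    ... | s , e = s , trans (sym (trans (∑-ones k (+ 1)) (ℤP.*-identityʳ (+ k)))) e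

    Root : ℤ → Set
    Root h = + p ∣ h * h + h + + 1

    fixed⇒root : ∀ {x} → InRange x → τ x ≡ x → Root (+ x)
    fixed⇒root {x} r e = ∣-cast (l₁ (+ x)) (subst (Image x) e (proj₂ (τ-image r)))
      where
      l₁ : ∀ x → x * (+ 1 + x) + + 1 ≡ x * x + x + + 1
      l₁ = solve-∀

    root⇒fixed : ∀ {x} → InRange x → Root (+ x) → τ x ≡ x
    root⇒fixed {x} r d = let r′ , i = τ-image r in image-unique r (<p r′) (<p r) i (∣-cast (l₁ (+ x)) d)
      where
      l₁ : ∀ x → x * x + x + + 1 ≡ x * (+ 1 + x) + + 1
      l₁ = solve-∀

    no-fixed : ¬ (∃ λ x → x ∈ ps k × τ x ≡ x) → ∑ (ps k) (λ x → on (τ x ≟ x) (+ 1)) ≡ + 0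
    no-fixed h = ∑-0 (ps k) (λ x x∈ → on-no (τ x ≟ x) (λ e → h (x , x∈ , e)))

    root-exists : ∀ j → p ≡ 3 ℕ.* j ℕ.+ 1 → ∃ Root
    root-exists j p≡ with any? (λ x → τ x ≟ x) (ps k)
    ... | yes a = let x , x∈ , e = find a in + x , fixed⇒root (∈⇒InRange x∈) e
    ... | no ¬a with orbits
    ... | s , e = ⊥-elim (3∤1 (+ j - s) (trans (l₁ (+ j) s) (trans (cong (λ v → v - + 3 * s - + 1) (trans (cong (λ v → v + + 1) (sym (pos-* 3 j))) (cong +_ (sym p≡))))
        (trans (cong (λ v → + 2 + v - + 3 * s - + 1) (trans e (cong (λ v → v + + 3 * s) (no-fixed (λ (x , x∈ , f) → ¬a (lose x∈ f)))))) (l₂ s)))))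
      where
      l₁ : ∀ j s → (j - s) * + 3 ≡ + 3 * j + + 1 - + 3 * s - + 1
      l₁ = solve-∀
      l₂ : ∀ s → + 2 + (+ 0 + + 3 * s) - + 3 * s - + 1 ≡ + 1
      l₂ = solve-∀
      3∤1 : ∀ v → v * + 3 ≡ + 1 → ⊥
      3∤1 v e = impossible ∣ v ∣ (trans (sym (abs-* v (+ 3))) (cong ∣_∣ e))
        where
        impossible : ∀ n → n ℕ.* 3 ≡ 1 → ⊥
        impossible zero    ()
        impossible (suc n) ()

  3∤2 : ∀ v → v * + 3 ≡ + 2 → ⊥
  3∤2 v e = impossible ∣ v ∣ (trans (sym (abs-* v (+ 3))) (cong ∣_∣ e))
    where
    impossible : ∀ n → n ℕ.* 3 ≡ 2 → ⊥
    impossible zero    ()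
    impossible (suc n) ()

  module NoRoots (k : ℕ) (p-prime : Prime (suc (suc k))) (j : ℕ) (p≡ : suc (suc k) ≡ 3 ℕ.* j ℕ.+ 2) where

    open Roots k p-prime

    private
      +p≡ : + 2 + + k ≡ + 3 * + j + + 2
      +p≡ = trans (cong +_ p≡) (cong (λ v → v + + 2) (pos-* 3 j))

    p∤3 : ¬ (+ p ∣ + 3)
    p∤3 d = small k (s≤s⁻¹ (s≤s⁻¹ (ℕD.∣⇒≤ (∣⇒∣ᵤ d)))) p≡ d
      where
      impossible : ∀ j → 3 ≡ 3 ℕ.* j ℕ.+ 2 → ⊥
      impossible j e = 3∤2 (+ 1 - + j) (trans (l₁ (+ j)) (trans (cong (λ v → v - + 3 * + j) (trans (cong +_ e) (cong (λ v → v + + 2) (pos-* 3 j)))) (l₂ (+ j))))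
        where
        l₁ : ∀ j → (+ 1 - j) * + 3 ≡ + 3 - + 3 * j
        l₁ = solve-∀
        l₂ : ∀ j → + 3 * j + + 2 - + 3 * j ≡ + 2
        l₂ = solve-∀
      small : ∀ k → k ≤ 1 → suc (suc k) ≡ 3 ℕ.* j ℕ.+ 2 → + suc (suc k) ∣ + 3 → ⊥
      small zero          _ _ (divides q e) = odd≢even (+ 1) q e
      small (suc zero)    _ e _ = impossible j e
      small (suc (suc k)) (s≤s ()) _ _

    module _ (r : ℕ) (r-range : InRange r) (root : Root (+ r)) where

      private
        r≤k : r ≤ k
        r≤k = proj₂ r-range
        -- The conjugate root -1 - r, represented by p - 1 - r.
        r′ : ℕ
        r′ = suc k ∸ r
        +r′ : + r′ ≡ + 1 + + k - + r
        +r′ = sym (trans (m-n≡m⊖n (suc k) r) (⊖-≥ (m≤n⇒m≤1+n r≤k)))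
        r′-range : InRange r′
        r′-range = m<n⇒0<n∸m (s≤s r≤k) , ℕP.∸-monoʳ-≤ (suc k) (proj₁ r-range)
        root′ : Root (+ r′)
        root′ = ∣-cast (sym (trans (cong (λ h → h * h + h + + 1) +r′) (l₁ (+ k) (+ r))))
          (∣m∣n⇒∣m+n root (divides (+ 1 + + k - + 2 * + r) (l₂ (+ k) (+ r))))
          where
          l₁ : ∀ k r → (+ 1 + k - r) * (+ 1 + k - r) + (+ 1 + k - r) + + 1 ≡ r * r + r + + 1 + (+ 2 + k) * (+ 1 + k - + 2 * r)
          l₁ = solve-∀
          l₂ : ∀ k r → (+ 2 + k) * (+ 1 + k - + 2 * r) ≡ (+ 1 + k - + 2 * r) * (+ 2 + k)
          l₂ = solve-∀
        r≢r′ : r ≢ r′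
        -- Equality would mean 2r + 1 = p, and p would divide 4(r² + r + 1) - (2r + 1)² = 3.
        r≢r′ e = p∤3 (∣-cast (trans (cong (λ w → + 4 * (+ r * + r + + r + + 1) - w * w) 2r+1) (l₂ (+ r)))
          (∣m∣n⇒∣m-n (∣n⇒∣m*n (+ 4) root) (∣m⇒∣m*n (+ p) ∣-refl)))
          where
          2r+1 : + p ≡ + 2 * + r + + 1
          2r+1 = trans (l₁ (+ k) (+ r)) (trans (cong (λ v → v + + r + + 1) (trans (sym +r′) (cong +_ (sym e)))) (l₃ (+ r)))
            where
            l₁ : ∀ k r → + 2 + k ≡ + 1 + k - r + r + + 1
            l₁ = solve-∀
            l₃ : ∀ r → r + r + + 1 ≡ + 2 * r + + 1
            l₃ = solve-∀
          l₂ : ∀ r → + 4 * (r * r + r + + 1) - (+ 2 * r + + 1) * (+ 2 * r + + 1) ≡ + 3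
          l₂ = solve-∀
        fixed-points : ∀ x → InRange x → τ x ≡ x → x ≡ r ⊎ x ≡ r′
        fixed-points x xr e with p∣*⇒ (+ x - + r) (+ x + + r + + 1)
          (∣-cast (l₁ (+ x) (+ r)) (∣m∣n⇒∣m-n (fixed⇒root xr e) root))
          where
          l₁ : ∀ x r → x * x + x + + 1 - (r * r + r + + 1) ≡ (x - r) * (x + r + + 1)
          l₁ = solve-∀
        ... | inj₁ d = inj₁ (unique-residue x r (<p xr) (<p r-range) d)
        ... | inj₂ d = inj₂ (unique-residue x r′ (<p xr) (<p r′-range)
          (∣-cast (trans (l₁ (+ x) (+ r) (+ k)) (cong (λ v → + x - v) (sym +r′)))
            (∣m∣n⇒∣m-n d ∣-refl)))
          where
          l₁ : ∀ x r k → x + r + + 1 - (+ 2 + k) ≡ x - (+ 1 + k - r)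
          l₁ = solve-∀
        pointwise : ∀ x → x ∈ ps k → on (τ x ≟ x) (+ 1) ≡ on (r ≟ x) (+ 1) + on (r′ ≟ x) (+ 1)
        pointwise x x∈ with τ x ≟ x
        ... | no ¬f = sym (cong₂ _+_ (on-no (r ≟ x) (λ { refl → ¬f (root⇒fixed r-range root) }))
                                     (on-no (r′ ≟ x) (λ { refl → ¬f (root⇒fixed r′-range root′) })))
        ... | yes f with fixed-points x (∈⇒InRange x∈) f
        ... | inj₁ refl = sym (cong₂ _+_ (on-yes (r ≟ r) refl) (on-no (r′ ≟ r) (λ e → r≢r′ (sym e))))
        ... | inj₂ refl = sym (cong₂ _+_ (on-no (r ≟ r′) r≢r′) (on-yes (r′ ≟ r′) refl))
        two : ∑ (ps k) (λ x → on (τ x ≟ x) (+ 1)) ≡ + 2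
        two = trans (∑-cong (ps k) pointwise) (trans (∑-+ (ps k) (λ x → on (r ≟ x) (+ 1)) (λ x → on (r′ ≟ x) (+ 1)))
          (cong₂ _+_ (∑-δ _≟_ (ps-unique k) r (∈-ps⁺ k (proj₁ r-range) r≤k) (λ _ → + 1))
                     (∑-δ _≟_ (ps-unique k) r′ (∈-ps⁺ k (proj₁ r′-range) (proj₂ r′-range)) (λ _ → + 1))))

      -- One root r brings the second root -1 - r and no further ones, so there are exactly two
      -- fixed points, whereas p - 2 = 3j requires a multiple of three.
      no-root-in-range : ⊥
      no-root-in-range = 3∤2 (+ j - proj₁ orbits) (trans (l₁ (+ j) (proj₁ orbits)) (trans (cong (λ v → v - + 2 - + 3 * proj₁ orbits) (sym +p≡))
        (trans (cong (λ v → + 2 + v - + 2 - + 3 * proj₁ orbits) (trans (proj₂ orbits) (cong (λ v → v + + 3 * proj₁ orbits) two))) (l₂ (proj₁ orbits)))))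
        where
        l₁ : ∀ j s → (j - s) * + 3 ≡ + 3 * j + + 2 - + 2 - + 3 * s
        l₁ = solve-∀
        l₂ : ∀ s → + 2 + (+ 2 + + 3 * s) - + 2 - + 3 * s ≡ + 2
        l₂ = solve-∀

    no-root : ∀ h → ¬ Root h
    no-root h d = go (h %ℕ p) (n%ℕd<d h p) reduced
      where
      q : ℤ
      q = h /ℕ p
      reduced : Root (+ (h %ℕ p))
      reduced = ∣-cast (trans (cong (λ v → v * v + v + + 1 - + p * (q * (+ 2 * + (h %ℕ p) + q * + p + + 1))) (a≡a%ℕn+[a/ℕn]*n h p)) (l₁ (+ (h %ℕ p)) q (+ p)))
        (∣m∣n⇒∣m-n d (∣m⇒∣m*n (q * (+ 2 * + (h %ℕ p) + q * + p + + 1)) ∣-refl))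
        where
        l₁ : ∀ r q p → (r + q * p) * (r + q * p) + (r + q * p) + + 1 - p * (q * (+ 2 * r + q * p + + 1)) ≡ r * r + r + + 1
        l₁ = solve-∀
      go : ∀ r → r < p → Root (+ r) → ⊥
      go zero    _   d = p∤1 d
      go (suc r) r<p d with suc r ≤? k
      ... | yes h = no-root-in-range (suc r) (s≤s z≤n , h) d
      ... | no ¬h with refl ← ≤-antisym (s≤s⁻¹ (s≤s⁻¹ r<p)) (s≤s⁻¹ (≰⇒> ¬h)) =
        p∤1 (∣-cast (l₁ (+ k)) (∣m∣n⇒∣m-n d (∣m⇒∣m*n (+ 1 + + k) ∣-refl)))
        where
        l₁ : ∀ k → (+ 1 + k) * (+ 1 + k) + (+ 1 + k) + + 1 - (+ 2 + k) * (+ 1 + k) ≡ + 1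
        l₁ = solve-∀

  -- Hecke relations for representation numbers and divisor sums

  on-inclusion-exclusion : {P Q R S : Set} (d : Dec P) (e : Dec Q) (f : Dec R) (g : Dec S) {w : ℤ} →
    (P → Q ⊎ R) → (P → Q → R → S) → (P → S → Q × R) →
    on d w ≡ on (d ×-dec e) w + on (d ×-dec f) w - on (d ×-dec g) w
  on-inclusion-exclusion (no _)  e f g _ _ _ = refl
  on-inclusion-exclusion {P} {Q} {R} {S} (yes p) e f g {w} h i j = go e f g
    where
    l₁ : ∀ w → w ≡ w + w - w
    l₁ = solve-∀
    l₂ : ∀ w → w ≡ w + + 0 - + 0
    l₂ = solve-∀
    l₃ : ∀ w → w ≡ + 0 + w - + 0
    l₃ = solve-∀
    go : (e : Dec Q) (f : Dec R) (g : Dec S) → w ≡ on (yes p ×-dec e) w + on (yes p ×-dec f) w - on (yes p ×-dec g) w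
    go (yes q) (yes r) (yes s) = l₁ w
    go (yes q) (yes r) (no ¬s) = ⊥-elim (¬s (i p q r))
    go (yes q) (no ¬r) (yes s) = ⊥-elim (¬r (proj₂ (j p s)))
    go (yes q) (no ¬r) (no ¬s) = l₂ w
    go (no ¬q) (yes r) (yes s) = ⊥-elim (¬q (proj₁ (j p s)))
    go (no ¬q) (yes r) (no ¬s) = l₃ w
    go (no ¬q) (no ¬r) g with h p
    ... | inj₁ q = ⊥-elim (¬q q)
    ... | inj₂ r = ⊥-elim (¬r r)

  module _ {A : Set} where

    ∑-inclusion-exclusion : (xs : List A) {P Q R S : A → Set} (P? : Decidable P) (Q? : Decidable Q) (R? : Decidable R) (S? : Decidable S) (w : A → ℤ) →
      (∀ x → P x → Q x ⊎ R x) → (∀ x → P x → Q x → R x → S x) → (∀ x → P x → S x → Q x × R x) →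
      ∑ xs (λ x → on (P? x) (w x)) ≡
      ∑ xs (λ x → on (P? x ×-dec Q? x) (w x)) + ∑ xs (λ x → on (P? x ×-dec R? x) (w x)) - ∑ xs (λ x → on (P? x ×-dec S? x) (w x))
    ∑-inclusion-exclusion xs P? Q? R? S? w h i j = trans
      (∑-cong′ xs (λ x → trans (on-inclusion-exclusion (P? x) (Q? x) (R? x) (S? x) (h x) (i x) (j x))
        (cong (λ v → on (P? x ×-dec Q? x) (w x) + on (P? x ×-dec R? x) (w x) + v) (sym (-1*i≡-i (on (P? x ×-dec S? x) (w x)))))))
      (trans (∑-+ xs (λ x → on (P? x ×-dec Q? x) (w x) + on (P? x ×-dec R? x) (w x)) (λ x → - + 1 * on (P? x ×-dec S? x) (w x)))
      (cong₂ _+_ (∑-+ xs (λ x → on (P? x ×-dec Q? x) (w x)) (λ x → on (P? x ×-dec R? x) (w x)))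
        (trans (∑-*ˡ xs (- + 1) (λ x → on (P? x ×-dec S? x) (w x))) (-1*i≡-i (∑ xs (λ x → on (P? x ×-dec S? x) (w x)))))))

  χ-mod : ∀ j n → χ (3 ℕ.* j ℕ.+ n) ≡ χ n
  χ-mod zero    n = refl
  χ-mod (suc j) n = trans (cong (λ k → χ (k ℕ.+ n)) (*-suc 3 j)) (χ-mod j n)

  mod-3 : ∀ n → (∃ λ j → n ≡ 3 ℕ.* j) ⊎ (∃ λ j → n ≡ 3 ℕ.* j ℕ.+ 1) ⊎ (∃ λ j → n ≡ 3 ℕ.* j ℕ.+ 2)
  mod-3 0 = inj₁ (0 , refl)
  mod-3 1 = inj₂ (inj₁ (0 , refl))
  mod-3 2 = inj₂ (inj₂ (0 , refl))
  mod-3 (suc (suc (suc n))) with mod-3 n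
  ... | inj₁ (j , refl)        = inj₁ (suc j , sym (*-suc 3 j))
  ... | inj₂ (inj₁ (j , refl)) = inj₂ (inj₁ (suc j , cong (ℕ._+ 1) (sym (*-suc 3 j))))
  ... | inj₂ (inj₂ (j , refl)) = inj₂ (inj₂ (suc j , cong (ℕ._+ 2) (sym (*-suc 3 j))))

  module HeckeR (k : ℕ) (p-prime : Prime (suc (suc k))) (B m : ℕ) (large : 2 ℕ.* (suc (suc k) ℕ.* m) ≤ B) where

    open Roots k p-prime

    private
      on-norm : ℤ × ℤ → Set
      on-norm = Norm (+ (p ℕ.* m))
      on-norm? : Decidable on-norm
      on-norm? = norm? (+ (p ℕ.* m))
      p∣norm : ∀ {x y} → on-norm (x , y) → + p ∣ norm x y
      p∣norm e = divides (+ m) (trans e (trans (pos-* p m) (ℤP.*-comm (+ p) (+ m))))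
      p∣square : ∀ x → + p ∣ x * x → + p ∣ x
      p∣square x d with p∣*⇒ x x d
      ... | inj₁ h = h
      ... | inj₂ h = h

    -- Modulo p the norm factors as (x - h y)(x - h′ y) with h′ = -1 - h, so every point counted
    -- lies on one of two lines. They meet only where p ∣ (2h + 1) y; as (2h + 1)² ≡ -3 and p ≠ 3,
    -- this forces p ∣ y and then p ∣ x.
    split : ¬ (p ≡ 3) → ∀ h → Root h → R B (p ℕ.* m) ≡ R B m + R B m - R/ B p m
    split p≢3 h root@(divides c eq) = trans
      (∑-inclusion-exclusion (grid B) on-norm? (onLine? (+ p) h) (onLine? (+ p) h′) (bothDivisible? (+ p)) (λ _ → + 1) either both lines)
      (cong₂ _-_ (cong₂ _+_ (line-count B p m large h c (trans (ℤP.*-comm (+ p) c) (sym eq))) (line-count B p m large h′ c (trans (ℤP.*-comm (+ p) c) (trans (sym eq) (conj h)))))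
        (divisible-count B p m large))
      where
      h′ : ℤ
      h′ = - + 1 - h
      conj : ∀ h → h * h + h + + 1 ≡ (- + 1 - h) * (- + 1 - h) + (- + 1 - h) + + 1
      conj = solve-∀
      either : ∀ q → on-norm q → OnLine (+ p) h q ⊎ OnLine (+ p) h′ q
      either (x , y) e = p∣*⇒ (x - h * y) (x - h′ * y) (∣-cast (l₁ x y h) (∣m∣n⇒∣m-n (p∣norm {x} {y} e) (∣m⇒∣m*n (y * y) root)))
        where
        l₁ : ∀ x y h → x * x + x * y + y * y - (h * h + h + + 1) * (y * y) ≡ (x - h * y) * (x - (- + 1 - h) * y)
        l₁ = solve-∀
      p∤2h+1 : ¬ (+ p ∣ + 2 * h + + 1)
      p∤2h+1 d = impossible k (ℕD.∣⇒≤ (∣⇒∣ᵤ p∣3)) p≢3 p∣3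
        where
        p∣3 : + p ∣ + 3
        p∣3 = ∣-cast (l₁ h) (∣m∣n⇒∣m-n (∣n⇒∣m*n (+ 4) root) (∣m⇒∣m*n (+ 2 * h + + 1) d))
          where
          l₁ : ∀ h → + 4 * (h * h + h + + 1) - (+ 2 * h + + 1) * (+ 2 * h + + 1) ≡ + 3
          l₁ = solve-∀
        impossible : ∀ k → suc (suc k) ≤ 3 → ¬ (suc (suc k) ≡ 3) → + suc (suc k) ∣ + 3 → ⊥
        impossible zero          _ _  (divides q e) = odd≢even (+ 1) q e
        impossible (suc zero)    _ ne _ = ne refl
        impossible (suc (suc k)) (s≤s (s≤s (s≤s ()))) _ _
      both : ∀ q → on-norm q → OnLine (+ p) h q → OnLine (+ p) h′ q → BothDivisible (+ p) q
      both (x , y) _ d d′ with p∣*⇒ (+ 2 * h + + 1) y (∣-cast (l₁ x y h) (∣m∣n⇒∣m-n d′ d))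
        where
        l₁ : ∀ x y h → x - (- + 1 - h) * y - (x - h * y) ≡ (+ 2 * h + + 1) * y
        l₁ = solve-∀
      ... | inj₁ d₂ = ⊥-elim (p∤2h+1 d₂)
      ... | inj₂ dy = ∣-cast (l₂ x y h) (∣m∣n⇒∣m+n d (∣n⇒∣m*n h dy)) , dy
        where
        l₂ : ∀ x y h → x - h * y + h * y ≡ x
        l₂ = solve-∀
      lines : ∀ q → on-norm q → BothDivisible (+ p) q → OnLine (+ p) h q × OnLine (+ p) h′ q
      lines (x , y) _ (dx , dy) = ∣m∣n⇒∣m-n dx (∣n⇒∣m*n h dy) , ∣m∣n⇒∣m-n dx (∣n⇒∣m*n h′ dy)

    -- If p divided the norm but not y, the quotient x/y would be a root of h² + h + 1 modulo p.
    -- Hence p ∣ y, then p ∣ x², and the point is p times another one.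
    inert : (∀ h → ¬ Root h) → R B (p ℕ.* m) ≡ R/ B p m
    inert no-root = trans (∑-cong′ (grid B) (λ q → on-cong (on-norm? q) (on-norm? q ×-dec bothDivisible? (+ p) q) (λ e → e , both q e) proj₁ (λ _ → refl)))
      (divisible-count B p m large)
      where
      inverse-mod : ∀ y → ¬ (+ p ∣ y) → ∃ λ b → + p ∣ b * y - + 1
      inverse-mod y ¬d with inverse (y %ℕ p) (n≢0⇒n>0 nonzero) (n%ℕd<d y p)
        where
        nonzero : y %ℕ p ≢ 0
        nonzero e = ¬d (divides (y /ℕ p) (trans (a≡a%ℕn+[a/ℕn]*n y p) (trans (cong (λ r → + r + y /ℕ p * + p) e) (+-identityˡ _))))
      ... | b , d = b , ∣-cast (trans (l₁ b (+ (y %ℕ p)) (y /ℕ p) (+ p)) (cong (λ v → b * v - + 1) (sym (a≡a%ℕn+[a/ℕn]*n y p))))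
        (∣m∣n⇒∣m+n d (divides (b * (y /ℕ p)) refl))
        where
        l₁ : ∀ b r q p → b * r - + 1 + b * q * p ≡ b * (r + q * p) - + 1
        l₁ = solve-∀
      both : ∀ q → on-norm q → BothDivisible (+ p) q
      both (x , y) e with (+ p) ∣? y
      ... | yes dy = p∣square x (∣-cast (l₁ x y) (∣m∣n⇒∣m-n (p∣norm {x} {y} e) (∣n⇒∣m*n (x + y) dy))) , dy
        where
        l₁ : ∀ x y → x * x + x * y + y * y - (x + y) * y ≡ x * x
        l₁ = solve-∀
      ... | no ¬dy with inverse-mod y ¬dy
      ... | b , d = ⊥-elim (no-root (x * b) (∣-cast (l₁ x y b)
        (∣m∣n⇒∣m-n (∣n⇒∣m*n (b * b) (p∣norm {x} {y} e)) (∣m⇒∣m*n (x * b + b * y + + 1) d))))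
        where
        l₁ : ∀ x y b → b * b * (x * x + x * y + y * y) - (b * y - + 1) * (x * b + b * y + + 1) ≡ x * b * (x * b) + x * b + + 1
        l₁ = solve-∀

    -- Modulo 3 the norm is the square (x - y)², so the two lines collapse to the single line h = 1,
    -- for which 1 + 1 + 1 = 3 · 1 gives c = 1.
    ramified : p ≡ 3 → R B (p ℕ.* m) ≡ R B m
    ramified p≡3 = trans (∑-cong′ (grid B) (λ q → on-cong (on-norm? q) (on-norm? q ×-dec onLine? (+ p) (+ 1) q) (λ e → e , line q e) proj₁ (λ _ → refl)))
      (line-count B p m large (+ 1) (+ 1) (trans (ℤP.*-identityʳ (+ p)) (cong +_ p≡3)))
      where
      line : ∀ q → on-norm q → OnLine (+ p) (+ 1) q
      line (x , y) e = p∣square (x - + 1 * y) (∣-cast (l₁ x y)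
        (∣m∣n⇒∣m-n (p∣norm {x} {y} e) (subst (λ v → + p ∣ v * (x * y)) (cong +_ p≡3) (∣m⇒∣m*n (x * y) ∣-refl))))
        where
        l₁ : ∀ x y → x * x + x * y + y * y - + 3 * (x * y) ≡ (x - + 1 * y) * (x - + 1 * y)
        l₁ = solve-∀

    3∣p⇒p≡3 : ∀ j → p ≡ 3 ℕ.* j → p ≡ 3
    3∣p⇒p≡3 j e with prime⇒irreducible p-prime (ℕD.divides j (trans e (ℕP.*-comm 3 j)))
    ... | inj₂ 3≡p = sym 3≡p

    hecke : R B (p ℕ.* m) ≡ (+ 1 + χ p) * R B m - χ p * R/ B p m
    hecke with mod-3 p
    ... | inj₁ (j , e) = trans (ramified (3∣p⇒p≡3 j e)) (trans (l₁ (R B m) (R/ B p m)) (cong (λ c → (+ 1 + c) * R B m - c * R/ B p m) (sym χp)))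
      where
      χp : χ p ≡ + 0
      χp = cong χ (3∣p⇒p≡3 j e)
      l₁ : ∀ r s → r ≡ (+ 1 + + 0) * r - + 0 * s
      l₁ = solve-∀
    ... | inj₂ (inj₁ (j , e)) = trans (split p≢3 (proj₁ root) (proj₂ root)) (trans (l₁ (R B m) (R/ B p m)) (cong (λ c → (+ 1 + c) * R B m - c * R/ B p m) (sym χp)))
      where
      root : ∃ Root
      root = root-exists j e
      χp : χ p ≡ + 1
      χp = trans (cong χ e) (χ-mod j 1)
      p≢3 : ¬ (p ≡ 3)
      p≢3 p≡3 with trans (sym χp) (cong χ p≡3)
      ... | ()
      l₁ : ∀ r s → r + r - s ≡ (+ 1 + + 1) * r - + 1 * s
      l₁ = solve-∀
    ... | inj₂ (inj₂ (j , e)) = trans (inert (NoRoots.no-root k p-prime j e)) (trans (l₁ (R B m) (R/ B p m)) (cong (λ c → (+ 1 + c) * R B m - c * R/ B p m) (sym χp)))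
      where
      χp : χ p ≡ - + 1
      χp = trans (cong χ e) (χ-mod j 2)
      l₁ : ∀ r s → s ≡ (+ 1 + - + 1) * r - - + 1 * s
      l₁ = solve-∀

  χ-double : ∀ n → χ (n ℕ.+ n) ≡ - χ n
  χ-double 0 = refl
  χ-double 1 = refl
  χ-double 2 = refl
  χ-double (suc (suc (suc n))) = trans (cong χ (cong (λ k → suc (suc (suc k))) (trans (+-suc n _) (cong suc (trans (+-suc n _) (cong suc (+-suc n n))))))) (χ-double n)

  χ-* : ∀ m n → χ (m ℕ.* n) ≡ χ m * χ n
  χ-* 0 n = refl
  χ-* 1 n = trans (cong χ (ℕP.+-identityʳ n)) (sym (ℤP.*-identityˡ (χ n)))
  χ-* 2 n = trans (cong (λ k → χ (n ℕ.+ k)) (ℕP.+-identityʳ n)) (trans (χ-double n) (sym (-1*i≡-i (χ n))))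
  χ-* (suc (suc (suc m))) n = trans (cong χ (l₁ m n)) (trans (χ-mod n (m ℕ.* n)) (χ-* m n))
    where
    l₁ : ∀ m n → (3 ℕ.+ m) ℕ.* n ≡ 3 ℕ.* n ℕ.+ m ℕ.* n
    l₁ = ℕSolver.solve-∀

  -- The counterpart of `R/`: the divisor sum at m / p, and 0 when p does not divide m.
  A/ : ℕ → ℕ → ℕ → ℤ
  A/ C p m = ∑ (pairs C) (λ (d , e) → on (p ℕ.* (d ℕ.* e) ≟ m) (χ d))

  module HeckeA (p : ℕ) (p-prime : Prime p) (C m : ℕ) (large : p ℕ.* m ≤ C) where

    private
      instance
        p-nonZero : ℕ.NonZero p
        p-nonZero = prime⇒nonZero p-prime

      Factors : ℕ → ℕ × ℕ → Set
      Factors k (d , e) = d ℕ.* e ≡ k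
      factors? : ∀ k → Decidable (Factors k)
      factors? k (d , e) = d ℕ.* e ≟ k
      Left Right Both : ℕ × ℕ → Set
      Left  (d , e) = p ℕD.∣ d
      Right (d , e) = p ℕD.∣ e
      Both  (d , e) = (p ℕD.∣ d) × (p ℕD.∣ e)
      left? : Decidable Left
      left? (d , e) = p ℕD.∣? d
      right? : Decidable Right
      right? (d , e) = p ℕD.∣? e
      both? : Decidable Both
      both? (d , e) = (p ℕD.∣? d) ×-dec (p ℕD.∣? e)

      χ₁ : ℕ × ℕ → ℤ
      χ₁ (d , e) = χ d

      χ-multiple : ∀ q → χ (q ℕ.* p) ≡ χ p * χ q
      χ-multiple q = trans (χ-* q p) (ℤP.*-comm (χ q) (χ p))

      positive : ∀ {d e} → (d , e) ∈ pairs C → 1 ≤ d × 1 ≤ e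
      positive h = let (a , _) , (b , _) = ∈-pairs⁻ C h in a , b
      positive-factor : ∀ {q} → 1 ≤ q ℕ.* p → 1 ≤ q
      positive-factor {suc q} _ = s≤s z≤n
      positive-multiple : ∀ {q} → 1 ≤ q → 1 ≤ q ℕ.* p
      positive-multiple {q} h = ≤-trans h (m≤m*n q p)
      m≤C : m ≤ C
      m≤C = ≤-trans (m≤n*m m p) large

      eqˡ : ∀ q e p → q ℕ.* p ℕ.* e ≡ p ℕ.* (q ℕ.* e)
      eqˡ = ℕSolver.solve-∀
      eqʳ : ∀ d q p → d ℕ.* (q ℕ.* p) ≡ p ℕ.* (d ℕ.* q)
      eqʳ = ℕSolver.solve-∀
      eq² : ∀ q r p → q ℕ.* p ℕ.* (r ℕ.* p) ≡ p ℕ.* (p ℕ.* (q ℕ.* r))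
      eq² = ℕSolver.solve-∀

      left : ∑ (pairs C) (λ x → on (factors? (p ℕ.* m) x ×-dec left? x) (χ₁ x)) ≡ χ p * A C m
      left = trans (∑-bijection _≟ℕ²_ _≟ℕ²_ (pairs-unique C) (pairs-unique C) (λ x → factors? (p ℕ.* m) x ×-dec left? x) (factors? m) χ₁ (λ x → χ p * χ₁ x)
          (λ (q , e) → q ℕ.* p , e)
          (λ (q , e) q∈ h → let a , b = positive q∈
                                s = trans (eqˡ q e p) (cong (p ℕ.*_) h) in
            ∈-pairs⁺ C (positive-multiple a) b (≤-trans (≤-reflexive s) large) , (s , ℕD.divides q refl) , χ-multiple q)
          (λ (q , e) (q′ , e′) _ _ eq → cong₂ _,_ (ℕP.*-cancelʳ-≡ q q′ p (cong proj₁ eq)) (cong proj₂ eq))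
          (λ { (d , e) d∈ (h , ℕD.divides q refl) → let a , b = positive d∈
                                                        s = ℕP.*-cancelˡ-≡ (q ℕ.* e) m p (trans (sym (eqˡ q e p)) h) in
            (q , e) , ∈-pairs⁺ C (positive-factor a) b (≤-trans (≤-reflexive s) m≤C) , s , refl }))
        (trans (∑-cong′ (pairs C) (λ x → on-*ˡ (factors? m x) (χ p) (χ₁ x))) (∑-*ˡ (pairs C) (χ p) (λ x → on (factors? m x) (χ₁ x))))

      right : ∑ (pairs C) (λ x → on (factors? (p ℕ.* m) x ×-dec right? x) (χ₁ x)) ≡ A C m
      right = ∑-bijection _≟ℕ²_ _≟ℕ²_ (pairs-unique C) (pairs-unique C) (λ x → factors? (p ℕ.* m) x ×-dec right? x) (factors? m) χ₁ χ₁
          (λ (d , q) → d , q ℕ.* p)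
          (λ (d , q) q∈ h → let a , b = positive q∈
                                s = trans (eqʳ d q p) (cong (p ℕ.*_) h) in
            ∈-pairs⁺ C a (positive-multiple b) (≤-trans (≤-reflexive s) large) , (s , ℕD.divides q refl) , refl)
          (λ (d , q) (d′ , q′) _ _ eq → cong₂ _,_ (cong proj₁ eq) (ℕP.*-cancelʳ-≡ q q′ p (cong proj₂ eq)))
          (λ { (d , e) d∈ (h , ℕD.divides q refl) → let a , b = positive d∈
                                                        s = ℕP.*-cancelˡ-≡ (d ℕ.* q) m p (trans (sym (eqʳ d q p)) h) in
            (d , q) , ∈-pairs⁺ C a (positive-factor b) (≤-trans (≤-reflexive s) m≤C) , s , refl })

      both : ∑ (pairs C) (λ x → on (factors? (p ℕ.* m) x ×-dec both? x) (χ₁ x)) ≡ χ p * A/ C p m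
      both = trans (∑-bijection _≟ℕ²_ _≟ℕ²_ (pairs-unique C) (pairs-unique C) (λ x → factors? (p ℕ.* m) x ×-dec both? x) (λ (q , r) → p ℕ.* (q ℕ.* r) ≟ m) χ₁ (λ x → χ p * χ₁ x)
          (λ (q , r) → q ℕ.* p , r ℕ.* p)
          (λ (q , r) q∈ h → let a , b = positive q∈
                                s = trans (eq² q r p) (cong (p ℕ.*_) h) in
            ∈-pairs⁺ C (positive-multiple a) (positive-multiple b) (≤-trans (≤-reflexive s) large) , (s , ℕD.divides q refl , ℕD.divides r refl) , χ-multiple q)
          (λ (q , r) (q′ , r′) _ _ eq → cong₂ _,_ (ℕP.*-cancelʳ-≡ q q′ p (cong proj₁ eq)) (ℕP.*-cancelʳ-≡ r r′ p (cong proj₂ eq)))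
          (λ { (d , e) d∈ (h , ℕD.divides q refl , ℕD.divides r refl) → let a , b = positive d∈
                                                                            s = ℕP.*-cancelˡ-≡ (p ℕ.* (q ℕ.* r)) m p (trans (sym (eq² q r p)) h) in
            (q , r) , ∈-pairs⁺ C (positive-factor a) (positive-factor b) (≤-trans (m≤n*m (q ℕ.* r) p) (≤-trans (≤-reflexive s) m≤C)) , s , refl }))
        (trans (∑-cong′ (pairs C) (λ (q , r) → on-*ˡ (p ℕ.* (q ℕ.* r) ≟ m) (χ p) (χ q))) (∑-*ˡ (pairs C) (χ p) (λ (q , r) → on (p ℕ.* (q ℕ.* r) ≟ m) (χ q))))

    -- In d e = p m the prime divides d or e. The first case contributes χ(p) A(m), the second A(m),
    -- and the overlap χ(p) A(m/p), all by multiplicativity of χ.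
    hecke : A C (p ℕ.* m) ≡ (+ 1 + χ p) * A C m - χ p * A/ C p m
    hecke = trans (∑-inclusion-exclusion (pairs C) (factors? (p ℕ.* m)) left? right? both? χ₁
        (λ (d , e) h → euclidsLemma d e p-prime (ℕD.divides m (trans h (ℕP.*-comm p m)))) (λ _ _ a b → a , b) (λ _ _ ab → ab))
      (trans (cong₂ _-_ (cong₂ _+_ left right) both) (l₁ (χ p) (A C m) (χ p * A/ C p m)))
      where
      l₁ : ∀ c x y → c * x + x - y ≡ (+ 1 + c) * x - y
      l₁ = solve-∀

  -- Comparison of representation numbers with divisor sums

  R-independent : ∀ B B′ m → 2 ℕ.* m ≤ B → 2 ℕ.* m ≤ B′ → R B m ≡ R B′ m
  R-independent B B′ m h h′ = ∑-bijection _≟²_ _≟²_ (grid-unique B) (grid-unique B′) (norm? (+ m)) (norm? (+ m)) (λ _ → + 1) (λ _ → + 1) id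
    (λ (x , y) _ e → ∈-grid⁺ B (x , y) (norm-bounded x y e h) , e , refl)
    (λ _ _ _ _ e → e)
    (λ (x , y) _ e → (x , y) , ∈-grid⁺ B′ (x , y) (norm-bounded x y e h′) , e , refl)

  A-independent : ∀ C C′ m → m ≤ C → m ≤ C′ → A C m ≡ A C′ m
  A-independent C C′ m h h′ = ∑-bijection _≟ℕ²_ _≟ℕ²_ (pairs-unique C) (pairs-unique C′)
    (λ (d , e) → d ℕ.* e ≟ m) (λ (d , e) → d ℕ.* e ≟ m) (λ (d , e) → χ d) (λ (d , e) → χ d) id
    (λ (d , e) d∈ eq → let (a , _) , (b , _) = ∈-pairs⁻ C′ d∈ in ∈-pairs⁺ C a b (≤-trans (≤-reflexive eq) h) , eq , refl)
    (λ _ _ _ _ e → e)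
    (λ (d , e) d∈ eq → let (a , _) , (b , _) = ∈-pairs⁻ C d∈ in (d , e) , ∈-pairs⁺ C′ a b (≤-trans (≤-reflexive eq) h′) , eq , refl)

  prime-factor : ∀ m → 2 ≤ m → ∃ λ k → ∃ λ n → Prime (suc (suc k)) × m ≡ suc (suc k) ℕ.* n
  prime-factor (suc zero) (s≤s ())
  prime-factor (suc (suc m)) _ with factorise (suc (suc m))
  ... | record { factors = []     ; isFactorisation = () ; factorsPrime = _ }
  ... | record { factors = q ∷ qs ; isFactorisation = e ; factorsPrime = q-prime All.∷ _ } = go q q-prime e
    where
    go : ∀ q → Prime q → suc (suc m) ≡ q ℕ.* product qs → _
    go zero          q-prime _ = ⊥-elim (¬prime[0] q-prime)
    go (suc zero)    q-prime _ = ⊥-elim (¬prime[1] q-prime)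
    go (suc (suc k)) q-prime e = k , product qs , q-prime , e

  -- Both sides satisfy the same recursion over the prime factors of m.
  R≡6A : ∀ n B C m → m ≤ n → 1 ≤ m → 2 ℕ.* m ≤ B → m ≤ C → R B m ≡ + 6 * A C m
  -- The constant 6 is the number of units, the elements of norm 1. After moving to the concrete
  -- cutoffs 2 and 1 this case holds by computation.
  R≡6A n B C 1 _ _ h h′ = trans (R-independent B 2 1 h ≤-refl) (cong (λ v → + 6 * v) (A-independent 1 C 1 ≤-refl h′))
  R≡6A (suc n) B C m@(suc (suc _)) m≤n _ h h′ with prime-factor m (s≤s (s≤s z≤n))
  ... | k , m′ , p-prime , e = begin
    R B m                                              ≡⟨ cong (R B) e ⟩
    R B (p ℕ.* m′)                                     ≡⟨ HeckeR.hecke k p-prime B m′ hB ⟩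
    (+ 1 + χ p) * R B m′ - χ p * R/ B p m′             ≡⟨ cong₂ (λ x y → (+ 1 + χ p) * x - χ p * y) (R≡6A n B C m′ m′≤n 1≤m′ 2m′≤B m′≤C) quotient ⟩
    (+ 1 + χ p) * (+ 6 * A C m′) - χ p * (+ 6 * A/ C p m′) ≡⟨ l₁ (χ p) (A C m′) (A/ C p m′) ⟩
    + 6 * ((+ 1 + χ p) * A C m′ - χ p * A/ C p m′)     ≡⟨ cong (λ v → + 6 * v) (sym (HeckeA.hecke p p-prime C m′ hC)) ⟩
    + 6 * A C (p ℕ.* m′)                               ≡⟨ cong (λ v → + 6 * A C v) (sym e) ⟩
    + 6 * A C m                                        ∎
    where
    open ≡-Reasoning
    p : ℕ
    p = suc (suc k)
    l₁ : ∀ c x y → (+ 1 + c) * (+ 6 * x) - c * (+ 6 * y) ≡ + 6 * ((+ 1 + c) * x - c * y)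
    l₁ = solve-∀
    hB : 2 ℕ.* (p ℕ.* m′) ≤ B
    hB = subst (λ v → 2 ℕ.* v ≤ B) e h
    hC : p ℕ.* m′ ≤ C
    hC = subst (_≤ C) e h′
    m′≤pm′ : m′ ≤ p ℕ.* m′
    m′≤pm′ = m≤n*m m′ p
    2m′≤B : 2 ℕ.* m′ ≤ B
    2m′≤B = ≤-trans (*-monoʳ-≤ 2 m′≤pm′) hB
    m′≤C : m′ ≤ C
    m′≤C = ≤-trans m′≤pm′ hC
    1≤m′ : 1 ≤ m′
    1≤m′ = n≢0⇒n>0 (λ m′≡0 → absurd (trans e (trans (cong (p ℕ.*_) m′≡0) (ℕP.*-zeroʳ p))))
      where
      absurd : ¬ (m ≡ 0)
      absurd ()
    m′<m : m′ < m
    m′<m = subst (m′ <_) (sym e) (+-mono-≤ 1≤m′ (m≤m+n m′ (k ℕ.* m′)))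
    m′≤n : m′ ≤ n
    m′≤n = s≤s⁻¹ (≤-trans m′<m m≤n)
    quotient : R/ B p m′ ≡ + 6 * A/ C p m′
    quotient with p ℕD.∣? m′
    ... | yes (ℕD.divides q m′≡) = trans (∑-cong′ (grid B) (λ x → on-cong (+ p * norm² x ℤ.≟ + m′) (norm? (+ q) x) (to x) (from x) (λ _ → refl)))
      (trans (R≡6A n B C q (≤-trans q≤m′ m′≤n) 1≤q (≤-trans (*-monoʳ-≤ 2 q≤m′) 2m′≤B) (≤-trans q≤m′ m′≤C))
      (cong (λ v → + 6 * v) (∑-cong′ (pairs C) (λ (d , e) → on-cong (d ℕ.* e ≟ q) (p ℕ.* (d ℕ.* e) ≟ m′)
        (λ h → trans (cong (p ℕ.*_) h) (trans (ℕP.*-comm p q) (sym m′≡)))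
        (λ h → ℕP.*-cancelˡ-≡ (d ℕ.* e) q p (trans h (trans m′≡ (ℕP.*-comm q p)))) (λ _ → refl)))))
      where
      q≤m′ : q ≤ m′
      q≤m′ = subst (q ≤_) (sym m′≡) (m≤m*n q p)
      1≤q : 1 ≤ q
      1≤q = n≢0⇒n>0 (λ { refl → <-irrefl refl (subst (1 ≤_) m′≡ 1≤m′) })
      to : ∀ x → + p * norm² x ≡ + m′ → Norm (+ q) x
      to x h = ℤP.*-cancelˡ-≡ (+ p) (norm² x) (+ q) (trans h (trans (cong +_ (trans m′≡ (ℕP.*-comm q p))) (pos-* p q)))
      from : ∀ x → Norm (+ q) x → + p * norm² x ≡ + m′
      from x h = trans (cong (λ v → + p * v) h) (trans (sym (pos-* p q)) (cong +_ (trans (ℕP.*-comm p q) (sym m′≡))))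
    ... | no ¬d = trans (∑-0 (grid B) (λ x _ → on-no (+ p * norm² x ℤ.≟ + m′) (λ h → ¬d (∣⇒∣ᵤ (divides (norm² x) (trans (sym h) (ℤP.*-comm (+ p) (norm² x))))))))
      (sym (trans (cong (λ v → + 6 * v) (∑-0 (pairs C) (λ (d , e) _ → on-no (p ℕ.* (d ℕ.* e) ≟ m′) (λ h → ¬d (ℕD.divides (d ℕ.* e) (trans (sym h) (ℕP.*-comm p (d ℕ.* e)))))))) refl))

  -- From the norm form to x² + 3z²

  EvenSnd : ℤ × ℤ → Set
  EvenSnd (x , y) = + 2 ∣ y
  evenSnd? : Decidable EvenSnd
  evenSnd? (x , y) = (+ 2) ∣? y

  norm-even⇒ : ∀ x y → + 2 ∣ norm x y → (+ 2 ∣ x) × (+ 2 ∣ y)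
  norm-even⇒ x y (divides j e) with parity x | parity y
  ... | inj₁ (k , refl) | inj₁ (l , refl) = divides k refl , divides l refl
  ... | inj₁ (k , refl) | inj₂ (l , refl) = ⊥-elim (odd≢even (+ 2 * (k * k) + k * (l * + 2 + + 1) + + 2 * (l * l) + + 2 * l) j (trans (lemma k l) e))
    where
    lemma : ∀ k l → (+ 2 * (k * k) + k * (l * + 2 + + 1) + + 2 * (l * l) + + 2 * l) * + 2 + + 1 ≡
      k * + 2 * (k * + 2) + k * + 2 * (l * + 2 + + 1) + (l * + 2 + + 1) * (l * + 2 + + 1)
    lemma = solve-∀
  ... | inj₂ (k , refl) | inj₁ (l , refl) = ⊥-elim (odd≢even (+ 2 * (k * k) + + 2 * k + (k * + 2 + + 1) * l + + 2 * (l * l)) j (trans (lemma k l) e))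
    where
    lemma : ∀ k l → (+ 2 * (k * k) + + 2 * k + (k * + 2 + + 1) * l + + 2 * (l * l)) * + 2 + + 1 ≡
      (k * + 2 + + 1) * (k * + 2 + + 1) + (k * + 2 + + 1) * (l * + 2) + l * + 2 * (l * + 2)
    lemma = solve-∀
  ... | inj₂ (k , refl) | inj₂ (l , refl) = ⊥-elim (odd≢even (+ 2 * (k * k) + + 3 * k + + 2 * (k * l) + + 3 * l + + 2 * (l * l) + + 1) j (trans (lemma k l) e))
    where
    lemma : ∀ k l → (+ 2 * (k * k) + + 3 * k + + 2 * (k * l) + + 3 * l + + 2 * (l * l) + + 1) * + 2 + + 1 ≡
      (k * + 2 + + 1) * (k * + 2 + + 1) + (k * + 2 + + 1) * (l * + 2 + + 1) + (l * + 2 + + 1) * (l * + 2 + + 1)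
    lemma = solve-∀

  norm-even⇐ : ∀ x y → + 2 ∣ x → + 2 ∣ y → + 2 ∣ norm x y
  norm-even⇐ x y dx dy = ∣m∣n⇒∣m+n (∣m∣n⇒∣m+n (∣m⇒∣m*n x dx) (∣m⇒∣m*n y dx)) (∣m⇒∣m*n y dy)

  module _ (N i : ℕ) (i≤N : i ≤ N) where

    private
      B : ℕ
      B = 2 ℕ.* N
      2i≤B : 2 ℕ.* i ≤ B
      2i≤B = *-monoʳ-≤ 2 i≤N
      n? : Decidable (Norm (+ i))
      n? = norm? (+ i)

    -- X + Z√-3 equals (X - Z) + 2Z (1 + √-3)/2, so X² + 3Z² is the norm form restricted to the
    -- sublattice of even second coordinates.
    even-snd-count : count B (n? ∩? evenSnd?) ≡ U N i
    even-snd-count = ∑-bijection _≟²_ _≟²_ (grid-unique B) (grid-unique N) (n? ∩? evenSnd?) (λ p → form p ≟ i) (λ _ → + 1) (λ _ → + 1) ψ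
      (λ (X , Z) _ e → let e′ = trans (sym (same X Z)) (cong +_ e) in
        ∈-grid⁺ B (ψ (X , Z)) (norm-bounded (X - Z) (Z * + 2) e′ 2i≤B) , (e′ , divides Z refl) , refl)
      (λ (X , Z) (X′ , Z′) _ _ e → let Z≡ = ℤP.*-cancelʳ-≡ Z Z′ (+ 2) (cong proj₂ e) in
        cong₂ _,_ (+-cancelʳ-≡ (- Z) X X′ (trans (cong proj₁ e) (cong (λ v → X′ - v) (sym Z≡)))) Z≡)
      onto
      where
      ψ : ℤ × ℤ → ℤ × ℤ
      ψ (X , Z) = X - Z , Z * + 2
      same : ∀ X Z → + form (X , Z) ≡ norm (X - Z) (Z * + 2)
      same X Z = trans (+form X Z) (lemma X Z)
        where
        lemma : ∀ X Z → X * X + + 3 * (Z * Z) ≡ (X - Z) * (X - Z) + (X - Z) * (Z * + 2) + Z * + 2 * (Z * + 2)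
        lemma = solve-∀
      onto : ∀ q → q ∈ grid B → Norm (+ i) q × EvenSnd q → ∃ λ p → p ∈ grid N × form p ≡ i × ψ p ≡ q
      onto (x , _) _ (e , divides Z refl) = (x + Z , Z) , ∈-grid⁺ N (x + Z , Z) (form-bounded (x + Z , Z) f i≤N) , f , cong (_, Z * + 2) (back x Z)
        where
        back : ∀ x Z → x + Z - Z ≡ x
        back = solve-∀
        f : form (x + Z , Z) ≡ i
        f = +-injective (trans (same (x + Z) Z) (trans (cong (λ v → norm v (Z * + 2)) (back x Z)) e))

    -- An even norm forces both coordinates to be even, so all representations already lie in that
    -- sublattice.
    U-even : + 2 ∣ + i → U N i ≡ R B i
    U-even h = trans (sym even-snd-count) (sym (∑-cong′ (grid B) (λ q → on-cong (n? q) (n? q ×-dec evenSnd? q)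
      (λ e → e , proj₂ (norm-even⇒ (proj₁ q) (proj₂ q) (∣-cast (sym e) h))) proj₁ (λ _ → refl))))

    -- When the norm is odd, exactly one of x, y, x + y is even. The automorphisms (x, y) ↦ (y, x)
    -- and (x, y) ↦ (x + y, -y) permute the three cases, and `U` counts one of them.
    U-odd : ¬ + 2 ∣ + i → R B i ≡ + 3 * U N i
    U-odd h = begin
      R B i
        ≡⟨ ∑-split (grid B) n? evenSnd? (λ q → ¬? (evenSnd? q)) (λ _ → + 1) (λ q _ → yes-or-no (evenSnd? q)) (λ _ _ a b → b a) ⟩
      count B (n? ∩? evenSnd?) + count B (λ q → n? q ×-dec ¬? (evenSnd? q))
        ≡⟨ cong (λ v → count B (n? ∩? evenSnd?) + v) (∑-split (grid B) (λ q → n? q ×-dec ¬? (evenSnd? q)) evenFst? evenSum? (λ _ → + 1)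
             (λ (x , y) (_ , oy) → first-or-sum x y oy) (λ (x , y) (e , _) ex es → not-both-even x y e ex (∣-cancel-+ y es ex))) ⟩
      count B (n? ∩? evenSnd?) + (count B (λ q → (n? q ×-dec ¬? (evenSnd? q)) ×-dec evenFst? q) + count B (λ q → (n? q ×-dec ¬? (evenSnd? q)) ×-dec evenSum? q))
        ≡⟨ cong₂ (λ a b → count B (n? ∩? evenSnd?) + (a + b))
             (∑-cong′ (grid B) (λ (x , y) → on-cong ((n? (x , y) ×-dec ¬? (evenSnd? (x , y))) ×-dec evenFst? (x , y)) (n? (x , y) ×-dec evenFst? (x , y))
               (λ ((e , _) , ex) → e , ex) (λ (e , ex) → (e , (λ ey → not-both-even x y e ex ey)) , ex) (λ _ → refl)))
             (∑-cong′ (grid B) (λ (x , y) → on-cong ((n? (x , y) ×-dec ¬? (evenSnd? (x , y))) ×-dec evenSum? (x , y)) (n? (x , y) ×-dec evenSum? (x , y))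
               (λ ((e , _) , es) → e , es) (λ (e , es) → (e , (λ ey → not-both-even x y e (∣-cancel-+ x (∣-cast (ℤP.+-comm x y) es) ey) ey)) , es) (λ _ → refl))) ⟩
      count B (n? ∩? evenSnd?) + (count B (n? ∩? evenFst?) + count B (n? ∩? evenSum?))
        ≡⟨ cong₂ (λ a b → count B (n? ∩? evenSnd?) + (a + b)) fst≡snd (trans sum≡fst fst≡snd) ⟩
      count B (n? ∩? evenSnd?) + (count B (n? ∩? evenSnd?) + count B (n? ∩? evenSnd?))
        ≡⟨ cong (λ v → v + (v + v)) even-snd-count ⟩
      U N i + (U N i + U N i)
        ≡⟨ lemma (U N i) ⟩
      + 3 * U N i ∎
      where
      open ≡-Reasoning
      lemma : ∀ u → u + (u + u) ≡ + 3 * u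
      lemma = solve-∀
      not-both-even : ∀ x y → norm x y ≡ + i → + 2 ∣ x → + 2 ∣ y → ⊥
      not-both-even x y e ex ey = h (∣-cast e (norm-even⇐ x y ex ey))
      first-or-sum : ∀ x y → ¬ + 2 ∣ y → (+ 2 ∣ x) ⊎ (+ 2 ∣ x + y)
      first-or-sum x y oy with (+ 2) ∣? x
      ... | yes ex = inj₁ ex
      ... | no ox  = inj₂ (odd-+ ox oy)
      norm-swap : ∀ x y → norm y x ≡ norm x y
      norm-swap = swapped
        where
        swapped : ∀ x y → y * y + y * x + x * x ≡ x * x + x * y + y * y
        swapped = solve-∀
      fst≡snd : count B (n? ∩? evenFst?) ≡ count B (n? ∩? evenSnd?)
      fst≡snd = grid-bijection B (n? ∩? evenFst?) (n? ∩? evenSnd?) (λ _ → + 1) (λ _ → + 1) (λ (x , y) → y , x)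
        (λ (x , y) (e , d) → let e′ = trans (norm-swap x y) e in norm-bounded y x e′ 2i≤B , (e′ , d) , refl)
        (λ { (x , y) (x′ , y′) _ _ refl → refl })
        (λ (x , y) (e , d) → let e′ = trans (norm-swap x y) e in (y , x) , norm-bounded y x e′ 2i≤B , (e′ , d) , refl)
      sum≡fst : count B (n? ∩? evenSum?) ≡ count B (n? ∩? evenFst?)
      sum≡fst = grid-bijection B (n? ∩? evenSum?) (n? ∩? evenFst?) (λ _ → + 1) (λ _ → + 1) (λ (x , y) → x + y , - y)
        (λ (x , y) (e , d) → let e′ = trans (l₁ x y) e in norm-bounded (x + y) (- y) e′ 2i≤B , (e′ , ∣-cast (l₂ x y) d) , refl)
        (λ (x , y) (x′ , y′) _ _ e → let y≡ = neg-injective (cong proj₂ e) in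
          cong₂ _,_ (+-cancelʳ-≡ y x x′ (trans (cong proj₁ e) (cong (λ v → x′ + v) (sym y≡)))) y≡)
        (λ (x , y) (e , d) → let e′ = trans (l₁ x y) e in (x + y , - y) , norm-bounded (x + y) (- y) e′ 2i≤B , (e′ , d) , cong₂ _,_ (sym (l₂ x y)) (neg-involutive y))
        where
        l₁ : ∀ x y → (x + y) * (x + y) + (x + y) * - y + - y * - y ≡ x * x + x * y + y * y
        l₁ = solve-∀
        l₂ : ∀ x y → x ≡ x + y + - y
        l₂ = solve-∀

  -- The coefficient of U² at an odd index

  A-zero : ∀ C → A C 0 ≡ + 0
  A-zero C = ∑-0 (pairs C) (λ (d , e) m → on-no (d ℕ.* e ≟ 0) (λ h → let (a , _) , (b , _) = ∈-pairs⁻ C m in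
    <-irrefl (sym h) (*-mono-≤ a b)))

  U²-coefficient : ∀ N → 1 ≤ N → ¬ + 2 ∣ + N → (U N ⊗ U N) N ≡ + 12 * (A N ⊗ A N) N + + 4 * A N N
  U²-coefficient N 1≤N odd = begin
    (U N ⊗ U N) N
      ≡⟨ ⊗-∑ (U N) (U N) N ⟩
    ∑ (ns N) (λ i → U N i * U N (N ∸ i))
      ≡⟨ ∑-cong (ns N) (λ i i∈ → pointwise i (∈-ns⁻ N i∈)) ⟩
    -- At i = 0 and i = N the product A(i) A(N - i) vanishes while one factor `U` equals 1; the
    -- correction `c = 2A(N)` stands for these two ends.
    ∑ (ns N) (λ i → + 12 * (A N i * A N (N ∸ i)) + (on (0 ≟ i) c + on (N ≟ i) c))
      ≡⟨ trans (∑-+ (ns N) (λ i → + 12 * (A N i * A N (N ∸ i))) (λ i → on (0 ≟ i) c + on (N ≟ i) c)) (cong₂ _+_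
           (trans (∑-*ˡ (ns N) (+ 12) (λ i → A N i * A N (N ∸ i))) (cong (λ v → + 12 * v) (sym (⊗-∑ (A N) (A N) N))))
           (trans (∑-+ (ns N) (λ i → on (0 ≟ i) c) (λ i → on (N ≟ i) c)) (cong₂ _+_
             (∑-δ _≟_ (ns-unique N) 0 (∈-ns⁺ N z≤n) (λ _ → c)) (∑-δ _≟_ (ns-unique N) N (∈-ns⁺ N ≤-refl) (λ _ → c))))) ⟩
    + 12 * (A N ⊗ A N) N + (c + c)
      ≡⟨ cong (λ v → + 12 * (A N ⊗ A N) N + v) (l₁ (A N N)) ⟩
    + 12 * (A N ⊗ A N) N + + 4 * A N N ∎
    where
    open ≡-Reasoning
    c : ℤ
    c = + 2 * A N N
    l₁ : ∀ x → + 2 * x + + 2 * x ≡ + 4 * x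
    l₁ = solve-∀
    U₀ : U N 0 ≡ + 1
    U₀ = trans (U-even N 0 z≤n (divides (+ 0) refl)) (R-independent (2 ℕ.* N) 0 0 z≤n z≤n)
    R≡ : ∀ i → 1 ≤ i → i ≤ N → R (2 ℕ.* N) i ≡ + 6 * A N i
    R≡ i 1≤i i≤N = R≡6A i (2 ℕ.* N) N i ≤-refl 1≤i (*-monoʳ-≤ 2 i≤N) i≤N
    even-value : ∀ i → 1 ≤ i → i ≤ N → + 2 ∣ + i → U N i ≡ + 6 * A N i
    even-value i 1≤i i≤N e = trans (U-even N i i≤N e) (R≡ i 1≤i i≤N)
    odd-value : ∀ i → 1 ≤ i → i ≤ N → ¬ + 2 ∣ + i → U N i ≡ + 2 * A N i
    odd-value i 1≤i i≤N o = ℤP.*-cancelˡ-≡ (+ 3) (U N i) (+ 2 * A N i) (trans (sym (U-odd N i i≤N o)) (trans (R≡ i 1≤i i≤N) (l₂ (A N i))))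
      where
      l₂ : ∀ x → + 6 * x ≡ + 3 * (+ 2 * x)
      l₂ = solve-∀
    pointwise : ∀ i → i ≤ N → U N i * U N (N ∸ i) ≡ + 12 * (A N i * A N (N ∸ i)) + (on (0 ≟ i) c + on (N ≟ i) c)
    pointwise zero _ = trans (cong₂ _*_ U₀ (odd-value N 1≤N ≤-refl odd)) (trans (l₃ c (A N N))
      (cong₂ (λ x y → + 12 * (x * A N N) + (c + y)) (sym (A-zero N)) (sym (on-no (N ≟ 0) (λ { refl → <-irrefl refl 1≤N })))))
      where
      l₃ : ∀ c x → + 1 * c ≡ + 12 * (+ 0 * x) + (c + + 0)
      l₃ = solve-∀
    pointwise i@(suc _) i≤N with m≤n⇒m<n∨m≡n i≤N
    ... | inj₂ refl = trans (cong₂ _*_ (odd-value N 1≤N ≤-refl odd) (trans (cong (U N) (n∸n≡0 N)) U₀)) (trans (l₃ c (A N N))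
      (cong₂ (λ x y → + 12 * (A N N * x) + (+ 0 + y)) (sym (trans (cong (A N) (n∸n≡0 N)) (A-zero N))) (sym (on-yes (N ≟ N) refl))))
      where
      l₃ : ∀ c x → c * + 1 ≡ + 12 * (x * + 0) + (+ 0 + c)
      l₃ = solve-∀
    ... | inj₁ i<N = trans interior (trans (l₃ (A N i * A N (N ∸ i))) (cong (λ y → + 12 * (A N i * A N (N ∸ i)) + (+ 0 + y)) (sym (on-no (N ≟ i) (λ { refl → <-irrefl refl i<N })))))
      where
      l₃ : ∀ x → + 12 * x ≡ + 12 * x + (+ 0 + + 0)
      l₃ = solve-∀
      l₄ : ∀ x y → + 6 * x * (+ 2 * y) ≡ + 12 * (x * y)
      l₄ = solve-∀
      l₅ : ∀ x y → + 2 * x * (+ 6 * y) ≡ + 12 * (x * y)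
      l₅ = solve-∀
      1≤N-i : 1 ≤ N ∸ i
      1≤N-i = m<n⇒0<n∸m i<N
      interior : U N i * U N (N ∸ i) ≡ + 12 * (A N i * A N (N ∸ i))
      interior with parityℕ i | parityℕ (N ∸ i)
      ... | inj₁ e | inj₁ e′ = ⊥-elim (odd (∣-cast (sym (+-∸ i≤N)) (even-+ e e′)))
      ... | inj₂ o | inj₂ o′ = ⊥-elim (odd (∣-cast (sym (+-∸ i≤N)) (odd-+ o o′)))
      ... | inj₁ e | inj₂ o  = trans (cong₂ _*_ (even-value i (s≤s z≤n) i≤N e) (odd-value (N ∸ i) 1≤N-i (m∸n≤m N i) o)) (l₄ (A N i) (A N (N ∸ i)))
      ... | inj₂ o | inj₁ e  = trans (cong₂ _*_ (odd-value i (s≤s z≤n) i≤N o) (even-value (N ∸ i) 1≤N-i (m∸n≤m N i) e)) (l₅ (A N i) (A N (N ∸ i)))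

  -- The end terms 4A(N) cancel against the -A(N) on the right of `convolution`, leaving four times
  -- the sum of the divisors prime to 3.
  U²≡4σ : ∀ N β n₁ → 1 ≤ N → ¬ + 2 ∣ + N → N ≡ 3 ℕ.^ β ℕ.* n₁ → ¬ (3 ℕD.∣ n₁) → (U N ⊗ U N) N ≡ + 4 * + σ n₁
  U²≡4σ N β n₁ 1≤N odd N≡ 3∤n₁ = trans (U²-coefficient N 1≤N odd) (trans (l₁ ((A N ⊗ A N) N) (A N N))
    (cong (λ v → + 4 * v) (trans (cong (λ v → v + A N N) (trans (convolution N) (cong (λ v → v - A N N) (σ-weighted N β n₁ 1≤N N≡ 3∤n₁)))) (l₂ (+ σ n₁) (A N N)))))
    where
    l₁ : ∀ x y → + 12 * x + + 4 * y ≡ + 4 * (+ 3 * x + y)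
    l₁ = solve-∀
    l₂ : ∀ x y → x - y + y ≡ x
    l₂ = solve-∀

  -- Triangular numbers and odd squares

  -- x (x - 1) is even and nonnegative, so the absolute value and the truncating division in `tri`
  -- are both exact.
  tri-double : ∀ x → + (tri x ℕ.* 2) ≡ x * (x - + 1)
  tri-double x = trans (cong +_ (trans (cong (λ v → v ℕ./ 2 ℕ.* 2) halves) (trans (cong (ℕ._* 2) (ℕDM.m*n/n≡m (proj₁ even) 2)) (sym halves)))) (nonnegative x)
    where
    even : ∃ λ k → ∣ x * (x - + 1) ∣ ≡ k ℕ.* 2
    even with square-parity x
    ... | k , e = ∣ k ∣ , trans (cong ∣_∣ (trans (lemma x) (trans (cong (λ v → v - x) e) (lemma′ x (k * + 2))))) (abs-* k (+ 2))
      where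
      lemma : ∀ x → x * (x - + 1) ≡ x * x - x
      lemma = solve-∀
      lemma′ : ∀ x y → x + y - x ≡ y
      lemma′ = solve-∀
    halves : ∣ x * (x - + 1) ∣ ≡ proj₁ even ℕ.* 2
    halves = proj₂ even
    nonnegative : ∀ x → + ∣ x * (x - + 1) ∣ ≡ x * (x - + 1)
    nonnegative (+ zero)  = refl
    nonnegative (+ suc n) = trans (cong (λ v → + ∣ v ∣) expanded) (sym expanded)
      where
      expanded : + suc n * (+ suc n - + 1) ≡ + (suc n ℕ.* n)
      expanded = sym (pos-* (suc n) n)
    nonnegative -[1+ n ] = refl

  -- Two bounds of different shape, as x(x - 1)/2 is symmetric about 1/2: a value at most n leaves
  -- room for x up to n + 1 but only down to -n, the ends of `box n`.
  ∣∣≤tri : ∀ j → j ≤ tri (+ suc j) × suc j ≤ tri -[1+ j ]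
  ∣∣≤tri j = ℕP.*-cancelʳ-≤ j (tri (+ suc j)) 2 (≤-trans (bound j) (≤-reflexive (sym (+-injective (trans (tri-double (+ suc j)) (sym (pos-* (suc j) j))))))) ,
    ℕP.*-cancelʳ-≤ (suc j) (tri -[1+ j ]) 2 (≤-trans (*-monoʳ-≤ (suc j) (s≤s (s≤s z≤n))) (≤-reflexive (sym (+-injective (trans (tri-double -[1+ j ]) (lemma (+ j)))))))
    where
    bound : ∀ j → j ℕ.* 2 ≤ suc j ℕ.* j
    bound zero    = z≤n
    bound (suc j) = ≤-trans (≤-reflexive (ℕP.*-comm (suc j) 2)) (ℕP.*-monoˡ-≤ (suc j) (s≤s (s≤s (z≤n {j}))))
    lemma : ∀ j → - (+ 1 + j) * (- (+ 1 + j) - + 1) ≡ (+ 1 + j) * (+ 2 + j)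
    lemma = solve-∀

  ∈-box : ∀ n x → tri x ≤ n → x ∈ box n
  ∈-box n x h = member x h
    where
    shift : ℕ → ℤ
    shift i = + i - + n
    member : ∀ x → tri x ≤ n → x ∈ box n
    member (+ zero) _ = subst (_∈ box n) (+-inverseʳ (+ n)) (∈-map⁺ shift (∈-upTo⁺
      (≤-trans (s≤s (m≤n*m n 2)) (≤-trans (≤-reflexive (ℕP.+-comm 1 (2 ℕ.* n))) (+-monoʳ-≤ (2 ℕ.* n) (s≤s z≤n))))))
    member (+ suc j) h = subst (_∈ box n) (lemma (+ suc j) (+ n)) (∈-map⁺ shift (∈-upTo⁺
      (≤-trans (s≤s (+-monoˡ-≤ n (s≤s (≤-trans (proj₁ (∣∣≤tri j)) h)))) (≤-reflexive (size n)))))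
      where
      lemma : ∀ x n → x + n - n ≡ x
      lemma = solve-∀
      size : ∀ n → suc (suc n ℕ.+ n) ≡ 2 ℕ.* n ℕ.+ 2
      size = ℕSolver.solve-∀
    member -[1+ j ] h = subst (_∈ box n) position (∈-map⁺ shift (∈-upTo⁺
      (≤-trans (s≤s (≤-trans (m∸n≤m n (suc j)) (m≤n*m n 2))) (≤-trans (≤-reflexive (ℕP.+-comm 1 (2 ℕ.* n))) (+-monoʳ-≤ (2 ℕ.* n) (s≤s z≤n))))))
      where
      lemma : ∀ n x → n - x - n ≡ - x
      lemma = solve-∀
      position : shift (n ∸ suc j) ≡ -[1+ j ]
      position = trans (cong (λ v → v - + n) (sym (trans (m-n≡m⊖n n (suc j)) (⊖-≥ (≤-trans (proj₂ (∣∣≤tri j)) h))))) (lemma (+ n) (+ suc j))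

  box-unique : ∀ n → Unique (box n)
  box-unique n = UniqueP.map⁺ (λ {i} {j} e → +-injective (+-cancelʳ-≡ (- + n) (+ i) (+ j) e)) (UniqueP.upTo⁺ (2 ℕ.* n ℕ.+ 2))

  -- Quadruples and sums of two values of x² + 3z²

  Quadruple : Set
  Quadruple = ℤ × ℤ × ℤ × ℤ

  _≟⁴_ : (p q : Quadruple) → Dec (p ≡ q)
  _≟⁴_ = ≡-dec ℤ._≟_ (≡-dec ℤ._≟_ _≟²_)

  quadruples : ℕ → List Quadruple
  quadruples n = cartesianProduct (box n) (cartesianProduct (box n) (cartesianProduct (box n) (box n)))

  quadruples-unique : ∀ n → Unique (quadruples n)
  quadruples-unique n = cartesianProduct⁺ (box-unique n) (cartesianProduct⁺ (box-unique n) (cartesianProduct⁺ (box-unique n) (box-unique n)))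

  ∑-quads : ∀ n (f : Quadruple → ℤ) → ∑ (quads (box n)) f ≡ ∑ (quadruples n) f
  ∑-quads n f = trans expand (sym collect)
    where
    b : List ℤ
    b = box n
    nested : ℤ
    nested = ∑ b (λ x → ∑ b (λ y → ∑ b (λ z → ∑ b (λ w → f (x , y , z , w)))))
    expand : ∑ (quads b) f ≡ nested
    expand = trans (∑-concatMap (λ x → concatMap (λ y → concatMap (λ z → map (λ w → (x , y , z , w)) b) b) b) b f)
      (∑-cong′ b (λ x → trans (∑-concatMap (λ y → concatMap (λ z → map (λ w → (x , y , z , w)) b) b) b f)
      (∑-cong′ b (λ y → trans (∑-concatMap (λ z → map (λ w → (x , y , z , w)) b) b f)
      (∑-cong′ b (λ z → ∑-map (λ w → (x , y , z , w)) b f))))))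
    collect : ∑ (quadruples n) f ≡ nested
    collect = trans (∑-× b (cartesianProduct b (cartesianProduct b b)) f)
      (∑-cong′ b (λ x → trans (∑-× b (cartesianProduct b b) (λ r → f (x , r)))
      (∑-cong′ b (λ y → ∑-× b b (λ r → f (x , y , r))))))

  Pair² : Set
  Pair² = (ℤ × ℤ) × (ℤ × ℤ)

  grid² : ℕ → List Pair²
  grid² N = cartesianProduct (grid N) (grid N)

  Rep : ℕ → Pair² → Set
  Rep N (p , q) = form p ℕ.+ form q ≡ N

  rep²? : ∀ N → Decidable (Rep N)
  rep²? N (p , q) = form p ℕ.+ form q ≟ N

  OddEven : Pair² → Set
  OddEven ((x , z) , (y , w)) = (¬ (+ 2 ∣ z)) × (+ 2 ∣ w)

  oddEven? : Decidable OddEven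
  oddEven? ((x , z) , (y , w)) = ¬? ((+ 2) ∣? z) ×-dec ((+ 2) ∣? w)

  G : ℕ → ℤ
  G N = ∑ (grid² N) (λ r → on (rep²? N r ×-dec oddEven? r) (+ 1))

  -- Each representation has weight 1 - (-1)^(z + w), which is 2 when z and w have opposite parity
  -- and 0 otherwise. Exchanging the two pairs identifies the cases z odd and w odd, which doubles
  -- once more.
  U²-T² : ∀ N → (U N ⊗ U N) N - (T N ⊗ T N) N ≡ + 4 * G N
  U²-T² N = begin
    (U N ⊗ U N) N - (T N ⊗ T N) N
      ≡⟨ cong₂ _-_ (gen-⊗ (grid N) (grid N) form form (λ _ → + 1) (λ _ → + 1) N) (gen-⊗ (grid N) (grid N) form form σ₁ σ₁ N) ⟩
    ∑ (grid² N) (λ r → on (rep²? N r) (+ 1)) - ∑ (grid² N) (λ r → on (rep²? N r) (sgn² r))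
      ≡⟨ cong (λ v → ∑ (grid² N) (λ r → on (rep²? N r) (+ 1)) + v) (sym (trans (∑-*ˡ (grid² N) (- + 1) (λ r → on (rep²? N r) (sgn² r))) (-1*i≡-i _))) ⟩
    ∑ (grid² N) (λ r → on (rep²? N r) (+ 1)) + ∑ (grid² N) (λ r → - + 1 * on (rep²? N r) (sgn² r))
      ≡⟨ sym (∑-+ (grid² N) (λ r → on (rep²? N r) (+ 1)) (λ r → - + 1 * on (rep²? N r) (sgn² r))) ⟩
    ∑ (grid² N) (λ r → on (rep²? N r) (+ 1) + - + 1 * on (rep²? N r) (sgn² r))
      ≡⟨ ∑-cong′ (grid² N) pointwise ⟩
    ∑ (grid² N) (λ r → + 2 * on (rep²? N r ×-dec oddEven? r) (+ 1) + + 2 * on (rep²? N r ×-dec oddEven? (flip r)) (+ 1))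
      ≡⟨ trans (∑-+ (grid² N) (λ r → + 2 * on (rep²? N r ×-dec oddEven? r) (+ 1)) (λ r → + 2 * on (rep²? N r ×-dec oddEven? (flip r)) (+ 1)))
           (cong₂ _+_ (∑-*ˡ (grid² N) (+ 2) (λ r → on (rep²? N r ×-dec oddEven? r) (+ 1))) (trans (∑-*ˡ (grid² N) (+ 2) (λ r → on (rep²? N r ×-dec oddEven? (flip r)) (+ 1))) (cong (λ v → + 2 * v) flipped))) ⟩
    + 2 * G N + + 2 * G N
      ≡⟨ lemma (G N) ⟩
    + 4 * G N ∎
    where
    open ≡-Reasoning
    lemma : ∀ g → + 2 * g + + 2 * g ≡ + 4 * g
    lemma = solve-∀
    σ₁ : ℤ × ℤ → ℤ
    σ₁ (x , z) = sign z
    sgn² : Pair² → ℤ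
    sgn² ((x , z) , (y , w)) = sign z * sign w
    flip : Pair² → Pair²
    flip (p , q) = q , p
    flip-∈ : ∀ r → r ∈ grid² N → flip r ∈ grid² N
    flip-∈ (p , q) m = let a , b = ∈-cartesianProduct⁻ (grid N) (grid N) m in ∈-cartesianProduct⁺ b a
    flipped : ∑ (grid² N) (λ r → on (rep²? N r ×-dec oddEven? (flip r)) (+ 1)) ≡ G N
    flipped = ∑-bijection (≡-dec _≟²_ _≟²_) (≡-dec _≟²_ _≟²_) (cartesianProduct⁺ (grid-unique N) (grid-unique N)) (cartesianProduct⁺ (grid-unique N) (grid-unique N))
      (λ r → rep²? N r ×-dec oddEven? (flip r)) (λ r → rep²? N r ×-dec oddEven? r) (λ _ → + 1) (λ _ → + 1) flip
      (λ (p , q) m (h , o) → flip-∈ (p , q) m , (trans (ℕP.+-comm (form q) (form p)) h , o) , refl)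
      (λ { (p , q) (p′ , q′) _ _ refl → refl })
      (λ (p , q) m (h , o) → (q , p) , flip-∈ (p , q) m , (trans (ℕP.+-comm (form q) (form p)) h , o) , refl)
    pointwise : ∀ r → on (rep²? N r) (+ 1) + - + 1 * on (rep²? N r) (sgn² r) ≡
      + 2 * on (rep²? N r ×-dec oddEven? r) (+ 1) + + 2 * on (rep²? N r ×-dec oddEven? (flip r)) (+ 1)
    pointwise r@((x , z) , (y , w)) = go (rep²? N r) ((+ 2) ∣? z) ((+ 2) ∣? w)
      where
      go : {P : Set} (d : Dec P) (ez : Dec (+ 2 ∣ z)) (ew : Dec (+ 2 ∣ w)) →
        on d (+ 1) + - + 1 * on d (sign z * sign w) ≡
        + 2 * on (d ×-dec (¬? ez ×-dec ew)) (+ 1) + + 2 * on (d ×-dec (¬? ew ×-dec ez)) (+ 1)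
      go (no _)  _        _        = refl
      go (yes _) (yes ez) (yes ew) rewrite sign-even′ ez | sign-even′ ew = refl
      go (yes _) (yes ez) (no ow)  rewrite sign-even′ ez | sign-odd′ ow = refl
      go (yes _) (no oz)  (yes ew) rewrite sign-odd′ oz | sign-even′ ew = refl
      go (yes _) (no oz)  (no ow)  rewrite sign-odd′ oz | sign-odd′ ow = refl

  weight : Quadruple → ℕ
  weight (x , y , z , w) = 1 ℕ.* tri x ℕ.+ 1 ℕ.* tri y ℕ.+ 3 ℕ.* tri z ℕ.+ 12 ℕ.* tri w

  -- Based on 8 tri(x) + 1 = (2x - 1)². The last square has coefficient 12 = 3 · 2², hence the extra
  -- factor 2 in the last entry, and 17 = 1 + 1 + 3 + 12.
  oddSquares : Quadruple → Pair²
  oddSquares (x , y , z , w) = (x * + 2 - + 1 , z * + 2 - + 1) , (y * + 2 - + 1 , (w * + 2 - + 1) * + 2)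

  rank : Pair² → ℕ
  rank (p , q) = form p ℕ.+ form q

  rank-oddSquares : ∀ q → rank (oddSquares q) ≡ 8 ℕ.* weight q ℕ.+ 17
  rank-oddSquares (x , y , z , w) = +-injective (trans (cong₂ _+_ (+form (x * + 2 - + 1) (z * + 2 - + 1)) (+form (y * + 2 - + 1) ((w * + 2 - + 1) * + 2)))
    (trans (l₁ x y z w) (trans (cong (λ v → + 4 * v + + 17) (cong₂ _+_ (cong₂ _+_ (cong₂ _+_ (double x) (double y)) (cong (λ v → + 3 * v) (double z))) (cong (λ v → + 12 * v) (double w))))
    (trans (l₂ (+ tri x) (+ tri y) (+ tri z) (+ tri w)) (sym +weight)))))
    where
    double : ∀ x → x * (x - + 1) ≡ + tri x * + 2
    double x = trans (sym (tri-double x)) (pos-* (tri x) 2)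
    l₁ : ∀ x y z w → (x * + 2 - + 1) * (x * + 2 - + 1) + + 3 * ((z * + 2 - + 1) * (z * + 2 - + 1)) +
      ((y * + 2 - + 1) * (y * + 2 - + 1) + + 3 * ((w * + 2 - + 1) * + 2 * ((w * + 2 - + 1) * + 2))) ≡
      + 4 * (x * (x - + 1) + y * (y - + 1) + + 3 * (z * (z - + 1)) + + 12 * (w * (w - + 1))) + + 17
    l₁ = solve-∀
    l₂ : ∀ x y z w → + 4 * (x * + 2 + y * + 2 + + 3 * (z * + 2) + + 12 * (w * + 2)) + + 17 ≡
      + 8 * (+ 1 * x + + 1 * y + + 3 * z + + 12 * w) + + 17
    l₂ = solve-∀
    +weight : + (8 ℕ.* weight (x , y , z , w) ℕ.+ 17) ≡ + 8 * (+ 1 * + tri x + + 1 * + tri y + + 3 * + tri z + + 12 * + tri w) + + 17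
    +weight = cong (λ v → v + + 17) (trans (pos-* 8 (weight (x , y , z , w))) (cong (λ v → + 8 * v)
      (cong₂ _+_ (cong₂ _+_ (cong₂ _+_ (pos-* 1 (tri x)) (pos-* 1 (tri y))) (pos-* 3 (tri z))) (pos-* 12 (tri w)))))

  oddSquares-injective : ∀ q q′ → oddSquares q ≡ oddSquares q′ → q ≡ q′
  oddSquares-injective (x , y , z , w) (x′ , y′ , z′ , w′) e = cong₂ _,_ (unshift x x′ (cong (λ r → proj₁ (proj₁ r)) e))
    (cong₂ _,_ (unshift y y′ (cong (λ r → proj₁ (proj₂ r)) e)) (cong₂ _,_ (unshift z z′ (cong (λ r → proj₂ (proj₁ r)) e))
      (unshift w w′ (ℤP.*-cancelʳ-≡ (w * + 2 - + 1) (w′ * + 2 - + 1) (+ 2) (cong (λ r → proj₂ (proj₂ r)) e)))))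
    where
    unshift : ∀ x x′ → x * + 2 - + 1 ≡ x′ * + 2 - + 1 → x ≡ x′
    unshift x x′ e = ℤP.*-cancelʳ-≡ x x′ (+ 2) (+-cancelʳ-≡ (- + 1) (x * + 2) (x′ * + 2) e)

  odd-square : ∀ k → ∃ λ l → (k * + 2 + + 1) * (k * + 2 + + 1) ≡ + 8 * l + + 1
  odd-square k with square-parity k
  ... | j , e = k + j , trans (lemma k) (trans (cong (λ v → + 4 * v + + 4 * k + + 1) e) (lemma′ k j))
    where
    lemma : ∀ k → (k * + 2 + + 1) * (k * + 2 + + 1) ≡ + 4 * (k * k) + + 4 * k + + 1
    lemma = solve-∀
    lemma′ : ∀ k j → + 4 * (k + j * + 2) + + 4 * k + + 1 ≡ + 8 * (k + j) + + 1
    lemma′ = solve-∀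

  -- Reduction modulo 8.
  parities : ∀ n x y c d → x * x + + 3 * ((c * + 2 + + 1) * (c * + 2 + + 1)) + (y * y + + 3 * (d * + 2 * (d * + 2))) ≡ + 8 * n + + 17 →
    ∃ λ a → ∃ λ b → ∃ λ m → x ≡ a * + 2 + + 1 × y ≡ b * + 2 + + 1 × d ≡ m * + 2 + + 1
  parities n x y c d e with odd-square c
  ... | k , ek with parity x | parity y
  -- With x and y even the left side is 3 modulo 4, while 8n + 17 is 1.
  ... | inj₁ (a , refl) | inj₁ (b , refl) = ⊥-elim (odd≢even (+ 2 * n + + 3 - + 6 * k) (a * a + b * b + + 3 * (d * d))
    (ℤP.*-cancelʳ-≡ ((+ 2 * n + + 3 - + 6 * k) * + 2 + + 1) ((a * a + b * b + + 3 * (d * d)) * + 2) (+ 2)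
      (trans (l₁ n k) (trans (cong (λ v → v - (+ 24 * k + + 3)) (sym e)) (trans (cong (λ v → a * + 2 * (a * + 2) + + 3 * v + (b * + 2 * (b * + 2) + + 3 * (d * + 2 * (d * + 2))) - (+ 24 * k + + 3)) ek) (l₂ a b d k))))))
    where
    l₁ : ∀ n k → ((+ 2 * n + + 3 - + 6 * k) * + 2 + + 1) * + 2 ≡ + 8 * n + + 17 - (+ 24 * k + + 3)
    l₁ = solve-∀
    l₂ : ∀ a b d k → a * + 2 * (a * + 2) + + 3 * (+ 8 * k + + 1) + (b * + 2 * (b * + 2) + + 3 * (d * + 2 * (d * + 2))) - (+ 24 * k + + 3) ≡
      (a * a + b * b + + 3 * (d * d)) * + 2 * + 2
    l₂ = solve-∀
  -- If just one of x and y is odd, the left side is even and the right side odd.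
  ... | inj₁ (a , refl) | inj₂ (b , refl) with odd-square b
  ... | l , el = ⊥-elim (odd≢even (+ 4 * n + + 8) (+ 2 * (a * a) + + 12 * k + + 4 * l + + 6 * (d * d) + + 2)
    (trans (l₁ n) (trans (sym e) (trans (cong₂ (λ u v → a * + 2 * (a * + 2) + + 3 * u + (v + + 3 * (d * + 2 * (d * + 2)))) ek el) (l₂ a d k l)))))
    where
    l₁ : ∀ n → (+ 4 * n + + 8) * + 2 + + 1 ≡ + 8 * n + + 17
    l₁ = solve-∀
    l₂ : ∀ a d k l → a * + 2 * (a * + 2) + + 3 * (+ 8 * k + + 1) + (+ 8 * l + + 1 + + 3 * (d * + 2 * (d * + 2))) ≡
      (+ 2 * (a * a) + + 12 * k + + 4 * l + + 6 * (d * d) + + 2) * + 2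
    l₂ = solve-∀
  parities n x y c d e | k , ek | inj₂ (a , refl) | inj₁ (b , refl) with odd-square a
  ... | l , el = ⊥-elim (odd≢even (+ 4 * n + + 8) (+ 2 * (b * b) + + 12 * k + + 4 * l + + 6 * (d * d) + + 2)
    (trans (l₁ n) (trans (sym e) (trans (cong₂ (λ u v → v + + 3 * u + (b * + 2 * (b * + 2) + + 3 * (d * + 2 * (d * + 2)))) ek el) (l₂ b d k l)))))
    where
    l₁ : ∀ n → (+ 4 * n + + 8) * + 2 + + 1 ≡ + 8 * n + + 17
    l₁ = solve-∀
    l₂ : ∀ b d k l → + 8 * l + + 1 + + 3 * (+ 8 * k + + 1) + (b * + 2 * (b * + 2) + + 3 * (d * + 2 * (d * + 2))) ≡
      (+ 2 * (b * b) + + 12 * k + + 4 * l + + 6 * (d * d) + + 2) * + 2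
    l₂ = solve-∀
  parities n x y c d e | k , ek | inj₂ (a , refl) | inj₂ (b , refl) with odd-square a | odd-square b | parity d
  ... | _ | _ | inj₂ (m , refl) = a , b , m , refl , refl , refl
  -- With x and y odd and d even the left side is 1 + 3 + 1 = 5 modulo 8, while 8n + 17 is 1.
  ... | r , er | s , es | inj₁ (m , refl) = ⊥-elim (odd≢even (n + + 1 - r - s - + 3 * k) (+ 3 * (m * m) * + 2)
    (ℤP.*-cancelʳ-≡ ((n + + 1 - r - s - + 3 * k) * + 2 + + 1) (+ 3 * (m * m) * + 2 * + 2) (+ 4)
      (trans (l₁ n r s k) (trans (cong (λ v → v - (+ 8 * r + + 8 * s + + 24 * k + + 5)) (sym e))
        (trans (cong₂ (λ u v → u + v - (+ 8 * r + + 8 * s + + 24 * k + + 5)) (cong₂ (λ u v → u + + 3 * v) er ek) (cong (λ v → v + + 3 * (m * + 2 * + 2 * (m * + 2 * + 2))) es)) (l₂ m r s k))))))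
    where
    l₁ : ∀ n r s k → ((n + + 1 - r - s - + 3 * k) * + 2 + + 1) * + 4 ≡ + 8 * n + + 17 - (+ 8 * r + + 8 * s + + 24 * k + + 5)
    l₁ = solve-∀
    l₂ : ∀ m r s k → + 8 * r + + 1 + + 3 * (+ 8 * k + + 1) + (+ 8 * s + + 1 + + 3 * (m * + 2 * + 2 * (m * + 2 * + 2))) - (+ 8 * r + + 8 * s + + 24 * k + + 5) ≡
      + 3 * (m * m) * + 2 * + 2 * + 4
    l₂ = solve-∀

  -- Once z is odd and w even, the congruence modulo 8 makes x, y and w/2 odd as well, so every
  -- representation counted by `G` comes from a quadruple of triangular numbers.
  t≡G : ∀ n → + t 1 1 3 12 n ≡ G (8 ℕ.* n ℕ.+ 17)
  t≡G n = trans (∑-filter _ (quads (box n))) (trans (∑-quads n _) (trans (∑-cong′ (quadruples n) (λ (x , y , z , w) → refl))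
    (sym (∑-bijection (≡-dec _≟²_ _≟²_) _≟⁴_ (cartesianProduct⁺ (grid-unique N) (grid-unique N)) (quadruples-unique n)
      (λ r → rep²? N r ×-dec oddEven? r) (λ q → weight q ≟ n) (λ _ → + 1) (λ _ → + 1) oddSquares into
      (λ q q′ _ _ → oddSquares-injective q q′) onto))))
    where
    N : ℕ
    N = 8 ℕ.* n ℕ.+ 17
    into : ∀ q → q ∈ quadruples n → weight q ≡ n → oddSquares q ∈ grid² N × (Rep N (oddSquares q) × OddEven (oddSquares q)) × + 1 ≡ + 1
    into q@(x , y , z , w) _ h =
      ∈-cartesianProduct⁺ (∈-grid⁺ N _ (form-bounded (proj₁ (oddSquares q)) refl (≤-trans (m≤m+n _ _) (≤-reflexive r))))
                          (∈-grid⁺ N _ (form-bounded (proj₂ (oddSquares q)) refl (≤-trans (m≤n+m _ (form (proj₁ (oddSquares q)))) (≤-reflexive r)))) ,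
      (r , ((λ { (divides l e) → odd≢even (z - + 1) l (trans (lemma z) e) }) , divides (w * + 2 - + 1) refl)) , refl
      where
      r : rank (oddSquares q) ≡ N
      r = trans (rank-oddSquares q) (cong (λ v → 8 ℕ.* v ℕ.+ 17) h)
      lemma : ∀ z → (z - + 1) * + 2 + + 1 ≡ z * + 2 - + 1
      lemma = solve-∀
    onto : ∀ r → r ∈ grid² N → Rep N r × OddEven r → ∃ λ q → q ∈ quadruples n × weight q ≡ n × oddSquares q ≡ r
    onto ((X , Z) , (Y , W)) _ (h , (oz , divides d refl)) with 2∤⇒odd oz
    ... | c , refl with parities (+ n) X Y c d (trans (cong₂ _+_ (sym (+form X (c * + 2 + + 1))) (sym (+form Y (d * + 2)))) (trans (cong +_ h) (cong (λ v → v + + 17) (pos-* 8 n))))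
    ... | a , b , m , refl , refl , refl = q , member , weight≡ , position
      where
      q : Quadruple
      q = a + + 1 , b + + 1 , c + + 1 , m + + 1
      lemma : ∀ a → (a + + 1) * + 2 - + 1 ≡ a * + 2 + + 1
      lemma = solve-∀
      position : oddSquares q ≡ ((a * + 2 + + 1 , c * + 2 + + 1) , (b * + 2 + + 1 , (m * + 2 + + 1) * + 2))
      position = cong₂ _,_ (cong₂ _,_ (lemma a) (lemma c)) (cong₂ _,_ (lemma b) (cong (λ v → v * + 2) (lemma m)))
      weight≡ : weight q ≡ n
      weight≡ = ℕP.*-cancelˡ-≡ (weight q) n 8 (ℕP.+-cancelʳ-≡ 17 (8 ℕ.* weight q) (8 ℕ.* n) (trans (sym (rank-oddSquares q)) (trans (cong rank position) h)))
      tx ty tz tw : ℕ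
      tx = tri (a + + 1)
      ty = tri (b + + 1)
      tz = tri (c + + 1)
      tw = tri (m + + 1)
      member : q ∈ quadruples n
      member = ∈-cartesianProduct⁺ (∈-box n (a + + 1) (below (≤-trans (m≤n*m tx 1) (≤-trans (m≤m+n _ (1 ℕ.* ty)) (≤-trans (m≤m+n _ (3 ℕ.* tz)) (m≤m+n _ (12 ℕ.* tw)))))))
        (∈-cartesianProduct⁺ (∈-box n (b + + 1) (below (≤-trans (m≤n*m ty 1) (≤-trans (m≤n+m _ (1 ℕ.* tx)) (≤-trans (m≤m+n _ (3 ℕ.* tz)) (m≤m+n _ (12 ℕ.* tw)))))))
        (∈-cartesianProduct⁺ (∈-box n (c + + 1) (below (≤-trans (m≤n*m tz 3) (≤-trans (m≤n+m _ (1 ℕ.* tx ℕ.+ 1 ℕ.* ty)) (m≤m+n _ (12 ℕ.* tw))))))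
          (∈-box n (m + + 1) (below (≤-trans (m≤n*m tw 12) (m≤n+m _ (1 ℕ.* tx ℕ.+ 1 ℕ.* ty ℕ.+ 3 ℕ.* tz)))))))
        where
        below : ∀ {k} → k ≤ weight q → k ≤ n
        below {k} = subst (k ≤_) weight≡

  -- Comparison of the coefficients of U² and T² at 8n + 17

  theorem : ∀ n β n₁ → 8 ℕ.* n ℕ.+ 17 ≡ 3 ℕ.^ β ℕ.* n₁ → ¬ (3 ℕD.∣ n₁) →
    + t 1 1 3 12 n ≡ + σ n₁ - a (8 ℕ.* n ℕ.+ 17)
  theorem n β n₁ N≡ 3∤n₁ = trans (t≡G n) (ℤP.*-cancelˡ-≡ (+ 4) (G N) (+ σ n₁ - a N) (trans (sym (U²-T² N))
    (trans (cong₂ _-_ (U²≡4σ N β n₁ 1≤N odd N≡ 3∤n₁) T²) (lemma (+ σ n₁) (a N)))))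
    where
    N : ℕ
    N = 8 ℕ.* n ℕ.+ 17
    lemma : ∀ x y → + 4 * x - + 4 * y ≡ + 4 * (x - y)
    lemma = solve-∀
    successor : N ≡ suc (8 ℕ.* n ℕ.+ 16)
    successor = +-suc (8 ℕ.* n) 16
    1≤N : 1 ≤ N
    1≤N = subst (1 ≤_) (sym successor) (s≤s z≤n)
    odd : ¬ + 2 ∣ + N
    odd (divides j e) = odd≢even (+ 4 * + n + + 8) j (trans (l₁ (+ n)) (trans (cong (λ v → v + + 17) (sym (pos-* 8 n))) e))
      where
      l₁ : ∀ n → (+ 4 * n + + 8) * + 2 + + 1 ≡ + 8 * n + + 17
      l₁ = solve-∀
    T² : (T N ⊗ T N) N ≡ + 4 * a N
    T² = subst (λ N → (T N ⊗ T N) N ≡ + 4 * a N) (sym successor) (T²≡4a (8 ℕ.* n ℕ.+ 16) (subst (λ N → ¬ + 2 ∣ + N) successor odd))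

open import Defs
open import Data.Nat using (ℕ; _+_; _*_; _^_; _≤_)
open import Data.Nat.Divisibility using (_∣_)
open import Data.Integer using (ℤ; +_; _-_)
open import Relation.Binary.PropositionalEquality using (_≡_)
open import Relation.Nullary using (¬_)

theorem4p6 : (n β n₁ : ℕ) → 1 ≤ n → 8 * n + 17 ≡ 3 ^ β * n₁ → ¬ (3 ∣ n₁) →
    + (t 1 1 3 12 n) ≡ + (σ n₁) - a (8 * n + 17)
theorem4p6 n β n₁ _ = Representations.theorem n β n₁
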